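{- Define vectors $(a_i,b_i,c_i)$, $i\ge0$, of formal power series in $x$ by $(a_0,b_0,c_0)=(tx,x^2,x)$ and, for $i>0$, $a_i=tx\exp(a_{i-1}+b_{i-1})\cosh(c_{i-1})$, $b_i=x\exp(a_{i-1}+b_{i-1})\sinh(c_{i-1})$, $c_i=x\exp(t^{ -1}a_{i-1}+tb_{i-1}+c_{i-1})$. Then $(a_i,b_i,c_i)$ converges (coefficientwise) to a vector $(a_\infty,b_\infty,c_\infty)$ of formal power series in $x$ with coefficients in $\mathbb{Q}[t]$, and $\mathscr T_w^+=a_\infty$, $\mathscr T_w^-=b_\infty$, $\mathscr T_b=c_\infty$, $\mathscr T=a_\infty+b_\infty+c_\infty$.
   Context: A rooted tree is a finite tree with a distinguished root; $\operatorname{Aut}T$ denotes root-preserving automorphisms, and sums over rooted trees are over isomorphism classes. A coloring of $T$ is a map $c\colon V(T)\to\{0,1\}$ ($0$ white, $1$ black); a vertex is even-white if it is white with an even number of black neighbors; the black-white polynomial is $W_T(t)=\sum_c t^{\#\{\text{even-white vertices}\}}$. Let $\mathscr T(x)=\sum_T W_T(t)x^{v(T)}/|\operatorname{Aut}T|$, where $v(T)$ is the number of vertices. Decompose $\mathscr T=\mathscr T_w^++\mathscr T_w^-+\mathscr T_b$, where $\mathscr T_w^+$ (resp. $\mathscr T_w^-$, $\mathscr T_b$) is $\sum_{(T,c)}t^{\#\{\text{even-white vertices of }c\}}x^{v(T)}/|\operatorname{Aut}T|$ summed over rooted trees $T$ and colorings $c$ in which the root is white with an even number of black children (resp. the root is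 white with an odd number of black children; resp. the root is black). -}

module Defs where

open import Data.Bool using (Bool; true; false; _∧_; _∨_; not; if_then_else_; _xor_)
open import Data.Nat as ℕ using (ℕ; zero; suc; _∸_; _⊔_; _≡ᵇ_; _!)
open import Data.Integer as ℤ using (ℤ; +_; -[1+_])
open import Data.Rational as ℚ using (ℚ; 0ℚ; 1ℚ)
open import Data.Fin using (Fin; zero; suc; toℕ)
open import Data.List using (List; []; _∷_; _++_; map; foldr; upTo; allFin; concatMap; replicate; length)
open import Data.List.Relation.Unary.Any using (Any)
open import Data.List.Relation.Unary.AllPairs using (AllPairs)
import Data.Vec.Functional as VF
open import Data.Product using (Σ; _×_)
open import Function.Bundles using (_↔_; Inverse)
open import Relation.Binary.PropositionalEquality using (_≡_)
open import Relation.Nullary using (¬_)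

-- Laurent polynomials in t over ℚ:  mkLP low cs  =  Σ_j cs[j] t^(j - low)

addL : List ℚ → List ℚ → List ℚ
addL [] ys = ys
addL (x ∷ xs) [] = x ∷ xs
addL (x ∷ xs) (y ∷ ys) = (x ℚ.+ y) ∷ addL xs ys

scaleL : ℚ → List ℚ → List ℚ
scaleL q = map (q ℚ.*_)

mulL : List ℚ → List ℚ → List ℚ
mulL [] ys = []
mulL (x ∷ xs) ys = addL (scaleL x ys) (0ℚ ∷ mulL xs ys)

record LP : Set where
  constructor mkLP
  field
    low : ℕ
    cs  : List ℚ
open LP public

nthℚ : List ℚ → ℕ → ℚ
nthℚ [] _ = 0ℚ
nthℚ (x ∷ xs) zero = x
nthℚ (x ∷ xs) (suc n) = nthℚ xs n

coeff : LP → ℤ → ℚ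
coeff p k with k ℤ.+ (+ low p)
... | + j = nthℚ (cs p) j
... | -[1+ _ ] = 0ℚ

_≈_ : LP → LP → Set
p ≈ q = ∀ k → coeff p k ≡ coeff q k

padTo : ℕ → LP → List ℚ
padTo l p = replicate (l ∸ low p) 0ℚ ++ cs p

lpAdd : LP → LP → LP
lpAdd p q = mkLP l (addL (padTo l p) (padTo l q))
  where l = low p ⊔ low q

lpMul : LP → LP → LP
lpMul p q = mkLP (low p ℕ.+ low q) (mulL (cs p) (cs q))

lp0 lp1 tLP tinvLP : LP
lp0 = mkLP 0 []
lp1 = mkLP 0 (1ℚ ∷ [])
tLP = mkLP 0 (0ℚ ∷ 1ℚ ∷ [])
tinvLP = mkLP 1 (1ℚ ∷ [])

lpConst : ℚ → LP
lpConst q = mkLP 0 (q ∷ [])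

tpow : ℕ → LP
tpow k = mkLP 0 (replicate k 0ℚ ++ (1ℚ ∷ []))

sumLP : List LP → LP
sumLP = foldr lpAdd lp0

-- 1/n as a rational (n ≥ 1 in all uses; 1/0 := 0 is never used)
invNat : ℕ → ℚ
invNat zero = 0ℚ
invNat (suc k) = + 1 ℚ./ suc k

isEven : ℕ → Bool
isEven zero = true
isEven (suc zero) = false
isEven (suc (suc n)) = isEven n

-- Formal power series in x with Laurent-polynomial coefficients
-- (f n = coefficient of x^n)

PS : Set
PS = ℕ → LP

psOne : PS
psOne zero = lp1
psOne (suc _) = lp0

X : PS
X (suc zero) = lp1
X _ = lp0

psAdd : PS → PS → PS
psAdd f g n = lpAdd (f n) (g n)

psScale : LP → PS → PS
psScale c f n = lpMul c (f n)

psMul : PS → PS → PS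
psMul f g n = sumLP (map (λ j → lpMul (f j) (g (n ∸ j))) (upTo (suc n)))

psPow : PS → ℕ → PS
psPow f zero = psOne
psPow f (suc k) = psMul f (psPow f k)

-- Σ_{k ∈ sel} f^k / k!  (for series f with zero constant term, as here;
-- the terms k > n do not contribute to the coefficient of x^n)
expLike : (ℕ → Bool) → PS → PS
expLike sel f n =
  sumLP (map (λ k → if sel k then lpMul (lpConst (invNat (k !))) (psPow f k n) else lp0)
             (upTo (suc n)))

expS coshS sinhS : PS → PS
expS = expLike (λ _ → true)
coshS = expLike isEven
sinhS = expLike (λ k → not (isEven k))

record Triple : Set where
  constructor ⟨_,_,_⟩
  field
    A B C : PS
open Triple public

initT : Triple
initT = ⟨ psScale tLP X , psMul X X , X ⟩

stepT : Triple → Triple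
stepT ⟨ a , b , c ⟩ =
  ⟨ psMul (psScale tLP X) (psMul (expS (psAdd a b)) (coshS c))
  , psMul X (psMul (expS (psAdd a b)) (sinhS c))
  , psMul X (expS (psAdd (psScale tinvLP a) (psAdd (psScale tLP b) c))) ⟩

iterT : ℕ → Triple
iterT zero = initT
iterT (suc i) = stepT (iterT i)

-- Rooted trees.  RTree n : a rooted tree on vertex set Fin (suc n), root 0,
-- where vertex (suc i) has parent  T i  ∈ {0,…,i}.  Every finite rooted tree
-- with n+1 vertices is isomorphic to such a tree (label in BFS order).

RTree : ℕ → Set
RTree n = (i : Fin n) → Fin (suc (toℕ i))

isParent : ∀ {n} → RTree n → Fin (suc n) → Fin (suc n) → Bool
isParent T u zero = false
isParent T u (suc i) = toℕ (T i) ≡ᵇ toℕ u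

adj : ∀ {n} → RTree n → Fin (suc n) → Fin (suc n) → Bool
adj T u v = isParent T u v ∨ isParent T v u

_≅_ : ∀ {n} → RTree n → RTree n → Set
_≅_ {n} T T' = Σ (Fin (suc n) ↔ Fin (suc n)) λ σ →
  (Inverse.to σ zero ≡ zero) ×
  (∀ u v → adj T u v ≡ adj T' (Inverse.to σ u) (Inverse.to σ v))

IsTransversal : ∀ {n} → List (RTree n) → Set
IsTransversal {n} L = (∀ (T : RTree n) → Any (T ≅_) L) × AllPairs (λ T T' → ¬ (T ≅ T')) L

allFuns : ∀ {A : Set} (n : ℕ) → List A → List (Fin n → A)
allFuns zero xs = (λ ()) ∷ []
allFuns (suc n) xs = concatMap (λ f → map (λ a → a VF.∷ f) xs) (allFuns n xs)

countB : ∀ {A : Set} → (A → Bool) → List A → ℕ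
countB p xs = foldr (λ x r → if p x then suc r else r) 0 xs

eqFin : ∀ {n} → Fin n → Fin n → Bool
eqFin u v = toℕ u ≡ᵇ toℕ v

eqB : Bool → Bool → Bool
eqB a b = not (a xor b)

allB : ∀ {A : Set} → (A → Bool) → List A → Bool
allB p = foldr (λ x r → p x ∧ r) true

isAut : ∀ {n} → RTree n → (Fin (suc n) → Fin (suc n)) → Bool
isAut {n} T f = eqFin (f zero) zero ∧
  allB (λ u → allB (λ v → (eqFin u v ∨ not (eqFin (f u) (f v))) ∧
                          eqB (adj T u v) (adj T (f u) (f v)))
                 (allFin (suc n)))
      (allFin (suc n))

autCount : ∀ {n} → RTree n → ℕ
autCount {n} T = countB (isAut T) (allFuns (suc n) (allFin (suc n)))

-- colorings: true = black, false = white
Coloring : ℕ → Set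
Coloring n = Fin (suc n) → Bool

colorings : (n : ℕ) → List (Coloring n)
colorings n = allFuns (suc n) (false ∷ true ∷ [])

blackNbrs : ∀ {n} → RTree n → Coloring n → Fin (suc n) → ℕ
blackNbrs {n} T c v = countB (λ u → adj T v u ∧ c u) (allFin (suc n))

evenWhite : ∀ {n} → RTree n → Coloring n → Fin (suc n) → Bool
evenWhite T c v = not (c v) ∧ isEven (blackNbrs T c v)

numEvenWhite : ∀ {n} → RTree n → Coloring n → ℕ
numEvenWhite {n} T c = countB (evenWhite T c) (allFin (suc n))

-- root classes (the neighbours of the root are exactly its children)
rootWhiteEven rootWhiteOdd rootBlack anyRoot : ∀ {n} → RTree n → Coloring n → Bool
rootWhiteEven T c = not (c zero) ∧ isEven (blackNbrs T c zero)
rootWhiteOdd T c = not (c zero) ∧ not (isEven (blackNbrs T c zero))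
rootBlack T c = c zero
anyRoot T c = true

treeTerm : ∀ {n} → (RTree n → Coloring n → Bool) → RTree n → LP
treeTerm {n} sel T =
  lpMul (lpConst (invNat (autCount T)))
        (sumLP (map (λ c → if sel T c then tpow (numEvenWhite T c) else lp0) (colorings n)))

-- coefficient of x^(n+1), summed over a transversal L of isomorphism classes
treeSum : ∀ {n} → (RTree n → Coloring n → Bool) → List (RTree n) → LP
treeSum sel L = sumLP (map (treeTerm sel) L)

{-# OPTIONS --safe #-}

-- Write iso(P,S) for the number of isomorphisms between two rooted trees. If weights ω are chosen on a
-- family of trees so that Σ_P ω(P) iso(P,S) = 1 for every S, then Σ_T w(T)/|Aut T| = Σ_P ω(P) w(P) for
-- every isomorphism-invariant w. The family used here is that of all trees built from single vertices
-- by grafting (making the root of a tree A a child of the root of a tree B), where a graft with i+1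
-- vertices in A and n+1 non-root vertices altogether gets the factor (i+1)/(n+1); the identity for ω
-- holds because the branches at the root of S partition its non-root vertices. The coloring weights
-- are bilinear in the two parts of a graft, so the tree series satisfy exactly the recurrences that
-- the logarithmic derivative x d/dx gives for the coefficients of exp(a+b)cosh(c), exp(a+b)sinh(c) and
-- exp(a/t+tb+c) at the fixed point of the iteration, and these recurrences have only one solution.

module Submission where

open import Defs
open import Data.Nat using (ℕ; zero; suc; _≤_)
open import Data.Integer using (ℤ; _<_; 0ℤ)
open import Data.Rational using (0ℚ)
open import Data.List using (List)
open import Data.Product using (Σ; _×_)
open import Relation.Binary.PropositionalEquality using (_≡_)

open import Algebra.Bundles using (CommutativeRing; CommutativeSemiring)
import Algebra.Solver.Ring.NaturalCoefficients.Default as NatSolver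
open import Algebra.Structures.Biased using (isCommutativeSemiringˡ)
open import Data.Bool using (Bool; true; false; if_then_else_; _∧_; _∨_; not)
import Data.Bool.Properties as BoolP
open import Data.Empty using (⊥; ⊥-elim)
open import Data.Fin as Fin using (Fin; toℕ)
import Data.Fin.Properties as FinP
open import Data.Integer as ℤ using (+_; -[1+_]; _⊖_)
import Data.Integer.Properties as ℤP
open import Data.List as List using ([]; _∷_; _++_; map; concatMap; upTo; applyUpTo; allFin)
import Data.List.Membership.Propositional as ListMem
import Data.List.Membership.Propositional.Properties as ListMemP
open import Data.List.Membership.Propositional.Properties.WithK using (unique∧set⇒bag)
import Data.List.Properties as ListP
open import Data.List.Relation.Binary.BagAndSetEquality using (∼bag⇒↭)
open import Data.List.Relation.Binary.Permutation.Propositional as Perm using (_↭_)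
import Data.List.Relation.Binary.Permutation.Propositional.Properties as PermP
open import Data.List.Relation.Unary.All as All using (All; []; _∷_)
import Data.List.Relation.Unary.All.Properties as AllP
import Data.List.Relation.Unary.AllPairs as AllPairs
open import Data.List.Relation.Unary.AllPairs using (AllPairs; []; _∷_)
import Data.List.Relation.Unary.AllPairs.Properties as AllPairsP
open import Data.List.Relation.Unary.Any as Any using (Any; here; there)
import Data.List.Relation.Unary.Any.Properties as AnyP
open import Data.List.Relation.Unary.Unique.Propositional using (Unique)
import Data.List.Relation.Unary.Unique.Propositional.Properties as UniqueP
open import Data.Nat as ℕ using (z≤n; s≤s; _∸_; _!)
import Data.Nat.Coprimality as Coprimality
import Data.Nat.Properties as ℕP
open import Data.Product using (_,_; proj₁; proj₂; ∃)
open import Data.Rational as ℚ using (ℚ; 1ℚ)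
import Data.Rational.Properties as ℚP
open import Data.Sum using (_⊎_; inj₁; inj₂)
open import Data.Unit using (⊤; tt)
import Data.Vec.Functional as VF
open import Function using (_∘_; id; flip)
open import Function.Bundles using (Inverse; mk⇔; mk↔ₛ′)
open import Level using (0ℓ)
open import Relation.Binary.Definitions using (DecidableEquality)
open import Relation.Binary.PropositionalEquality as ≡ using (refl; cong; cong₂; sym; trans; subst)
import Relation.Binary.Reasoning.Setoid as SetoidReasoning
open import Relation.Binary.Structures using (IsEquivalence)
open import Relation.Nullary using (¬_; yes; no; Dec)
open import Relation.Nullary.Decidable using (does)

-- Finite sums

-- One isomorphism class may have many parent functions and many grafted forms, since nothing orders
-- the children of a vertex; so 1/|Aut| cannot be read off by recursion on a chosen form. The
-- weights ω make a choice unnecessary, because they are fitted to isomorphism counts, which obey a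
-- recursion of their own under grafting. The bridge from `RTree` to grafted trees is a sum over all
-- relabellings: a map of the vertices is an automorphism exactly when it carries one labelled form
-- of the tree to another. The colouring weights leave out the root, whose parity changes with each
-- black neighbour that it gains. With a = txU the summand a/t of the exponent is xU, so the tree
-- side never divides by t. This is also why the limit has coefficients in ℚ[t], although every step
-- of the iteration uses t⁻¹. Sums and series are developed over arbitrary commutative semirings
-- because they are used over ℕ (isomorphism counts), ℚ (coefficients in t) and Laurent polynomials.

module Sums (K : CommutativeSemiring 0ℓ 0ℓ) where
  open CommutativeSemiring K renaming (_≈_ to _∼_; refl to ∼-refl; sym to ∼-sym; trans to ∼-trans)
  open SetoidReasoning setoid
  open NatSolver K using (solve; _:=_; _:+_; _:*_)

  +-interchange : ∀ a b c d → (a + b) + (c + d) ∼ (a + c) + (b + d)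
  +-interchange = solve 4 (λ a b c d → (a :+ b) :+ (c :+ d) := (a :+ c) :+ (b :+ d)) ∼-refl

  ∑ : {I : Set} → List I → (I → Carrier) → Carrier
  ∑ [] g = 0#
  ∑ (x ∷ xs) g = g x + ∑ xs g

  module _ {I : Set} where
    ∑-cong : ∀ (xs : List I) {g h} → (∀ x → g x ∼ h x) → ∑ xs g ∼ ∑ xs h
    ∑-cong [] e = ∼-refl
    ∑-cong (x ∷ xs) e = +-cong (e x) (∑-cong xs e)

    ∑-cong-All : ∀ {xs : List I} {g h} → All (λ x → g x ∼ h x) xs → ∑ xs g ∼ ∑ xs h
    ∑-cong-All [] = ∼-refl
    ∑-cong-All (e ∷ es) = +-cong e (∑-cong-All es)

    ∑-zero : ∀ (xs : List I) {g} → (∀ x → g x ∼ 0#) → ∑ xs g ∼ 0#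
    ∑-zero [] e = ∼-refl
    ∑-zero (x ∷ xs) e = ∼-trans (+-cong (e x) (∑-zero xs e)) (+-identityˡ 0#)

    ∑-+ : ∀ (xs : List I) g h → ∑ xs (λ x → g x + h x) ∼ ∑ xs g + ∑ xs h
    ∑-+ [] g h = ∼-sym (+-identityˡ 0#)
    ∑-+ (x ∷ xs) g h = ∼-trans (+-congˡ (∑-+ xs g h)) (+-interchange _ _ _ _)

    ∑-*ˡ : ∀ (xs : List I) c g → ∑ xs (λ x → c * g x) ∼ c * ∑ xs g
    ∑-*ˡ [] c g = ∼-sym (zeroʳ c)
    ∑-*ˡ (x ∷ xs) c g = ∼-trans (+-congˡ (∑-*ˡ xs c g)) (∼-sym (distribˡ _ _ _))

    ∑-++ : ∀ (xs ys : List I) g → ∑ (xs ++ ys) g ∼ ∑ xs g + ∑ ys g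
    ∑-++ [] ys g = ∼-sym (+-identityˡ _)
    ∑-++ (x ∷ xs) ys g = ∼-trans (+-congˡ (∑-++ xs ys g)) (∼-sym (+-assoc _ _ _))

    ∑-↭ : ∀ {xs ys : List I} → xs ↭ ys → ∀ g → ∑ xs g ∼ ∑ ys g
    ∑-↭ Perm.refl g = ∼-refl
    ∑-↭ (Perm.prep x p) g = +-congˡ (∑-↭ p g)
    ∑-↭ (Perm.swap x y p) g = ∼-trans (+-congˡ (+-congˡ (∑-↭ p g)))
      (solve 3 (λ a b c → a :+ (b :+ c) := b :+ (a :+ c)) ∼-refl _ _ _)
    ∑-↭ (Perm.trans p q) g = ∼-trans (∑-↭ p g) (∑-↭ q g)

    -- The entry satisfying `P` exists and is unique by properties of the list and not by equality
    -- of entries: in the main use the entries are trees compared up to isomorphism. `Q` passes on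
    -- what is known of all entries.
    ∑-select : ∀ {P Q : I → Set} {xs} → All Q xs → Any P xs → AllPairs (λ x y → ¬ (P x × P y)) xs →
               ∀ {g c} → (∀ x → Q x → P x → g x ∼ c) → (∀ x → ¬ P x → g x ∼ 0#) → ∑ xs g ∼ c
    ∑-select {P} {xs = x ∷ xs} (q ∷ _) (here p) (ne ∷ _) on off =
      ∼-trans (+-cong (on x q p) (rest xs ne)) (+-identityʳ _)
      where
      rest : ∀ ys → All (λ y → ¬ (P x × P y)) ys → ∑ ys _ ∼ 0#
      rest [] [] = ∼-refl
      rest (y ∷ ys) (n ∷ ns) = ∼-trans (+-cong (off y (λ q → n (p , q))) (rest ys ns)) (+-identityˡ 0#)
    ∑-select {P} {xs = x ∷ xs} (_ ∷ qs) (there a) (ne ∷ nes) on off =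
      ∼-trans (+-cong (off x (λ p → excluded p a ne)) (∑-select qs a nes on off)) (+-identityˡ _)
      where
      excluded : P x → ∀ {ys} → Any P ys → All (λ y → ¬ (P x × P y)) ys → ⊥
      excluded p (here q) (n ∷ _) = n (p , q)
      excluded p (there b) (_ ∷ ns) = excluded p b ns

  module _ {I J : Set} where
    ∑-map : ∀ (f : I → J) xs g → ∑ (map f xs) g ∼ ∑ xs (g ∘ f)
    ∑-map f [] g = ∼-refl
    ∑-map f (x ∷ xs) g = +-congˡ (∑-map f xs g)

    ∑-concatMap : ∀ (f : I → List J) xs g → ∑ (concatMap f xs) g ∼ ∑ xs (λ x → ∑ (f x) g)
    ∑-concatMap f [] g = ∼-refl
    ∑-concatMap f (x ∷ xs) g = ∼-trans (∑-++ (f x) _ g) (+-congˡ (∑-concatMap f xs g))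

    ∑-swap : ∀ (xs : List I) (ys : List J) (F : I → J → Carrier) → ∑ xs (λ x → ∑ ys (F x)) ∼ ∑ ys (λ y → ∑ xs (λ x → F x y))
    ∑-swap [] ys F = ∼-sym (∑-zero ys (λ _ → ∼-refl))
    ∑-swap (x ∷ xs) ys F = ∼-trans (+-congˡ (∑-swap xs ys F)) (∼-sym (∑-+ ys _ _))

  -- The sum over i + j = n. Advancing the first index of the summand avoids the subtraction n ∸ i.
  diag : ℕ → (ℕ → ℕ → Carrier) → Carrier
  diag zero F = F 0 0
  diag (suc n) F = F 0 (suc n) + diag n (λ i j → F (suc i) j)

  diag-cong : ∀ n {F G} → (∀ i j → i ℕ.+ j ≡ n → F i j ∼ G i j) → diag n F ∼ diag n G
  diag-cong zero e = e 0 0 refl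
  diag-cong (suc n) e = +-cong (e 0 (suc n) refl) (diag-cong n (λ i j p → e (suc i) j (cong suc p)))

  diag-+ : ∀ n F G → diag n (λ i j → F i j + G i j) ∼ diag n F + diag n G
  diag-+ zero F G = ∼-refl
  diag-+ (suc n) F G = ∼-trans (+-congˡ (diag-+ n _ _)) (+-interchange _ _ _ _)

  diag-*ˡ : ∀ n c F → diag n (λ i j → c * F i j) ∼ c * diag n F
  diag-*ˡ zero c F = ∼-refl
  diag-*ˡ (suc n) c F = ∼-trans (+-congˡ (diag-*ˡ n c _)) (∼-sym (distribˡ _ _ _))

  diag-zero : ∀ n {F} → (∀ i j → i ℕ.+ j ≡ n → F i j ∼ 0#) → diag n F ∼ 0#
  diag-zero zero e = e 0 0 refl
  diag-zero (suc n) e = ∼-trans (+-cong (e 0 (suc n) refl) (diag-zero n (λ i j p → e (suc i) j (cong suc p)))) (+-identityˡ 0#)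

  diag-∑ : ∀ n {I : Set} (xs : List I) (F : ℕ → ℕ → I → Carrier) → diag n (λ i j → ∑ xs (F i j)) ∼ ∑ xs (λ x → diag n (λ i j → F i j x))
  diag-∑ zero xs F = ∼-refl
  diag-∑ (suc n) xs F = ∼-trans (+-congˡ (diag-∑ n xs _)) (∼-sym (∑-+ xs _ _))

  diag-select : ∀ n {F c} k l → k ℕ.+ l ≡ n → F k l ∼ c →
                (∀ i j → i ℕ.+ j ≡ n → ¬ (i ≡ k) → F i j ∼ 0#) → diag n F ∼ c
  diag-select zero zero zero refl e z = e
  diag-select (suc n) zero .(suc n) refl e z =
    ∼-trans (+-cong e (diag-zero n (λ i j p → z (suc i) j (cong suc p) (λ ())))) (+-identityʳ _)
  diag-select (suc n) (suc k) l p e z =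
    ∼-trans (+-cong (z 0 (suc n) refl (λ ()))
                    (diag-select n k l (ℕP.suc-injective p) e (λ i j q ne → z (suc i) j (cong suc q) (ne ∘ ℕP.suc-injective))))
            (+-identityˡ _)

  diag-last : ∀ n (F : ℕ → ℕ → Carrier) → diag (suc n) F ∼ diag n (λ i j → F i (suc j)) + F (suc n) 0
  diag-last zero F = ∼-refl
  diag-last (suc n) F = ∼-trans (+-congˡ (diag-last n (F ∘ suc))) (∼-sym (+-assoc _ _ _))

  diag-flip : ∀ n F → diag n F ∼ diag n (flip F)
  diag-flip zero F = ∼-refl
  diag-flip (suc n) F = ∼-trans (diag-last n F) (∼-trans (+-comm _ _) (+-congˡ (diag-flip n _)))

  -- Both sides run over i + j + k = n. The terms with i = 0 form `diag (suc n) (G 0)` on either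
  -- side, and those with i > 0 are the instance for n of the shifted summand.
  diag-assoc : ∀ n (G : ℕ → ℕ → ℕ → Carrier) →
               diag n (λ m k → diag m (λ i j → G i j k)) ∼ diag n (λ i m → diag m (λ j k → G i j k))
  diag-assoc zero G = ∼-refl
  diag-assoc (suc n) G = begin
    G 0 0 (suc n) + diag n (λ m k → G 0 (suc m) k + diag m (λ i j → G (suc i) j k))
      ≈⟨ +-congˡ (diag-+ n _ _) ⟩
    G 0 0 (suc n) + (diag n (λ m k → G 0 (suc m) k) + diag n (λ m k → diag m (λ i j → G (suc i) j k)))
      ≈⟨ +-assoc _ _ _ ⟨
    diag (suc n) (G 0) + diag n (λ m k → diag m (λ i j → G (suc i) j k))
      ≈⟨ +-congˡ (diag-assoc n (λ i → G (suc i))) ⟩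
    diag (suc n) (G 0) + diag n (λ i m → diag m (λ j k → G (suc i) j k)) ∎

  sumTo : ℕ → (ℕ → Carrier) → Carrier
  sumTo zero F = 0#
  sumTo (suc n) F = F 0 + sumTo n (F ∘ suc)

  sumTo-cong : ∀ n {F G} → (∀ i → F i ∼ G i) → sumTo n F ∼ sumTo n G
  sumTo-cong zero e = ∼-refl
  sumTo-cong (suc n) e = +-cong (e 0) (sumTo-cong n (e ∘ suc))

  sumTo-zero : ∀ n {F} → (∀ i → F i ∼ 0#) → sumTo n F ∼ 0#
  sumTo-zero zero e = ∼-refl
  sumTo-zero (suc n) e = ∼-trans (+-cong (e 0) (sumTo-zero n (e ∘ suc))) (+-identityˡ 0#)

  sumTo-*ˡ : ∀ n c F → sumTo n (λ i → c * F i) ∼ c * sumTo n F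
  sumTo-*ˡ zero c F = ∼-sym (zeroʳ c)
  sumTo-*ˡ (suc n) c F = ∼-trans (+-congˡ (sumTo-*ˡ n c _)) (∼-sym (distribˡ _ _ _))

  sumTo-truncate : ∀ {m n F} → m ≤ n → (∀ i → m ≤ i → F i ∼ 0#) → sumTo n F ∼ sumTo m F
  sumTo-truncate {n = n} z≤n z = sumTo-zero n (λ i → z i z≤n)
  sumTo-truncate (s≤s p) z = +-congˡ (sumTo-truncate p (λ i q → z (suc i) (s≤s q)))

  sumTo-diag : ∀ m n (F : ℕ → ℕ → ℕ → Carrier) → sumTo m (λ k → diag n (F k)) ∼ diag n (λ i j → sumTo m (λ k → F k i j))
  sumTo-diag zero n F = ∼-sym (diag-zero n (λ _ _ _ → ∼-refl))
  sumTo-diag (suc m) n F = ∼-trans (+-congˡ (sumTo-diag m n (F ∘ suc))) (∼-sym (diag-+ n _ _))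

  sumTo-antidiagonal : ∀ n (F : ℕ → ℕ → Carrier) → sumTo (suc n) (λ j → F j (n ∸ j)) ∼ diag n F
  sumTo-antidiagonal zero F = +-identityʳ _
  sumTo-antidiagonal (suc n) F = +-congˡ (sumTo-antidiagonal n (F ∘ suc))

  nat : ℕ → Carrier
  nat zero = 0#
  nat (suc n) = 1# + nat n

  nat-+ : ∀ m n → nat (m ℕ.+ n) ∼ nat m + nat n
  nat-+ zero n = ∼-sym (+-identityˡ _)
  nat-+ (suc m) n = ∼-trans (+-congˡ (nat-+ m n)) (∼-sym (+-assoc _ _ _))

  nat-* : ∀ m n → nat (m ℕ.* n) ∼ nat m * nat n
  nat-* zero n = ∼-sym (zeroˡ _)
  nat-* (suc m) n = begin
    nat (n ℕ.+ m ℕ.* n)            ≈⟨ nat-+ n (m ℕ.* n) ⟩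
    nat n + nat (m ℕ.* n)          ≈⟨ +-cong (∼-sym (*-identityˡ _)) (nat-* m n) ⟩
    1# * nat n + nat m * nat n     ≈⟨ distribʳ _ _ _ ⟨
    (1# + nat m) * nat n ∎

  -- The only divisions are by positive integers, in (i+1)/(n+1), 1/k! and 1/|Aut|. Asking for just
  -- these covers Laurent polynomials, which form no field.
  record Inverses : Set where
    field
      inv     : ℕ → Carrier
      nat-inv : ∀ n → nat (suc n) * inv (suc n) ∼ 1#

-- Formal power series

module Series (K : CommutativeSemiring 0ℓ 0ℓ) where
  open CommutativeSemiring K renaming (_≈_ to _∼_; refl to ∼-refl; sym to ∼-sym; trans to ∼-trans)
  open SetoidReasoning setoid
  open NatSolver K using (solve; _:=_; _:+_; _:*_)
  open Sums K

  infixl 7 _⋆_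
  _⋆_ : (ℕ → Carrier) → (ℕ → Carrier) → ℕ → Carrier
  (f ⋆ g) n = diag n (λ i j → f i * g j)

  infix 4 _≐_
  _≐_ : (ℕ → Carrier) → (ℕ → Carrier) → Set
  f ≐ g = ∀ n → f n ∼ g n

  ⋆-cong : ∀ {f f' g g'} → f ≐ f' → g ≐ g' → f ⋆ g ≐ f' ⋆ g'
  ⋆-cong p q n = diag-cong n (λ i j _ → *-cong (p i) (q j))

  ⋆-comm : ∀ f g → f ⋆ g ≐ g ⋆ f
  ⋆-comm f g n = ∼-trans (diag-flip n _) (diag-cong n (λ i j _ → *-comm (f j) (g i)))

  ⋆-assoc : ∀ f g h → (f ⋆ g) ⋆ h ≐ f ⋆ (g ⋆ h)
  ⋆-assoc f g h n = begin
    diag n (λ m k → diag m (λ i j → f i * g j) * h k)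
      ≈⟨ diag-cong n (λ m k _ → ∼-trans (*-comm _ (h k)) (∼-sym (diag-*ˡ m (h k) _))) ⟩
    diag n (λ m k → diag m (λ i j → h k * (f i * g j)))
      ≈⟨ diag-assoc n (λ i j k → h k * (f i * g j)) ⟩
    diag n (λ i m → diag m (λ j k → h k * (f i * g j)))
      ≈⟨ diag-cong n (λ i m _ → diag-cong m (λ j k _ → solve 3 (λ a b c → c :* (a :* b) := a :* (b :* c)) ∼-refl _ _ _)) ⟩
    diag n (λ i m → diag m (λ j k → f i * (g j * h k)))
      ≈⟨ diag-cong n (λ i m _ → diag-*ˡ m (f i) _) ⟩
    diag n (λ i m → f i * diag m (λ j k → g j * h k)) ∎

  ⋆-comm-left : ∀ f g h → f ⋆ (g ⋆ h) ≐ g ⋆ (f ⋆ h)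
  ⋆-comm-left f g h n =
    ∼-trans (∼-sym (⋆-assoc f g h n))
      (∼-trans (⋆-cong (⋆-comm f g) (λ _ → ∼-refl) n) (⋆-assoc g f h n))

  δ₀ : ℕ → Carrier
  δ₀ zero = 1#
  δ₀ (suc _) = 0#

  pow : (ℕ → Carrier) → ℕ → ℕ → Carrier
  pow f zero = δ₀
  pow f (suc k) = f ⋆ pow f k

  pow-vanish : ∀ {f} → f 0 ∼ 0# → ∀ k n → n ℕ.< k → pow f k n ∼ 0#
  pow-vanish {f} z (suc k) n n<k = diag-zero n vanish
    where
    vanish : ∀ i j → i ℕ.+ j ≡ n → f i * pow f k j ∼ 0#
    vanish zero j _ = ∼-trans (*-congʳ z) (zeroˡ _)
    vanish (suc i) j p = ∼-trans (*-congˡ (pow-vanish z k j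
      (ℕP.<-≤-trans (subst (j ℕ.<_) p (s≤s (ℕP.m≤n+m j i))) (ℕP.≤-pred n<k)))) (zeroʳ _)

  -- The operator x d/dx, which acts on each coefficient separately and so needs no index shift.
  θ : (ℕ → Carrier) → ℕ → Carrier
  θ f n = nat n * f n

  θ-⋆ : ∀ f g → θ (f ⋆ g) ≐ λ n → (θ f ⋆ g) n + (f ⋆ θ g) n
  θ-⋆ f g n = begin
    nat n * diag n (λ i j → f i * g j)
      ≈⟨ diag-*ˡ n (nat n) _ ⟨
    diag n (λ i j → nat n * (f i * g j))
      ≈⟨ diag-cong n (λ { i j refl → ∼-trans (*-congʳ (nat-+ i j))
           (solve 4 (λ a b x y → (a :+ b) :* (x :* y) := (a :* x) :* y :+ x :* (b :* y)) ∼-refl (nat i) (nat j) (f i) (g j)) }) ⟩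
    diag n (λ i j → θ f i * g j + f i * θ g j)
      ≈⟨ diag-+ n _ _ ⟩
    (θ f ⋆ g) n + (f ⋆ θ g) n ∎

  ⋆-zeroʳ : ∀ f {g} → (∀ n → g n ∼ 0#) → ∀ n → (f ⋆ g) n ∼ 0#
  ⋆-zeroʳ f z n = diag-zero n (λ i j _ → ∼-trans (*-congˡ (z j)) (zeroʳ _))

  ⋆-scaleʳ : ∀ c f g n → (f ⋆ (λ m → c * g m)) n ∼ c * (f ⋆ g) n
  ⋆-scaleʳ c f g n =
    ∼-trans (diag-cong n (λ i j _ → solve 3 (λ x y z → y :* (x :* z) := x :* (y :* z)) ∼-refl c (f i) (g j))) (diag-*ˡ n c _)

  θ-δ₀ : ∀ n → θ δ₀ n ∼ 0#
  θ-δ₀ zero = zeroˡ _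
  θ-δ₀ (suc n) = zeroʳ _

  θ-pow : ∀ f k n → θ (pow f (suc k)) n ∼ nat (suc k) * (θ f ⋆ pow f k) n
  θ-pow f zero n = begin
    θ (f ⋆ δ₀) n                     ≈⟨ θ-⋆ f δ₀ n ⟩
    (θ f ⋆ δ₀) n + (f ⋆ θ δ₀) n      ≈⟨ +-congˡ (⋆-zeroʳ f θ-δ₀ n) ⟩
    (θ f ⋆ δ₀) n + 0#                ≈⟨ +-identityʳ _ ⟩
    (θ f ⋆ δ₀) n                     ≈⟨ *-identityˡ _ ⟨
    1# * (θ f ⋆ δ₀) n                ≈⟨ *-congʳ (+-identityʳ 1#) ⟨
    nat 1 * (θ f ⋆ δ₀) n ∎
  θ-pow f (suc k) n = begin
    θ (f ⋆ pow f (suc k)) n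
      ≈⟨ θ-⋆ f (pow f (suc k)) n ⟩
    (θ f ⋆ pow f (suc k)) n + (f ⋆ θ (pow f (suc k))) n
      ≈⟨ +-congˡ (⋆-cong {f} (λ _ → ∼-refl) (θ-pow f k) n) ⟩
    (θ f ⋆ pow f (suc k)) n + (f ⋆ (λ m → nat (suc k) * (θ f ⋆ pow f k) m)) n
      ≈⟨ +-congˡ (⋆-scaleʳ (nat (suc k)) f _ n) ⟩
    (θ f ⋆ pow f (suc k)) n + nat (suc k) * (f ⋆ (θ f ⋆ pow f k)) n
      ≈⟨ +-cong (∼-sym (*-identityˡ _)) (*-congˡ (⋆-comm-left f (θ f) _ n)) ⟩
    1# * (θ f ⋆ pow f (suc k)) n + nat (suc k) * (θ f ⋆ pow f (suc k)) n
      ≈⟨ distribʳ _ _ _ ⟨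
    nat (suc (suc k)) * (θ f ⋆ pow f (suc k)) n ∎

  -- Composition e(f) of power series; only k ≤ n contributes to the coefficient n when f 0 = 0.
  compose : (ℕ → Carrier) → (ℕ → Carrier) → ℕ → Carrier
  compose e f n = sumTo (suc n) (λ k → e k * pow f k n)

  compose-extend : ∀ e {f} → f 0 ∼ 0# → ∀ {n m} → n ℕ.< m → compose e f n ∼ sumTo m (λ k → e k * pow f k n)
  compose-extend e z {n} n<m =
    ∼-sym (sumTo-truncate n<m (λ k n<k → ∼-trans (*-congˡ (pow-vanish z k n n<k)) (zeroʳ _)))

  ⋆-shift : ∀ f g → f 0 ∼ 0# → ∀ n → (f ⋆ g) (suc n) ∼ diag n (λ i j → f (suc i) * g j)
  ⋆-shift f g z n = ∼-trans (+-congʳ (∼-trans (*-congʳ z) (zeroˡ _))) (+-identityˡ _)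

  θ₀ : ∀ f → θ f 0 ∼ 0#
  θ₀ f = zeroˡ (f 0)

  -- The chain rule: `de` says that e' is the formal derivative of e, and `f 0 ∼ 0#` makes the
  -- truncation in `compose` harmless.
  θ-compose : ∀ e e' → (∀ k → nat (suc k) * e (suc k) ∼ e' k) →
              ∀ {f} → f 0 ∼ 0# → θ (compose e f) ≐ θ f ⋆ compose e' f
  θ-compose e e' de {f} z zero = ∼-trans (θ₀ (compose e f)) (∼-sym (∼-trans (*-congʳ (θ₀ f)) (zeroˡ _)))
  θ-compose e e' de {f} z (suc n) = begin
    nat (suc n) * (e 0 * 0# + sumTo (suc n) (λ k → e (suc k) * pow f (suc k) (suc n)))
      ≈⟨ *-congˡ (∼-trans (+-congʳ (zeroʳ _)) (+-identityˡ _)) ⟩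
    nat (suc n) * sumTo (suc n) (λ k → e (suc k) * pow f (suc k) (suc n))
      ≈⟨ termwise (suc n) ⟩
    diag n (λ i j → sumTo (suc n) (λ k → θ f (suc i) * (e' k * pow f k j)))
      -- `compose` cuts its sum at its own index j. Since j ≤ n, the common bound `suc n` adds only
      -- zero terms.
      ≈⟨ diag-cong n (λ i j p → ∼-trans (sumTo-*ˡ (suc n) (θ f (suc i)) (λ k → e' k * pow f k j))
           (*-congˡ (∼-sym (compose-extend e' z (s≤s (subst (j ≤_) p (ℕP.m≤n+m j i))))))) ⟩
    diag n (λ i j → θ f (suc i) * compose e' f j)
      ≈⟨ ⋆-shift (θ f) (compose e' f) (θ₀ f) n ⟨
    (θ f ⋆ compose e' f) (suc n) ∎
    where
    termwise : ∀ m → nat (suc n) * sumTo m (λ k → e (suc k) * pow f (suc k) (suc n)) ∼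
                     diag n (λ i j → sumTo m (λ k → θ f (suc i) * (e' k * pow f k j)))
    termwise m = begin
      nat (suc n) * sumTo m (λ k → e (suc k) * pow f (suc k) (suc n))
        ≈⟨ sumTo-*ˡ m (nat (suc n)) _ ⟨
      sumTo m (λ k → nat (suc n) * (e (suc k) * pow f (suc k) (suc n)))
        ≈⟨ sumTo-cong m (λ k → begin
             nat (suc n) * (e (suc k) * pow f (suc k) (suc n))
               ≈⟨ solve 3 (λ a b c → a :* (b :* c) := b :* (a :* c)) ∼-refl (nat (suc n)) (e (suc k)) (pow f (suc k) (suc n)) ⟩
             e (suc k) * θ (pow f (suc k)) (suc n)
               ≈⟨ *-congˡ (θ-pow f k (suc n)) ⟩
             e (suc k) * (nat (suc k) * (θ f ⋆ pow f k) (suc n))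
               ≈⟨ solve 3 (λ a b c → a :* (b :* c) := (b :* a) :* c) ∼-refl (e (suc k)) (nat (suc k)) ((θ f ⋆ pow f k) (suc n)) ⟩
             nat (suc k) * e (suc k) * (θ f ⋆ pow f k) (suc n)
               ≈⟨ *-cong (de k) (⋆-shift (θ f) (pow f k) (θ₀ f) n) ⟩
             e' k * diag n (λ i j → θ f (suc i) * pow f k j)
               ≈⟨ diag-*ˡ n (e' k) (λ i j → θ f (suc i) * pow f k j) ⟨
             diag n (λ i j → e' k * (θ f (suc i) * pow f k j))
               ≈⟨ diag-cong n (λ i j _ → solve 3 (λ a b c → a :* (b :* c) := b :* (a :* c)) ∼-refl (e' k) (θ f (suc i)) (pow f k j)) ⟩
             diag n (λ i j → θ f (suc i) * (e' k * pow f k j)) ∎) ⟩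
      sumTo m (λ k → diag n (λ i j → θ f (suc i) * (e' k * pow f k j)))
        ≈⟨ sumTo-diag m n (λ k i j → θ f (suc i) * (e' k * pow f k j)) ⟩
      diag n (λ i j → sumTo m (λ k → θ f (suc i) * (e' k * pow f k j))) ∎

  θ-recurrence : ∀ (f g : ℕ → Carrier) → θ g ≐ θ f ⋆ g →
                 ∀ n → nat (suc n) * g (suc n) ∼ diag n (λ i j → nat (suc i) * (f (suc i) * g j))
  θ-recurrence f g e n =
    ∼-trans (e (suc n)) (∼-trans (⋆-shift (θ f) g (θ₀ f) n) (diag-cong n (λ i j _ → *-assoc _ _ _)))

  -- With e = exp f, c = cosh g and s = sinh g this is the logarithmic derivative of a product. It
  -- leads from e ⋆ c to e ⋆ s, so the two white series satisfy a coupled system; exchanging c and s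
  -- gives the second equation.
  θ-recurrence₂ : ∀ (f g e c s : ℕ → Carrier) → θ e ≐ θ f ⋆ e → θ c ≐ θ g ⋆ s → ∀ n →
                  nat (suc n) * (e ⋆ c) (suc n) ∼
                  diag n (λ i j → nat (suc i) * (f (suc i) * (e ⋆ c) j + g (suc i) * (e ⋆ s) j))
  θ-recurrence₂ f g e c s θe θc n = begin
    θ (e ⋆ c) (suc n)
      ≈⟨ θ-⋆ e c (suc n) ⟩
    (θ e ⋆ c) (suc n) + (e ⋆ θ c) (suc n)
      ≈⟨ +-cong (⋆-cong {g = c} θe (λ _ → ∼-refl) (suc n)) (⋆-cong {e} (λ _ → ∼-refl) θc (suc n)) ⟩
    ((θ f ⋆ e) ⋆ c) (suc n) + (e ⋆ (θ g ⋆ s)) (suc n)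
      ≈⟨ +-cong (⋆-assoc (θ f) e c (suc n)) (⋆-comm-left e (θ g) s (suc n)) ⟩
    (θ f ⋆ (e ⋆ c)) (suc n) + (θ g ⋆ (e ⋆ s)) (suc n)
      ≈⟨ +-cong (⋆-shift (θ f) (e ⋆ c) (θ₀ f) n) (⋆-shift (θ g) (e ⋆ s) (θ₀ g) n) ⟩
    diag n (λ i j → θ f (suc i) * (e ⋆ c) j) + diag n (λ i j → θ g (suc i) * (e ⋆ s) j)
      ≈⟨ diag-+ n _ _ ⟨
    diag n (λ i j → θ f (suc i) * (e ⋆ c) j + θ g (suc i) * (e ⋆ s) j)
      ≈⟨ diag-cong n (λ i j _ → solve 5 (λ a x u y v → (a :* x) :* u :+ (a :* y) :* v := a :* (x :* u :+ y :* v)) ∼-refl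
                                  (nat (suc i)) (f (suc i)) ((e ⋆ c) j) (g (suc i)) ((e ⋆ s) j)) ⟩
    diag n (λ i j → nat (suc i) * (f (suc i) * (e ⋆ c) j + g (suc i) * (e ⋆ s) j)) ∎

  -- equality modulo x^(n+1)
  _≐[_]_ : (ℕ → Carrier) → ℕ → (ℕ → Carrier) → Set
  f ≐[ n ] g = ∀ i → i ≤ n → f i ∼ g i

  ⋆-local : ∀ {n f f' g g'} → f ≐[ n ] f' → g ≐[ n ] g' → (f ⋆ g) ≐[ n ] (f' ⋆ g')
  ⋆-local p q m m≤n = diag-cong m λ { i j refl →
    *-cong (p i (ℕP.≤-trans (ℕP.m≤m+n i j) m≤n)) (q j (ℕP.≤-trans (ℕP.m≤n+m j i) m≤n)) }

  pow-local : ∀ {n f f'} → f ≐[ n ] f' → ∀ k → pow f k ≐[ n ] pow f' k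
  pow-local p zero i _ = ∼-refl
  pow-local p (suc k) = ⋆-local p (pow-local p k)

  compose-local : ∀ e {n f f'} → f ≐[ n ] f' → compose e f ≐[ n ] compose e f'
  compose-local e p m m≤n = sumTo-cong (suc m) (λ k → *-congˡ {e k} (pow-local p k m m≤n))

-- Laurent polynomials

ℚ-semiring : CommutativeSemiring 0ℓ 0ℓ
ℚ-semiring = CommutativeRing.commutativeSemiring ℚP.+-*-commutativeRing

module ℚS = Series ℚ-semiring

-- Multiplication by t^d on coefficient sequences.
shift : ℕ → (ℕ → ℚ) → ℕ → ℚ
shift zero f n = f n
shift (suc d) f zero = 0ℚ
shift (suc d) f (suc n) = shift d f n

shift-cong : ∀ d {f g : ℕ → ℚ} → (∀ n → f n ≡ g n) → ∀ n → shift d f n ≡ shift d g n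
shift-cong zero e n = e n
shift-cong (suc d) e zero = refl
shift-cong (suc d) e (suc n) = shift-cong d e n

shift-+ : ∀ d f g n → shift d (λ m → f m ℚ.+ g m) n ≡ shift d f n ℚ.+ shift d g n
shift-+ zero f g n = refl
shift-+ (suc d) f g zero = sym (ℚP.+-identityˡ 0ℚ)
shift-+ (suc d) f g (suc n) = shift-+ d f g n

shift-shift : ∀ d e f n → shift d (shift e f) n ≡ shift (d ℕ.+ e) f n
shift-shift zero e f n = refl
shift-shift (suc d) e f zero = refl
shift-shift (suc d) e f (suc n) = shift-shift d e f n

shift-below : ∀ d f {n} → n ℕ.< d → shift d f n ≡ 0ℚ
shift-below (suc d) f {zero} _ = refl
shift-below (suc d) f {suc n} (s≤s p) = shift-below d f p

shift-⋆ : ∀ d f g n → (shift d f ℚS.⋆ g) n ≡ shift d (f ℚS.⋆ g) n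
shift-⋆ zero f g n = refl
shift-⋆ (suc d) f g zero = ℚP.*-zeroˡ (g 0)
shift-⋆ (suc d) f g (suc n) =
  trans (cong₂ ℚ._+_ (ℚP.*-zeroˡ (g (suc n))) (shift-⋆ d f g n)) (ℚP.+-identityˡ _)

shift-⋆ʳ : ∀ d f g n → (f ℚS.⋆ shift d g) n ≡ shift d (f ℚS.⋆ g) n
shift-⋆ʳ d f g n = trans (ℚS.⋆-comm f (shift d g) n) (trans (shift-⋆ d g f n) (shift-cong d (ℚS.⋆-comm g f) n))

nth-addL : ∀ xs ys n → nthℚ (addL xs ys) n ≡ nthℚ xs n ℚ.+ nthℚ ys n
nth-addL [] ys n = sym (ℚP.+-identityˡ _)
nth-addL (x ∷ xs) [] n = sym (ℚP.+-identityʳ _)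
nth-addL (x ∷ xs) (y ∷ ys) zero = refl
nth-addL (x ∷ xs) (y ∷ ys) (suc n) = nth-addL xs ys n

nth-scaleL : ∀ q xs n → nthℚ (scaleL q xs) n ≡ q ℚ.* nthℚ xs n
nth-scaleL q [] n = sym (ℚP.*-zeroʳ q)
nth-scaleL q (x ∷ xs) zero = refl
nth-scaleL q (x ∷ xs) (suc n) = nth-scaleL q xs n

nth-mulL : ∀ xs ys n → nthℚ (mulL xs ys) n ≡ (nthℚ xs ℚS.⋆ nthℚ ys) n
nth-mulL [] ys n = sym (Sums.diag-zero ℚ-semiring n (λ i j _ → ℚP.*-zeroˡ (nthℚ ys j)))
nth-mulL (x ∷ xs) ys zero =
  trans (nth-addL (scaleL x ys) _ 0) (trans (ℚP.+-identityʳ _) (nth-scaleL x ys 0))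
nth-mulL (x ∷ xs) ys (suc n) =
  trans (nth-addL (scaleL x ys) _ (suc n)) (cong₂ ℚ._+_ (nth-scaleL x ys (suc n)) (nth-mulL xs ys n))

nth-pad : ∀ d xs n → nthℚ (List.replicate d 0ℚ ++ xs) n ≡ shift d (nthℚ xs) n
nth-pad zero xs n = refl
nth-pad (suc d) xs zero = refl
nth-pad (suc d) xs (suc n) = nth-pad d xs n

-- The coefficients of t^L p: a sequence indexed by ℕ as soon as low p ≤ L.
level : ℕ → LP → ℕ → ℚ
level L p = shift (L ∸ low p) (nthℚ (cs p))

-- `coeff` branches on a computed integer, which blocks rewriting; as a function of the integer
-- itself, the coefficient can be transported along equalities of indices.
nthℤ : List ℚ → ℤ → ℚ
nthℤ xs (+ j) = nthℚ xs j
nthℤ xs -[1+ _ ] = 0ℚ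

nthℤ-⊖ : ∀ xs m d → nthℤ xs (m ⊖ d) ≡ shift d (nthℚ xs) m
nthℤ-⊖ xs m zero = refl
nthℤ-⊖ xs zero (suc d) = refl
nthℤ-⊖ xs (suc m) (suc d) = trans (cong (nthℤ xs) (ℤP.[1+m]⊖[1+n]≡m⊖n m d)) (nthℤ-⊖ xs m d)

coeff-nthℤ : ∀ p k → coeff p k ≡ nthℤ (cs p) (k ℤ.+ + low p)
coeff-nthℤ p k with k ℤ.+ + low p
... | + j = refl
... | -[1+ _ ] = refl

coeff-⊖ : ∀ {L} p → low p ≤ L → ∀ m → coeff p (m ⊖ L) ≡ level L p m
coeff-⊖ {L} p l≤L m = trans (coeff-nthℤ p (m ⊖ L)) (trans (cong (nthℤ (cs p)) index) (nthℤ-⊖ (cs p) m (L ∸ low p)))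
  where
  index : (m ⊖ L) ℤ.+ + low p ≡ m ⊖ (L ∸ low p)
  index = trans (ℤP.distribˡ-⊖-+-pos (low p) m L)
    (trans (cong₂ _⊖_ (ℕP.+-comm m (low p)) (sym (ℕP.m+[n∸m]≡n l≤L)))
           (ℤP.+-cancelˡ-⊖ (low p) m (L ∸ low p)))

infix 4 _≃_
-- A record, so that p and q can be inferred from the type; `_≈_` unfolds to a statement about
-- coefficients.
record _≃_ (p q : LP) : Set where
  constructor mk≃
  field at : p ≈ q
open _≃_

≃⇒level : ∀ {p q} L → low p ≤ L → low q ≤ L → p ≃ q → ∀ m → level L p m ≡ level L q m
≃⇒level {p} {q} L lp lq e m = trans (sym (coeff-⊖ p lp m)) (trans (at e (m ⊖ L)) (coeff-⊖ q lq m))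

-- An exponent k is either at least -L, hence of the form m ⊖ L, or below every exponent that p and
-- q contain, where both coefficients vanish.
level⇒≃ : ∀ {p q} L → low p ≤ L → low q ≤ L → (∀ m → level L p m ≡ level L q m) → p ≃ q
level⇒≃ {p} {q} L lp lq e = mk≃ coeffs
  where
  on : ∀ m → coeff p (m ⊖ L) ≡ coeff q (m ⊖ L)
  on m = trans (coeff-⊖ p lp m) (trans (e m) (sym (coeff-⊖ q lq m)))
  on≡ : ∀ {k} m → m ⊖ L ≡ k → coeff p k ≡ coeff q k
  on≡ m refl = on m
  negative : ∀ r i → low r ≤ i → coeff r -[1+ i ] ≡ 0ℚ
  negative r i l = trans (coeff-nthℤ r -[1+ i ]) (trans (nthℤ-⊖ (cs r) (low r) (suc i)) (shift-below (suc i) _ (s≤s l)))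
  coeffs : p ≈ q
  coeffs (+ j) = on≡ (j ℕ.+ L) (trans (ℤP.⊖-≥ (ℕP.m≤n+m L j)) (cong +_ (ℕP.m+n∸n≡m j L)))
  coeffs -[1+ i ] with i ℕ.<? L
  ... | yes i<L = on≡ (L ∸ suc i)
        (trans (cong₂ _⊖_ (sym (ℕP.+-identityʳ (L ∸ suc i))) (sym (ℕP.m∸n+n≡m i<L))) (ℤP.+-cancelˡ-⊖ (L ∸ suc i) 0 (suc i)))
  ... | no i≮L = trans (negative p i (ℕP.≤-trans lp (ℕP.≮⇒≥ i≮L))) (sym (negative q i (ℕP.≤-trans lq (ℕP.≮⇒≥ i≮L))))

level-add : ∀ {L} p q → low p ≤ L → low q ≤ L → ∀ m → level L (lpAdd p q) m ≡ level L p m ℚ.+ level L q m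
level-add {L} p q lp lq m = trans
  (shift-cong d (λ n → trans (nth-addL (padTo l p) (padTo l q) n) (cong₂ ℚ._+_ (nth-pad (l ∸ low p) (cs p) n) (nth-pad (l ∸ low q) (cs q) n))) m)
  (trans (shift-+ d _ _ m) (cong₂ ℚ._+_ (regroup p (ℕP.m≤m⊔n (low p) (low q))) (regroup q (ℕP.m≤n⊔m (low p) (low q)))))
  where
  l = low p ℕ.⊔ low q
  d = L ∸ l
  regroup : ∀ r → low r ≤ l → shift d (level l r) m ≡ level L r m
  regroup r lr = trans (shift-shift d (l ∸ low r) (nthℚ (cs r)) m)
    (cong (λ e → shift e (nthℚ (cs r)) m) (trans (sym (ℕP.+-∸-assoc d lr)) (cong (_∸ low r) (ℕP.m∸n+n≡m (ℕP.⊔-lub lp lq)))))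

-- Multiplying p by t^L and q by t^M leaves ordinary polynomials, whose product is a convolution.
-- The semiring laws of `LP` are thereby inherited from sequences over ℚ.
level-mul : ∀ {L M} p q → low p ≤ L → low q ≤ M → ∀ m → level (L ℕ.+ M) (lpMul p q) m ≡ (level L p ℚS.⋆ level M q) m
level-mul {L} {M} p q lp lq m = sym (trans (shift-⋆ a (nthℚ (cs p)) (level M q) m)
  (trans (shift-cong a (shift-⋆ʳ b (nthℚ (cs p)) (nthℚ (cs q))) m)
  (trans (shift-shift a b _ m)
  (trans (cong (λ e → shift e (nthℚ (cs p) ℚS.⋆ nthℚ (cs q)) m) offset)
         (shift-cong (L ℕ.+ M ∸ (low p ℕ.+ low q)) (λ n → sym (nth-mulL (cs p) (cs q) n)) m)))))
  where
  a = L ∸ low p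
  b = M ∸ low q
  offset : a ℕ.+ b ≡ L ℕ.+ M ∸ (low p ℕ.+ low q)
  offset = sym (trans (cong₂ (λ x y → x ℕ.+ y ∸ (low p ℕ.+ low q)) (sym (ℕP.m∸n+n≡m lp)) (sym (ℕP.m∸n+n≡m lq)))
    (trans (cong (_∸ (low p ℕ.+ low q)) (Sums.+-interchange ℕP.+-*-commutativeSemiring a (low p) b (low q)))
           (ℕP.m+n∸n≡m (a ℕ.+ b) (low p ℕ.+ low q))))

≃-refl : ∀ {p} → p ≃ p
≃-refl = mk≃ (λ _ → refl)

≃-sym : ∀ {p q} → p ≃ q → q ≃ p
≃-sym e = mk≃ (λ k → sym (at e k))

≃-trans : ∀ {p q r} → p ≃ q → q ≃ r → p ≃ r
≃-trans e f = mk≃ (λ k → trans (at e k) (at f k))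

module _ where
  open ℕP using (m≤m+n; m≤n+m; ≤-trans; ≤-refl; ⊔-lub)
  open Sums ℚ-semiring using (diag-cong; diag-+; diag-zero)

  private
    module Bound (p q r : LP) where
      N = low p ℕ.+ low q ℕ.+ low r
      1≤ : low p ≤ N
      1≤ = ≤-trans (m≤m+n _ _) (m≤m+n _ _)
      2≤ : low q ≤ N
      2≤ = ≤-trans (m≤n+m _ (low p)) (m≤m+n _ _)
      3≤ : low r ≤ N
      3≤ = m≤n+m _ _

  lpAdd-cong : ∀ {p p' q q'} → p ≃ p' → q ≃ q' → lpAdd p q ≃ lpAdd p' q'
  lpAdd-cong {p} {p'} {q} {q'} e f = level⇒≃ L (⊔-lub 1p 1q) (⊔-lub 1p' 1q') (λ m →
    trans (level-add p q 1p 1q m) (trans (cong₂ ℚ._+_ (≃⇒level L 1p 1p' e m) (≃⇒level L 1q 1q' f m)) (sym (level-add p' q' 1p' 1q' m))))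
    where
    L = (low p ℕ.+ low p') ℕ.+ (low q ℕ.+ low q')
    1p : low p ≤ L
    1p = ≤-trans (m≤m+n _ _) (m≤m+n _ _)
    1p' : low p' ≤ L
    1p' = ≤-trans (m≤n+m _ (low p)) (m≤m+n _ _)
    1q : low q ≤ L
    1q = ≤-trans (m≤m+n _ _) (m≤n+m _ (low p ℕ.+ low p'))
    1q' : low q' ≤ L
    1q' = ≤-trans (m≤n+m _ _) (m≤n+m _ (low p ℕ.+ low p'))

  lpAdd-assoc : ∀ p q r → lpAdd (lpAdd p q) r ≃ lpAdd p (lpAdd q r)
  lpAdd-assoc p q r = level⇒≃ N (⊔-lub (⊔-lub 1≤ 2≤) 3≤) (⊔-lub 1≤ (⊔-lub 2≤ 3≤)) (λ m →
    trans (level-add (lpAdd p q) r (⊔-lub 1≤ 2≤) 3≤ m)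
    (trans (cong (ℚ._+ level N r m) (level-add p q 1≤ 2≤ m))
    (trans (ℚP.+-assoc (level N p m) (level N q m) (level N r m))
    (sym (trans (level-add p (lpAdd q r) 1≤ (⊔-lub 2≤ 3≤) m) (cong (level N p m ℚ.+_) (level-add q r 2≤ 3≤ m)))))))
    where open Bound p q r

  lpAdd-comm : ∀ p q → lpAdd p q ≃ lpAdd q p
  lpAdd-comm p q = level⇒≃ N (⊔-lub 1≤ 2≤) (⊔-lub 2≤ 1≤) (λ m →
    trans (level-add p q 1≤ 2≤ m) (trans (ℚP.+-comm (level N p m) (level N q m)) (sym (level-add q p 2≤ 1≤ m))))
    where open Bound p q q

  level-lp0 : ∀ L m → level L lp0 m ≡ 0ℚ
  level-lp0 zero m = refl
  level-lp0 (suc L) zero = refl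
  level-lp0 (suc L) (suc m) = level-lp0 L m

  lpAdd-identityˡ : ∀ p → lpAdd lp0 p ≃ p
  lpAdd-identityˡ p = level⇒≃ (low p) ≤-refl ≤-refl (λ m →
    trans (level-add lp0 p z≤n ≤-refl m) (trans (cong (ℚ._+ level (low p) p m) (level-lp0 (low p) m)) (ℚP.+-identityˡ _)))

  lpMul-cong : ∀ {p p' q q'} → p ≃ p' → q ≃ q' → lpMul p q ≃ lpMul p' q'
  lpMul-cong {p} {p'} {q} {q'} e f =
    level⇒≃ (L ℕ.+ M) (ℕP.+-mono-≤ lp lq) (ℕP.+-mono-≤ lp' lq') (λ m →
      trans (level-mul p q lp lq m)
      (trans (diag-cong m (λ i j _ → cong₂ ℚ._*_ (≃⇒level L lp lp' e i) (≃⇒level M lq lq' f j)))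
      (sym (level-mul p' q' lp' lq' m))))
    where
    L = low p ℕ.+ low p'
    M = low q ℕ.+ low q'
    lp : low p ≤ L
    lp = m≤m+n _ _
    lp' : low p' ≤ L
    lp' = m≤n+m _ _
    lq : low q ≤ M
    lq = m≤m+n _ _
    lq' : low q' ≤ M
    lq' = m≤n+m _ _

  lpMul-comm : ∀ p q → lpMul p q ≃ lpMul q p
  lpMul-comm p q = level⇒≃ (low p ℕ.+ low q) ≤-refl (ℕP.≤-reflexive (ℕP.+-comm (low q) (low p))) (λ m →
    trans (level-mul p q ≤-refl ≤-refl m) (trans (ℚS.⋆-comm (level (low p) p) (level (low q) q) m)
    (sym (trans (cong (λ L → level L (lpMul q p) m) (ℕP.+-comm (low p) (low q))) (level-mul q p ≤-refl ≤-refl m)))))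

  lpMul-assoc : ∀ p q r → lpMul (lpMul p q) r ≃ lpMul p (lpMul q r)
  lpMul-assoc p q r = level⇒≃ (low p ℕ.+ low q ℕ.+ low r) ≤-refl (ℕP.≤-reflexive (sym regroup)) (λ m →
    trans (level-mul (lpMul p q) r ≤-refl ≤-refl m)
    (trans (diag-cong m (λ i j _ → cong (ℚ._* level (low r) r j) (level-mul p q ≤-refl ≤-refl i)))
    (trans (ℚS.⋆-assoc (level (low p) p) (level (low q) q) (level (low r) r) m)
    (sym (trans (cong (λ L → level L (lpMul p (lpMul q r)) m) regroup)
         (trans (level-mul p (lpMul q r) ≤-refl ≤-refl m)
                (diag-cong m (λ i j _ → cong (level (low p) p i ℚ.*_) (level-mul q r ≤-refl ≤-refl j)))))))))
    where regroup = ℕP.+-assoc (low p) (low q) (low r)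

  lpMul-zeroˡ : ∀ p → lpMul lp0 p ≃ lp0
  lpMul-zeroˡ p = level⇒≃ (low p) ≤-refl z≤n (λ m →
    trans (level-mul {0} {low p} lp0 p z≤n ≤-refl m)
    (trans (diag-zero m (λ i j _ → ℚP.*-zeroˡ (level (low p) p j))) (sym (level-lp0 (low p) m))))

  lpMul-constˡ : ∀ c p m → level (low p) (lpMul (lpConst c) p) m ≡ c ℚ.* level (low p) p m
  lpMul-constˡ c p m = trans (level-mul {0} {low p} (lpConst c) p z≤n ≤-refl m) (tail m)
    where
    f = level (low p) p
    tail : ∀ n → (level 0 (lpConst c) ℚS.⋆ f) n ≡ c ℚ.* f n
    tail zero = refl
    tail (suc n) = trans (cong (c ℚ.* f (suc n) ℚ.+_) (diag-zero n (λ i j _ → ℚP.*-zeroˡ (f j)))) (ℚP.+-identityʳ _)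

  lpMul-identityˡ : ∀ p → lpMul lp1 p ≃ p
  lpMul-identityˡ p = level⇒≃ (low p) ≤-refl ≤-refl (λ m → trans (lpMul-constˡ 1ℚ p m) (ℚP.*-identityˡ _))

  lpMul-distribʳ : ∀ p q r → lpMul (lpAdd q r) p ≃ lpAdd (lpMul q p) (lpMul r p)
  lpMul-distribʳ p q r = level⇒≃ (M ℕ.+ low p) ≤-refl (⊔-lub qp rp) (λ m →
    trans (level-mul (lpAdd q r) p ≤-refl ≤-refl m)
    (trans (diag-cong m (λ i j _ → trans (cong (ℚ._* level (low p) p j) (level-add q r q≤ r≤ i))
                                         (ℚP.*-distribʳ-+ (level (low p) p j) (level M q i) (level M r i))))
    (trans (diag-+ m (λ i j → level M q i ℚ.* level (low p) p j) (λ i j → level M r i ℚ.* level (low p) p j))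
    (sym (trans (level-add (lpMul q p) (lpMul r p) qp rp m)
                (cong₂ ℚ._+_ (level-mul q p q≤ ≤-refl m) (level-mul r p r≤ ≤-refl m)))))))
    where
    M = low q ℕ.⊔ low r
    q≤ : low q ≤ M
    q≤ = ℕP.m≤m⊔n _ _
    r≤ : low r ≤ M
    r≤ = ℕP.m≤n⊔m (low q) _
    qp : low q ℕ.+ low p ≤ M ℕ.+ low p
    qp = ℕP.+-monoˡ-≤ (low p) q≤
    rp : low r ℕ.+ low p ≤ M ℕ.+ low p
    rp = ℕP.+-monoˡ-≤ (low p) r≤

LP-semiring : CommutativeSemiring 0ℓ 0ℓ
LP-semiring = record
  { Carrier = LP ; _≈_ = _≃_ ; _+_ = lpAdd ; _*_ = lpMul ; 0# = lp0 ; 1# = lp1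
  ; isCommutativeSemiring = isCommutativeSemiringˡ (record
      { +-isCommutativeMonoid = record
          { isMonoid = record
              { isSemigroup = record
                  { isMagma = record { isEquivalence = isEquivalence ; ∙-cong = lpAdd-cong }
                  ; assoc = lpAdd-assoc }
              ; identity = lpAdd-identityˡ , λ p → ≃-trans (lpAdd-comm p lp0) (lpAdd-identityˡ p) }
          ; comm = lpAdd-comm }
      ; *-isCommutativeMonoid = record
          { isMonoid = record
              { isSemigroup = record
                  { isMagma = record { isEquivalence = isEquivalence ; ∙-cong = lpMul-cong }
                  ; assoc = lpMul-assoc }
              ; identity = lpMul-identityˡ , λ p → ≃-trans (lpMul-comm p lp1) (lpMul-identityˡ p) }
          ; comm = lpMul-comm }
      ; distribʳ = lpMul-distribʳ
      ; zeroˡ = lpMul-zeroˡ })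
  }
  where
  isEquivalence : IsEquivalence _≃_
  isEquivalence = record { refl = ≃-refl ; sym = ≃-sym ; trans = ≃-trans }

-- Trees and their isomorphism counts

module ℕΣ = Sums ℕP.+-*-commutativeSemiring

-- Rooted trees built by grafting: in graft a b the root of a becomes a child of the root of b,
-- so the root of a tree is its last leaf.
data Tree (A : Set) : Set where
  leaf : A → Tree A
  graft : Tree A → Tree A → Tree A

Shape : Set
Shape = Tree ⊤

module _ {A : Set} where
  edges : Tree A → ℕ
  edges (leaf _) = 0
  edges (graft a b) = edges b ℕ.+ suc (edges a)

  root : Tree A → A
  root (leaf x) = x
  root (graft a b) = root b

  labels : Tree A → List A
  labels (leaf x) = x ∷ []
  labels (graft a b) = labels a ++ labels b

  -- All ways to cut off the branch of a child of the root.
  splits : Tree A → List (Tree A × Tree A)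
  splits (leaf _) = []
  splits (graft a b) = (a , b) ∷ map (λ s → proj₁ s , graft a (proj₂ s)) (splits b)

  splits-edges : ∀ (q : Tree A) → All (λ s → edges (proj₂ s) ℕ.+ suc (edges (proj₁ s)) ≡ edges q) (splits q)
  splits-edges (leaf x) = []
  splits-edges (graft a b) = refl ∷ AllP.map⁺ (All.map (λ {s} → exchange s) (splits-edges b))
    where
    exchange : ∀ s → edges (proj₂ s) ℕ.+ suc (edges (proj₁ s)) ≡ edges b →
               edges (proj₂ s) ℕ.+ suc (edges a) ℕ.+ suc (edges (proj₁ s)) ≡ edges b ℕ.+ suc (edges a)
    exchange s e = trans (ℕP.+-assoc (edges (proj₂ s)) _ _)
      (trans (cong (edges (proj₂ s) ℕ.+_) (ℕP.+-comm (suc (edges a)) _))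
      (trans (sym (ℕP.+-assoc (edges (proj₂ s)) _ _)) (cong (ℕ._+ suc (edges a)) e)))

  splits-total : ∀ (q : Tree A) → ℕΣ.∑ (splits q) (λ s → suc (edges (proj₁ s))) ≡ edges q
  splits-total (leaf x) = refl
  splits-total (graft a b) =
    trans (cong (suc (edges a) ℕ.+_) (trans (ℕΣ.∑-map _ (splits b) _) (splits-total b))) (ℕP.+-comm (suc (edges a)) (edges b))

mapTree : ∀ {A B : Set} → (A → B) → Tree A → Tree B
mapTree f (leaf x) = leaf (f x)
mapTree f (graft a b) = graft (mapTree f a) (mapTree f b)

shape : ∀ {A : Set} → Tree A → Shape
shape = mapTree (λ _ → tt)

splits-mapTree : ∀ {A B : Set} (f : A → B) q →
  splits (mapTree f q) ≡ map (λ s → mapTree f (proj₁ s) , mapTree f (proj₂ s)) (splits q)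
splits-mapTree f (leaf x) = refl
splits-mapTree f (graft a b) = cong ((mapTree f a , mapTree f b) ∷_)
  (trans (cong (map _) (splits-mapTree f b)) (trans (sym (ListP.map-∘ (splits b))) (ListP.map-∘ (splits b))))

edges-mapTree : ∀ {A B : Set} (f : A → B) q → edges (mapTree f q) ≡ edges q
edges-mapTree f (leaf x) = refl
edges-mapTree f (graft a b) = cong₂ (λ m n → m ℕ.+ suc n) (edges-mapTree f b) (edges-mapTree f a)

mapTree-∘ : ∀ {A B C : Set} (g : B → C) (f : A → B) q → mapTree g (mapTree f q) ≡ mapTree (g ∘ f) q
mapTree-∘ g f (leaf x) = refl
mapTree-∘ g f (graft a b) = cong₂ graft (mapTree-∘ g f a) (mapTree-∘ g f b)

root-mapTree : ∀ {A B : Set} (f : A → B) q → root (mapTree f q) ≡ f (root q)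
root-mapTree f (leaf x) = refl
root-mapTree f (graft a b) = root-mapTree f b

indicator : {P : Set} → Dec P → ℕ
indicator d = if does d then 1 else 0

-- The number of label-preserving isomorphisms: 0 or 1 for distinctly labelled trees,
-- the number of all isomorphisms for shapes.
isos : ∀ {A : Set} → DecidableEquality A → Tree A → Tree A → ℕ
isos _≟_ (leaf x) (leaf y) = indicator (x ≟ y)
isos _≟_ (leaf x) (graft _ _) = 0
isos _≟_ (graft a b) q = ℕΣ.∑ (splits q) (λ s → isos _≟_ a (proj₁ s) ℕ.* isos _≟_ b (proj₂ s))

_≟⊤_ : DecidableEquality ⊤
tt ≟⊤ tt = yes refl

shapeIsos : Shape → Shape → ℕ
shapeIsos = isos _≟⊤_

isos-edges : ∀ {A : Set} (_≟_ : DecidableEquality A) p q → ¬ (edges p ≡ edges q) → isos _≟_ p q ≡ 0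
isos-edges _≟_ (leaf x) (leaf y) ne = ⊥-elim (ne refl)
isos-edges _≟_ (leaf x) (graft a b) ne = refl
isos-edges _≟_ (graft a b) q ne =
  trans (ℕΣ.∑-cong-All (All.map (λ {s} → vanish s) (splits-edges q))) (ℕΣ.∑-zero (splits q) (λ _ → refl))
  where
  vanish : ∀ s → edges (proj₂ s) ℕ.+ suc (edges (proj₁ s)) ≡ edges q →
           isos _≟_ a (proj₁ s) ℕ.* isos _≟_ b (proj₂ s) ≡ 0
  vanish s e with edges a ℕ.≟ edges (proj₁ s) | edges b ℕ.≟ edges (proj₂ s)
  ... | yes ea | yes eb = ⊥-elim (ne (trans (cong₂ (λ m n → m ℕ.+ suc n) eb ea) e))
  ... | no na | _ = cong (ℕ._* isos _≟_ b (proj₂ s)) (isos-edges _≟_ a (proj₁ s) na)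
  ... | yes _ | no nb = trans (cong (isos _≟_ a (proj₁ s) ℕ.*_) (isos-edges _≟_ b (proj₂ s) nb)) (ℕP.*-zeroʳ (isos _≟_ a (proj₁ s)))

-- Sums over all labellings of a shape

module Fill (K : CommutativeSemiring 0ℓ 0ℓ) {A : Set} (xs : List A) where
  open CommutativeSemiring K renaming (_≈_ to _∼_; refl to ∼-refl; sym to ∼-sym; trans to ∼-trans)
  open Sums K

  fill : Shape → (Tree A → Carrier) → Carrier
  fill (leaf _) g = ∑ xs (λ x → g (leaf x))
  fill (graft a b) g = fill a (λ r → fill b (λ s → g (graft r s)))

  fill-cong : ∀ p {g h} → (∀ r → g r ∼ h r) → fill p g ∼ fill p h
  fill-cong (leaf _) e = ∑-cong xs (λ x → e (leaf x))
  fill-cong (graft a b) e = fill-cong a (λ r → fill-cong b (λ s → e (graft r s)))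

  fill-+ : ∀ p g h → fill p (λ r → g r + h r) ∼ fill p g + fill p h
  fill-+ (leaf _) g h = ∑-+ xs _ _
  fill-+ (graft a b) g h = ∼-trans (fill-cong a (λ r → fill-+ b _ _)) (fill-+ a _ _)

  fill-∑ : ∀ p {J : Set} (js : List J) (F : Tree A → J → Carrier) →
           fill p (λ r → ∑ js (F r)) ∼ ∑ js (λ j → fill p (λ r → F r j))
  fill-∑ (leaf _) js F = ∑-swap xs js (F ∘ leaf)
  fill-∑ (graft a b) js F = ∼-trans (fill-cong a (λ r → fill-∑ b js (λ s → F (graft r s)))) (fill-∑ a js (λ r j → fill b (λ s → F (graft r s) j)))

  fill-*ˡ : ∀ p c g → fill p (λ r → c * g r) ∼ c * fill p g
  fill-*ˡ (leaf _) c g = ∑-*ˡ xs c _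
  fill-*ˡ (graft a b) c g = ∼-trans (fill-cong a (λ r → fill-*ˡ b c _)) (fill-*ˡ a c _)

  fill-*ʳ : ∀ p c g → fill p (λ r → g r * c) ∼ fill p g * c
  fill-*ʳ p c g = ∼-trans (fill-cong p (λ r → *-comm (g r) c)) (∼-trans (fill-*ˡ p c g) (*-comm c _))

  fill-product : ∀ p q g h → fill p (λ r → fill q (λ s → g r * h s)) ∼ fill p g * fill q h
  fill-product p q g h = ∼-trans (fill-cong p (λ r → fill-*ˡ q (g r) h)) (fill-*ʳ p (fill q h) g)

module _ {A : Set} (_≟_ : DecidableEquality A) (xs : List A)
         (complete : ∀ y → ℕΣ.∑ xs (λ x → indicator (x ≟ y)) ≡ 1) where
  open Fill ℕP.+-*-commutativeSemiring xs

  -- Each isomorphism of shapes respects the labels for exactly one labelling of p, the one pulled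
  -- back from q; `complete` says that this labelling occurs once in the sum.
  fill-isos : ∀ p q → fill p (λ r → isos _≟_ r q) ≡ shapeIsos p (shape q)
  fill-isos (leaf _) (leaf y) = complete y
  fill-isos (leaf _) (graft a b) = ℕΣ.∑-zero xs (λ _ → refl)
  fill-isos (graft a b) q = begin
    fill a (λ r → fill b (λ s → ℕΣ.∑ (splits q) (λ w → isos _≟_ r (proj₁ w) ℕ.* isos _≟_ s (proj₂ w))))
      ≡⟨ fill-cong a (λ r → fill-∑ b (splits q) _) ⟩
    fill a (λ r → ℕΣ.∑ (splits q) (λ w → fill b (λ s → isos _≟_ r (proj₁ w) ℕ.* isos _≟_ s (proj₂ w))))
      ≡⟨ fill-∑ a (splits q) _ ⟩
    ℕΣ.∑ (splits q) (λ w → fill a (λ r → fill b (λ s → isos _≟_ r (proj₁ w) ℕ.* isos _≟_ s (proj₂ w))))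
      ≡⟨ ℕΣ.∑-cong (splits q) (λ w → fill-product a b (λ r → isos _≟_ r (proj₁ w)) (λ s → isos _≟_ s (proj₂ w))) ⟩
    ℕΣ.∑ (splits q) (λ w → fill a (λ r → isos _≟_ r (proj₁ w)) ℕ.* fill b (λ s → isos _≟_ s (proj₂ w)))
      ≡⟨ ℕΣ.∑-cong (splits q) (λ w → cong₂ ℕ._*_ (fill-isos a (proj₁ w)) (fill-isos b (proj₂ w))) ⟩
    ℕΣ.∑ (splits q) (λ w → shapeIsos a (shape (proj₁ w)) ℕ.* shapeIsos b (shape (proj₂ w)))
      ≡⟨ ℕΣ.∑-map _ (splits q) _ ⟨
    ℕΣ.∑ (map _ (splits q)) (λ w → shapeIsos a (proj₁ w) ℕ.* shapeIsos b (proj₂ w))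
      ≡⟨ cong (λ l → ℕΣ.∑ l (λ w → shapeIsos a (proj₁ w) ℕ.* shapeIsos b (proj₂ w))) (splits-mapTree _ q) ⟨
    shapeIsos (graft a b) (shape q) ∎
    where open ≡.≡-Reasoning

-- Weighted sums over shapes

module Mass (K : CommutativeSemiring 0ℓ 0ℓ) (D : Sums.Inverses K) where
  open CommutativeSemiring K renaming (_≈_ to _∼_; refl to ∼-refl; sym to ∼-sym; trans to ∼-trans)
  open SetoidReasoning setoid
  open NatSolver K using (solve; _:=_; _:+_; _:*_)
  open Sums K
  open Inverses D

  -- A weighted sum over the shapes with n edges (for n < k) in which every isomorphism class has
  -- total weight 1/|Aut|. The factor (i+1)/(n+1) is the probability that a uniformly chosen
  -- non-root vertex lies in the branch of i+1 vertices that is cut off.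
  wsum : ℕ → ℕ → (Shape → Carrier) → Carrier
  wsum zero n g = 0#
  wsum (suc k) zero g = g (leaf tt)
  wsum (suc k) (suc n) g =
    inv (suc n) * diag n (λ i j → nat (suc i) * wsum k i (λ a → wsum k j (λ b → g (graft a b))))

  wsum-cong : ∀ k n {g h} → (∀ p → edges p ≡ n → g p ∼ h p) → wsum k n g ∼ wsum k n h
  wsum-cong zero n e = ∼-refl
  wsum-cong (suc k) zero e = e (leaf tt) refl
  wsum-cong (suc k) (suc n) e = *-congˡ (diag-cong n (λ i j i+j≡n → *-congˡ
    (wsum-cong k i (λ a ea → wsum-cong k j (λ b eb → e (graft a b)
      (trans (cong₂ (λ x y → x ℕ.+ suc y) eb ea) (trans (ℕP.+-comm j (suc i)) (cong suc i+j≡n))))))))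

  wsum-+ : ∀ k n g h → wsum k n (λ p → g p + h p) ∼ wsum k n g + wsum k n h
  wsum-+ zero n g h = ∼-sym (+-identityˡ 0#)
  wsum-+ (suc k) zero g h = ∼-refl
  wsum-+ (suc k) (suc n) g h = ∼-trans (*-congˡ (∼-trans (diag-cong n (λ i j _ →
      ∼-trans (*-congˡ (∼-trans (wsum-cong k i (λ a _ → wsum-+ k j _ _)) (wsum-+ k i _ _))) (distribˡ _ _ _)))
      (diag-+ n _ _))) (distribˡ _ _ _)

  wsum-*ˡ : ∀ k n c g → wsum k n (λ p → c * g p) ∼ c * wsum k n g
  wsum-*ˡ zero n c g = ∼-sym (zeroʳ c)
  wsum-*ˡ (suc k) zero c g = ∼-refl
  wsum-*ˡ (suc k) (suc n) c g = ∼-trans (*-congˡ (∼-trans (diag-cong n (λ i j _ →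
      ∼-trans (*-congˡ (∼-trans (wsum-cong k i (λ a _ → wsum-*ˡ k j c _)) (wsum-*ˡ k i c _))) (left-swap _ c _)))
      (diag-*ˡ n c _))) (left-swap _ c _)
    where
    left-swap : ∀ x y z → x * (y * z) ∼ y * (x * z)
    left-swap = solve 3 (λ x y z → x :* (y :* z) := y :* (x :* z)) ∼-refl

  wsum-*ʳ : ∀ k n c g → wsum k n (λ p → g p * c) ∼ wsum k n g * c
  wsum-*ʳ k n c g = ∼-trans (wsum-cong k n (λ p _ → *-comm (g p) c)) (∼-trans (wsum-*ˡ k n c g) (*-comm c _))

  wsum-zero : ∀ k n {g} → (∀ p → edges p ≡ n → g p ∼ 0#) → wsum k n g ∼ 0#
  wsum-zero k n {g} e = begin
    wsum k n g              ≈⟨ wsum-cong k n (λ p p≡n → ∼-trans (e p p≡n) (∼-sym (zeroˡ (g p)))) ⟩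
    wsum k n (λ p → 0# * g p) ≈⟨ wsum-*ˡ k n 0# g ⟩
    0# * wsum k n g         ≈⟨ zeroˡ _ ⟩
    0# ∎

  wsum-∑ : ∀ k n {J : Set} (js : List J) (F : Shape → J → Carrier) →
           wsum k n (λ p → ∑ js (F p)) ∼ ∑ js (λ j → wsum k n (λ p → F p j))
  wsum-∑ k n [] F = wsum-zero k n (λ _ _ → ∼-refl)
  wsum-∑ k n (j ∷ js) F = ∼-trans (wsum-+ k n _ _) (+-congˡ (wsum-∑ k n js F))

  wsum-product : ∀ k i j g h → wsum k i (λ a → wsum k j (λ b → g a * h b)) ∼ wsum k i g * wsum k j h
  wsum-product k i j g h = ∼-trans (wsum-cong k i (λ a _ → wsum-*ˡ k j (g a) h)) (wsum-*ʳ k i (wsum k j h) g)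

  nat-∑ : ∀ {J : Set} (js : List J) F → nat (ℕΣ.∑ js F) ∼ ∑ js (nat ∘ F)
  nat-∑ [] F = ∼-refl
  nat-∑ (j ∷ js) F = ∼-trans (nat-+ (F j) _) (+-congˡ (nat-∑ js F))

  -- For a split of q only the summand survives in which i and j are the edge numbers of its two
  -- parts. Both inner masses are 1 by induction, which leaves i+1. These numbers add up to n+1 and
  -- cancel against `inv`. The bound k is the depth of the recursion.
  wsum-isos : ∀ k n q → n ℕ.< k → edges q ≡ n → wsum k n (λ p → nat (shapeIsos p q)) ∼ 1#
  wsum-isos (suc k) zero (leaf tt) _ _ = +-identityʳ 1#
  wsum-isos (suc k) zero (graft a b) _ e = ⊥-elim (ℕP.m+1+n≢0 (edges b) e)
  wsum-isos (suc k) (suc n) q (s≤s n<k) q≡n = begin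
    inv (suc n) * diag n (λ i j → nat (suc i) * wsum k i (λ a → wsum k j (λ b → nat (shapeIsos (graft a b) q))))
      ≈⟨ *-congˡ (diag-cong n (λ i j _ → *-congˡ (factor i j))) ⟩
    inv (suc n) * diag n (λ i j → nat (suc i) * ∑ (splits q) (λ s → mass i (proj₁ s) * mass j (proj₂ s)))
      ≈⟨ *-congˡ (diag-cong n (λ i j _ → ∼-sym (∑-*ˡ (splits q) (nat (suc i)) _))) ⟩
    inv (suc n) * diag n (λ i j → ∑ (splits q) (λ s → nat (suc i) * (mass i (proj₁ s) * mass j (proj₂ s))))
      ≈⟨ *-congˡ (diag-∑ n (splits q) (λ i j s → nat (suc i) * (mass i (proj₁ s) * mass j (proj₂ s)))) ⟩
    inv (suc n) * ∑ (splits q) (λ s → diag n (λ i j → nat (suc i) * (mass i (proj₁ s) * mass j (proj₂ s))))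
      ≈⟨ *-congˡ (∑-cong-All (All.map (λ {s} → pick s) (splits-edges q))) ⟩
    inv (suc n) * ∑ (splits q) (λ s → nat (suc (edges (proj₁ s))))
      ≈⟨ *-congˡ (nat-∑ (splits q) _) ⟨
    inv (suc n) * nat (ℕΣ.∑ (splits q) (λ s → suc (edges (proj₁ s))))
      ≈⟨ *-congˡ (reflexive (cong nat (trans (splits-total q) q≡n))) ⟩
    inv (suc n) * nat (suc n)
      ≈⟨ ∼-trans (*-comm _ _) (nat-inv n) ⟩
    1# ∎
    where
    mass : ℕ → Shape → Carrier
    mass i s = wsum k i (λ p → nat (shapeIsos p s))

    factor : ∀ i j → wsum k i (λ a → wsum k j (λ b → nat (shapeIsos (graft a b) q))) ∼
                     ∑ (splits q) (λ s → mass i (proj₁ s) * mass j (proj₂ s))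
    factor i j = begin
      wsum k i (λ a → wsum k j (λ b → nat (shapeIsos (graft a b) q)))
        ≈⟨ wsum-cong k i (λ a _ → wsum-cong k j (λ b _ → ∼-trans (nat-∑ (splits q) _)
             (∑-cong (splits q) (λ s → nat-* (shapeIsos a (proj₁ s)) (shapeIsos b (proj₂ s)))))) ⟩
      wsum k i (λ a → wsum k j (λ b → ∑ (splits q) (λ s → nat (shapeIsos a (proj₁ s)) * nat (shapeIsos b (proj₂ s)))))
        ≈⟨ wsum-cong k i (λ a _ → wsum-∑ k j (splits q) _) ⟩
      wsum k i (λ a → ∑ (splits q) (λ s → wsum k j (λ b → nat (shapeIsos a (proj₁ s)) * nat (shapeIsos b (proj₂ s)))))
        ≈⟨ wsum-∑ k i (splits q) _ ⟩
      ∑ (splits q) (λ s → wsum k i (λ a → wsum k j (λ b → nat (shapeIsos a (proj₁ s)) * nat (shapeIsos b (proj₂ s)))))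
        ≈⟨ ∑-cong (splits q) (λ s → wsum-product k i j (λ a → nat (shapeIsos a (proj₁ s))) (λ b → nat (shapeIsos b (proj₂ s)))) ⟩
      ∑ (splits q) (λ s → mass i (proj₁ s) * mass j (proj₂ s)) ∎

    pick : ∀ s → edges (proj₂ s) ℕ.+ suc (edges (proj₁ s)) ≡ edges q →
           diag n (λ i j → nat (suc i) * (mass i (proj₁ s) * mass j (proj₂ s))) ∼ nat (suc (edges (proj₁ s)))
    pick (s₁ , s₂) e = diag-select n (edges s₁) (edges s₂) sum≡n
      (∼-trans (*-congˡ (∼-trans (*-cong (wsum-isos k (edges s₁) s₁ (below s₁ (subst (edges s₁ ≤_) sum≡n (ℕP.m≤m+n _ _))) refl)
                                         (wsum-isos k (edges s₂) s₂ (below s₂ (subst (edges s₂ ≤_) sum≡n (ℕP.m≤n+m _ (edges s₁)))) refl))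
                                 (*-identityˡ 1#)))
               (*-identityʳ _))
      -- For any other i there is no isomorphism onto the branch, because isomorphic trees have
      -- equally many edges.
      (λ i j _ i≢ → ∼-trans (*-congˡ (∼-trans (*-congʳ
          (wsum-zero k i (λ p p≡i → reflexive (cong nat (isos-edges _≟⊤_ p s₁ (λ p≡s → i≢ (trans (sym p≡i) p≡s))))))) (zeroˡ _))) (zeroʳ _))
      where
      sum≡n : edges s₁ ℕ.+ edges s₂ ≡ n
      sum≡n = ℕP.suc-injective (trans (ℕP.+-comm (suc (edges s₁)) (edges s₂)) (trans e q≡n))
      below : ∀ s → edges s ≤ n → edges s ℕ.< k
      below s l = ℕP.≤-trans (s≤s l) n<k

-- Graphs of labelled trees

infix 4 _∈_
data _∈_ {A : Set} (x : A) : Tree A → Set where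
  leaf  : ∀ {y} → x ≡ y → x ∈ leaf y
  left  : ∀ {a b} → x ∈ a → x ∈ graft a b
  right : ∀ {a b} → x ∈ b → x ∈ graft a b

data Distinct {A : Set} : Tree A → Set where
  leaf  : ∀ {x} → Distinct (leaf x)
  graft : ∀ {a b} → Distinct a → Distinct b → (∀ {x} → x ∈ a → x ∈ b → ⊥) → Distinct (graft a b)

-- Edge q x y: x is a child of y in q.
data Edge {A : Set} : Tree A → A → A → Set where
  new   : ∀ {a b x y} → x ≡ root a → y ≡ root b → Edge (graft a b) x y
  left  : ∀ {a b x y} → Edge a x y → Edge (graft a b) x y
  right : ∀ {a b x y} → Edge b x y → Edge (graft a b) x y

Adj : ∀ {A : Set} → Tree A → A → A → Set
Adj q x y = Edge q x y ⊎ Edge q y x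

module _ {A : Set} where
  root∈ : ∀ (q : Tree A) → root q ∈ q
  root∈ (leaf x) = leaf refl
  root∈ (graft a b) = right (root∈ b)

  edge-∈ˡ : ∀ {q : Tree A} {x y} → Edge q x y → x ∈ q
  edge-∈ˡ {graft a b} (new refl refl) = left (root∈ a)
  edge-∈ˡ (left e) = left (edge-∈ˡ e)
  edge-∈ˡ (right e) = right (edge-∈ˡ e)

  edge-∈ʳ : ∀ {q : Tree A} {x y} → Edge q x y → y ∈ q
  edge-∈ʳ {graft a b} (new refl refl) = right (root∈ b)
  edge-∈ʳ (left e) = left (edge-∈ʳ e)
  edge-∈ʳ (right e) = right (edge-∈ʳ e)

  adj-∈ˡ : ∀ {q : Tree A} {x y} → Adj q x y → x ∈ q
  adj-∈ˡ (inj₁ e) = edge-∈ˡ e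
  adj-∈ˡ (inj₂ e) = edge-∈ʳ e

  adj-∈ʳ : ∀ {q : Tree A} {x y} → Adj q x y → y ∈ q
  adj-∈ʳ (inj₁ e) = edge-∈ʳ e
  adj-∈ʳ (inj₂ e) = edge-∈ˡ e

  child≢root : ∀ {q : Tree A} {x y} → Distinct q → Edge q x y → ¬ (x ≡ root q)
  child≢root {graft a b} (graft _ _ dis) (new refl _) e = dis (root∈ a) (subst (_∈ b) (sym e) (root∈ b))
  child≢root {graft a b} (graft _ _ dis) (left e) p = dis (edge-∈ˡ e) (subst (_∈ b) (sym p) (root∈ b))
  child≢root (graft _ db _) (right e) p = child≢root db e p

  -- What is shared by two forms of a tree that differ in the order of children. Membership and
  -- edges do not see repeated labels, hence the separate field `distinct`.
  record Congruent (p q : Tree A) : Set where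
    field
      root≡    : root p ≡ root q
      ∈⇒       : ∀ {x} → x ∈ p → x ∈ q
      ∈⇐       : ∀ {x} → x ∈ q → x ∈ p
      edge⇒    : ∀ {x y} → Edge p x y → Edge q x y
      edge⇐    : ∀ {x y} → Edge q x y → Edge p x y
      distinct : Distinct q → Distinct p
  open Congruent

  congruent-refl : ∀ {p} → Congruent p p
  congruent-refl = record { root≡ = refl ; ∈⇒ = id ; ∈⇐ = id ; edge⇒ = id ; edge⇐ = id ; distinct = id }

  congruent-trans : ∀ {p q r} → Congruent p q → Congruent q r → Congruent p r
  congruent-trans c d = record
    { root≡ = trans (root≡ c) (root≡ d)
    ; ∈⇒ = ∈⇒ d ∘ ∈⇒ c ; ∈⇐ = ∈⇐ c ∘ ∈⇐ d
    ; edge⇒ = edge⇒ d ∘ edge⇒ c ; edge⇐ = edge⇐ c ∘ edge⇐ d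
    ; distinct = distinct c ∘ distinct d }

  congruent-graft : ∀ {a b c d} → Congruent a c → Congruent b d → Congruent (graft a b) (graft c d)
  congruent-graft {a} {b} {c} {d} f g = record
    { root≡ = root≡ g
    ; ∈⇒ = λ { (left i) → left (∈⇒ f i) ; (right i) → right (∈⇒ g i) }
    ; ∈⇐ = λ { (left i) → left (∈⇐ f i) ; (right i) → right (∈⇐ g i) }
    ; edge⇒ = λ { (new p q) → new (trans p (root≡ f)) (trans q (root≡ g)) ; (left e) → left (edge⇒ f e) ; (right e) → right (edge⇒ g e) }
    ; edge⇐ = λ { (new p q) → new (trans p (sym (root≡ f))) (trans q (sym (root≡ g))) ; (left e) → left (edge⇐ f e) ; (right e) → right (edge⇐ g e) }
    ; distinct = λ { (graft dc dd dis) → graft (distinct f dc) (distinct g dd) (λ i j → dis (∈⇒ f i) (∈⇒ g j)) } }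

  congruent-exchange : ∀ {a c d} → Congruent (graft c (graft a d)) (graft a (graft c d))
  congruent-exchange {a} {c} {d} = record
    { root≡ = refl
    ; ∈⇒ = swap∈ ; ∈⇐ = swap∈
    ; edge⇒ = swapE ; edge⇐ = swapE
    ; distinct = λ { (graft da (graft dc dd i) j) →
        graft dc (graft da dd (λ x y → j x (right y))) (λ { x (left y) → j y (left x) ; x (right y) → i x y }) } }
    where
    swap∈ : ∀ {a c d : Tree A} {x} → x ∈ graft c (graft a d) → x ∈ graft a (graft c d)
    swap∈ (left i) = right (left i)
    swap∈ (right (left i)) = left i
    swap∈ (right (right i)) = right (right i)
    swapE : ∀ {a c d : Tree A} {x y} → Edge (graft c (graft a d)) x y → Edge (graft a (graft c d)) x y
    swapE (new p q) = right (new p q)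
    swapE (left e) = right (left e)
    swapE (right (new p q)) = new p q
    swapE (right (left e)) = left e
    swapE (right (right e)) = right (right e)

  splits-congruent : ∀ q → All (λ s → Congruent (graft (proj₁ s) (proj₂ s)) q) (splits q)
  splits-congruent (leaf x) = []
  splits-congruent (graft a b) = congruent-refl ∷ AllP.map⁺ (All.map
    (λ c → congruent-trans congruent-exchange (congruent-graft congruent-refl c)) (splits-congruent b))

  -- A branch is identified by the label of its root, so at most one term of the sum defining `isos`
  -- can be nonzero.
  splits-roots : ∀ {q : Tree A} → Distinct q → AllPairs (λ s s' → ¬ (root (proj₁ s) ≡ root (proj₁ s'))) (splits q)
  splits-roots leaf = []
  splits-roots {graft a b} (graft da db dis) =
    AllP.map⁺ (All.map (λ {s} c e → dis (root∈ a) (subst (_∈ b) (sym e) (∈⇒ c (left (root∈ (proj₁ s)))))) (splits-congruent b))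
    ∷ AllPairsP.map⁺ (splits-roots db)

  split-at : ∀ {q : Tree A} {x y} → Distinct q → Edge q x y → y ≡ root q → Any (λ s → root (proj₁ s) ≡ x) (splits q)
  split-at _ (new refl _) _ = here refl
  split-at {graft a b} (graft _ _ dis) (left e) p = ⊥-elim (dis (edge-∈ʳ e) (subst (_∈ b) (sym p) (root∈ b)))
  split-at (graft _ db _) (right e) p = there (AnyP.map⁺ (split-at db e p))

  -- A tree is connected, so S spreads from the root along the edges. It can stop only at the
  -- exceptional vertex z, which lies outside the tree.
  walk : ∀ (a : Tree A) (S : A → Set) {z} → ¬ (z ∈ a) → (∀ {x y} → Adj a x y → S x → S y ⊎ y ≡ z) →
         S (root a) → ∀ {x} → x ∈ a → S x
  walk (leaf _) S _ _ s (leaf refl) = s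
  walk (graft a b) S z∉ step s (right i) =
    walk b S (z∉ ∘ right) (λ { (inj₁ e) → step (inj₁ (right e)) ; (inj₂ e) → step (inj₂ (right e)) }) s i
  walk (graft a b) S z∉ step s (left i) with step (inj₂ (new refl refl)) s
  ... | inj₂ refl = ⊥-elim (z∉ (left (root∈ a)))
  ... | inj₁ s' =
    walk a S (z∉ ∘ left) (λ { (inj₁ e) → step (inj₁ (left e)) ; (inj₂ e) → step (inj₂ (left e)) }) s' i

  module _ {a b : Tree A} (dis : ∀ {x} → x ∈ a → x ∈ b → ⊥) where
    leave-left : ∀ {x y} → Adj (graft a b) x y → x ∈ a → y ∈ a ⊎ y ≡ root b
    leave-left (inj₁ (new _ q)) i = inj₂ q
    leave-left (inj₁ (left e)) i = inj₁ (edge-∈ʳ e)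
    leave-left (inj₁ (right e)) i = ⊥-elim (dis i (edge-∈ˡ e))
    leave-left (inj₂ (new refl _)) i = inj₁ (root∈ a)
    leave-left (inj₂ (left e)) i = inj₁ (edge-∈ˡ e)
    leave-left (inj₂ (right e)) i = ⊥-elim (dis i (edge-∈ʳ e))

    leave-right : ∀ {x y} → Adj (graft a b) x y → x ∈ b → y ∈ b ⊎ y ≡ root a
    leave-right (inj₁ (new _ refl)) i = inj₁ (root∈ b)
    leave-right (inj₁ (left e)) i = ⊥-elim (dis (edge-∈ˡ e) i)
    leave-right (inj₁ (right e)) i = inj₁ (edge-∈ʳ e)
    leave-right (inj₂ (new p _)) i = inj₂ p
    leave-right (inj₂ (left e)) i = ⊥-elim (dis (edge-∈ʳ e) i)
    leave-right (inj₂ (right e)) i = inj₁ (edge-∈ˡ e)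

    edge-left : ∀ {x y} → Edge (graft a b) x y → x ∈ a → y ∈ a → Edge a x y
    edge-left (new _ refl) _ j = ⊥-elim (dis j (root∈ b))
    edge-left (left e) _ _ = e
    edge-left (right e) i _ = ⊥-elim (dis i (edge-∈ˡ e))

    edge-right : ∀ {x y} → Edge (graft a b) x y → x ∈ b → y ∈ b → Edge b x y
    edge-right (new refl _) i _ = ⊥-elim (dis (root∈ a) i)
    edge-right (left e) i _ = ⊥-elim (dis (edge-∈ˡ e) i)
    edge-right (right e) _ _ = e

    adj-left : ∀ {x y} → Adj (graft a b) x y → x ∈ a → y ∈ a → Adj a x y
    adj-left (inj₁ e) i j = inj₁ (edge-left e i j)
    adj-left (inj₂ e) i j = inj₂ (edge-left e j i)

    adj-right : ∀ {x y} → Adj (graft a b) x y → x ∈ b → y ∈ b → Adj b x y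
    adj-right (inj₁ e) i j = inj₁ (edge-right e i j)
    adj-right (inj₂ e) i j = inj₂ (edge-right e j i)

  graft-adjˡ : ∀ {a b : Tree A} {x y} → Adj a x y → Adj (graft a b) x y
  graft-adjˡ (inj₁ e) = inj₁ (left e)
  graft-adjˡ (inj₂ e) = inj₂ (left e)

  graft-adjʳ : ∀ {a b : Tree A} {x y} → Adj b x y → Adj (graft a b) x y
  graft-adjʳ (inj₁ e) = inj₁ (right e)
  graft-adjʳ (inj₂ e) = inj₂ (right e)

  -- Unlike Congruent, this compares undirected edges.
  record SameGraph (p q : Tree A) : Set where
    field
      root≡ : root p ≡ root q
      ∈⇒    : ∀ {x} → x ∈ p → x ∈ q
      ∈⇐    : ∀ {x} → x ∈ q → x ∈ p
      adj⇒  : ∀ {x y} → Adj p x y → Adj q x y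
      adj⇐  : ∀ {x y} → Adj q x y → Adj p x y

  -- Each of the two parts is connected, and the only edge between them joins their roots.
  sameGraph-graft : ∀ {a b c d} → Distinct (graft a b) → Distinct (graft c d) → root c ≡ root a →
                    SameGraph (graft a b) (graft c d) → SameGraph a c × SameGraph b d
  sameGraph-graft {a} {b} {c} {d} (graft _ _ ab) (graft _ _ cd) r s =
    (record { root≡ = sym r ; ∈⇒ = a⊆c ; ∈⇐ = c⊆a
            ; adj⇒ = λ e → adj-left cd (adj⇒ (graft-adjˡ e)) (a⊆c (adj-∈ˡ e)) (a⊆c (adj-∈ʳ e))
            ; adj⇐ = λ e → adj-left ab (adj⇐ (graft-adjˡ e)) (c⊆a (adj-∈ˡ e)) (c⊆a (adj-∈ʳ e)) }) ,
    (record { root≡ = SameGraph.root≡ s ; ∈⇒ = b⊆d ; ∈⇐ = d⊆b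
            ; adj⇒ = λ e → adj-right cd (adj⇒ (graft-adjʳ e)) (b⊆d (adj-∈ˡ e)) (b⊆d (adj-∈ʳ e))
            ; adj⇐ = λ e → adj-right ab (adj⇐ (graft-adjʳ e)) (d⊆b (adj-∈ˡ e)) (d⊆b (adj-∈ʳ e)) })
    where
    open SameGraph s using (adj⇒; adj⇐)
    a⊆c : ∀ {x} → x ∈ a → x ∈ c
    -- The walk inside a could leave c only through `root d`, which equals `root b` and is therefore
    -- not in a.
    a⊆c = walk a (_∈ c) (λ i → ab i (subst (_∈ b) (SameGraph.root≡ s) (root∈ b)))
               (λ e → leave-left cd (adj⇒ (graft-adjˡ e))) (subst (_∈ c) r (root∈ c))
    b⊆d : ∀ {x} → x ∈ b → x ∈ d
    b⊆d = walk b (_∈ d) (λ i → ab (subst (_∈ a) (sym r) (root∈ a)) i)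
               (λ e → leave-right cd (adj⇒ (graft-adjʳ e))) (subst (_∈ d) (sym (SameGraph.root≡ s)) (root∈ d))
    c⊆a : ∀ {x} → x ∈ c → x ∈ a
    c⊆a i with SameGraph.∈⇐ s (left i)
    ... | left j = j
    ... | right j = ⊥-elim (cd i (b⊆d j))
    d⊆b : ∀ {x} → x ∈ d → x ∈ b
    d⊆b i with SameGraph.∈⇐ s (right i)
    ... | left j = ⊥-elim (cd (a⊆c j) i)
    ... | right j = j

∑≢0 : ∀ {I : Set} (xs : List I) (g : I → ℕ) → ¬ (ℕΣ.∑ xs g ≡ 0) → Any (λ x → ¬ (g x ≡ 0)) xs
∑≢0 [] g ne = ⊥-elim (ne refl)
∑≢0 (x ∷ xs) g ne with g x ℕ.≟ 0
... | yes e = there (∑≢0 xs g (λ z → ne (trans (cong (ℕ._+ ℕΣ.∑ xs g) e) z)))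
... | no n = here n

module _ {A : Set} (_≟_ : DecidableEquality A) where
  isos⇒congruent : ∀ p q → ¬ (isos _≟_ p q ≡ 0) → Congruent p q
  isos⇒congruent (leaf x) (leaf y) ne with x ≟ y
  ... | yes refl = congruent-refl
  ... | no _ = ⊥-elim (ne refl)
  isos⇒congruent (leaf x) (graft _ _) ne = ⊥-elim (ne refl)
  isos⇒congruent (graft a b) q ne = find (splits-congruent q) (∑≢0 (splits q) _ ne)
    where
    find : ∀ {ss} → All (λ s → Congruent (graft (proj₁ s) (proj₂ s)) q) ss →
           Any (λ s → ¬ (isos _≟_ a (proj₁ s) ℕ.* isos _≟_ b (proj₂ s) ≡ 0)) ss → Congruent (graft a b) q
    find {s ∷ _} (c ∷ _) (here n) = congruent-trans (congruent-graft
      (isos⇒congruent a (proj₁ s) (λ e → n (cong (ℕ._* isos _≟_ b (proj₂ s)) e)))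
      (isos⇒congruent b (proj₂ s) (λ e → n (trans (cong (isos _≟_ a (proj₁ s) ℕ.*_) e) (ℕP.*-zeroʳ (isos _≟_ a (proj₁ s))))))) c
    find (_ ∷ cs) (there n) = find cs n

  -- The branch a can be matched only with the branch of q at the child labelled `root a`. That
  -- branch exists, is unique and has the same graph as a, so exactly one term of the sum is 1 and
  -- the others vanish.
  sameGraph⇒isos : ∀ p q → Distinct p → Distinct q → SameGraph p q → isos _≟_ p q ≡ 1
  sameGraph⇒isos (leaf x) (leaf y) _ _ s with x ≟ y
  ... | yes _ = refl
  ... | no ne = ⊥-elim (ne (SameGraph.root≡ s))
  sameGraph⇒isos (leaf x) (graft a b) _ (graft _ _ dis) s with SameGraph.∈⇐ s (left (root∈ a))
  ... | leaf e = ⊥-elim (dis (root∈ a) (subst (_∈ b) (sym (trans e (SameGraph.root≡ s))) (root∈ b)))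
  sameGraph⇒isos (graft a b) q dp@(graft da db _) dq s =
    ℕΣ.∑-select (splits-congruent q) (split-at dq child (SameGraph.root≡ s))
      (AllPairs.map (λ ne e → ne (trans (proj₁ e) (sym (proj₂ e)))) (splits-roots dq)) on off
    where
    child : Edge q (root a) (root b)
    -- The common graph is undirected. The edge is oriented towards `root b` because that is the
    -- root of q, which is nobody's child.
    child with SameGraph.adj⇒ s (inj₁ (new refl refl))
    ... | inj₁ e = e
    ... | inj₂ e = ⊥-elim (child≢root dq e (SameGraph.root≡ s))

    on : ∀ w → Congruent (graft (proj₁ w) (proj₂ w)) q → root (proj₁ w) ≡ root a →
         isos _≟_ a (proj₁ w) ℕ.* isos _≟_ b (proj₂ w) ≡ 1
    on (c , d) g r with Congruent.distinct g dq
    ... | dcd@(graft dc dd _) with sameGraph-graft dp dcd r s'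
      where
      adj⇐ : ∀ {x y} → Adj q x y → Adj (graft c d) x y
      adj⇐ (inj₁ e) = inj₁ (Congruent.edge⇐ g e)
      adj⇐ (inj₂ e) = inj₂ (Congruent.edge⇐ g e)
      adj⇒ : ∀ {x y} → Adj (graft c d) x y → Adj q x y
      adj⇒ (inj₁ e) = inj₁ (Congruent.edge⇒ g e)
      adj⇒ (inj₂ e) = inj₂ (Congruent.edge⇒ g e)
      s' : SameGraph (graft a b) (graft c d)
      s' = record
        { root≡ = trans (SameGraph.root≡ s) (sym (Congruent.root≡ g))
        ; ∈⇒ = Congruent.∈⇐ g ∘ SameGraph.∈⇒ s ; ∈⇐ = SameGraph.∈⇐ s ∘ Congruent.∈⇒ g
        ; adj⇒ = adj⇐ ∘ SameGraph.adj⇒ s ; adj⇐ = SameGraph.adj⇐ s ∘ adj⇒ }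
    ... | sa , sb = cong₂ ℕ._*_ (sameGraph⇒isos a c da dc sa) (sameGraph⇒isos b d db dd sb)

    off : ∀ w → ¬ (root (proj₁ w) ≡ root a) → isos _≟_ a (proj₁ w) ℕ.* isos _≟_ b (proj₂ w) ≡ 0
    off (c , d) ne with isos _≟_ a c ℕ.≟ 0
    ... | yes z = cong (ℕ._* isos _≟_ b d) z
    ... | no nz = ⊥-elim (ne (sym (Congruent.root≡ (isos⇒congruent a c nz))))

-- Relabelling a tree by all functions on its vertices

module Relabel (K : CommutativeSemiring 0ℓ 0ℓ) {A : Set} (xs : List A) where
  open CommutativeSemiring K renaming (_≈_ to _∼_; refl to ∼-refl; sym to ∼-sym; trans to ∼-trans)
  open SetoidReasoning setoid
  open Sums K
  open Fill K xs

  listSum : ℕ → (List A → Carrier) → Carrier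
  listSum zero h = h []
  listSum (suc k) h = ∑ xs (λ a → listSum k (λ l → h (a ∷ l)))

  map-cons-allFin : ∀ {n} (a : A) (f : Fin n → A) → map (a VF.∷ f) (allFin (suc n)) ≡ a ∷ map f (allFin n)
  map-cons-allFin a f = cong (a ∷_) (trans (ListP.map-tabulate Fin.suc (a VF.∷ f)) (sym (ListP.map-tabulate id f)))

  ∑-allFuns : ∀ n h → ∑ (allFuns n xs) (λ f → h (map f (allFin n))) ∼ listSum n h
  ∑-allFuns zero h = +-identityʳ _
  ∑-allFuns (suc n) h = begin
    ∑ (allFuns (suc n) xs) (λ f → h (map f (allFin (suc n))))
      ≈⟨ ∑-concatMap _ (allFuns n xs) _ ⟩
    ∑ (allFuns n xs) (λ f → ∑ (map (λ a → a VF.∷ f) xs) (λ f → h (map f (allFin (suc n)))))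
      ≈⟨ ∑-cong (allFuns n xs) (λ f → ∑-map _ xs _) ⟩
    ∑ (allFuns n xs) (λ f → ∑ xs (λ a → h (map (a VF.∷ f) (allFin (suc n)))))
      ≈⟨ ∑-cong (allFuns n xs) (λ f → ∑-cong xs (λ a → reflexive (cong h (map-cons-allFin a f)))) ⟩
    ∑ (allFuns n xs) (λ f → ∑ xs (λ a → h (a ∷ map f (allFin n))))
      ≈⟨ ∑-swap (allFuns n xs) xs _ ⟩
    ∑ xs (λ a → ∑ (allFuns n xs) (λ f → h (a ∷ map f (allFin n))))
      ≈⟨ ∑-cong xs (λ a → ∑-allFuns n (λ l → h (a ∷ l))) ⟩
    listSum (suc n) h ∎

  -- Reordering the summation variables. The summand h' is h with its arguments permuted; it is
  -- built by recursion on the permutation, so that no inverse permutation has to be formed.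
  listSum-↭ : ∀ {I : Set} {is js : List I} → is ↭ js → ∀ h → ∃ λ h' →
              (∀ f → h (map f is) ≡ h' (map f js)) × listSum (List.length is) h ∼ listSum (List.length js) h'
  listSum-↭ Perm.refl h = h , (λ _ → refl) , ∼-refl
  listSum-↭ {is = i ∷ is} {.i ∷ js} (Perm.prep i p) h = h' , (λ f → proj₁ (proj₂ (rec (f i))) f) , ∑-cong xs (λ a → proj₂ (proj₂ (rec a)))
    where
    rec = λ a → listSum-↭ p (λ l → h (a ∷ l))
    h' : List A → Carrier
    -- An arbitrary value: the lists that occur are as long as the index list, which is nonempty
    -- here.
    h' [] = 0#
    h' (a ∷ l) = proj₁ (rec a) l
  listSum-↭ {is = i ∷ j ∷ is} {.j ∷ .i ∷ js} (Perm.swap i j p) h = h' , (λ f → proj₁ (proj₂ (rec (f i) (f j))) f) ,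
    ∼-trans (∑-swap xs xs (λ a b → listSum (List.length is) (λ l → h (a ∷ b ∷ l)))) (∑-cong xs (λ b → ∑-cong xs (λ a → proj₂ (proj₂ (rec a b)))))
    where
    rec = λ a b → listSum-↭ p (λ l → h (a ∷ b ∷ l))
    h' : List A → Carrier
    h' [] = 0#
    h' (_ ∷ []) = 0#
    h' (b ∷ a ∷ l) = proj₁ (rec a b) l
  listSum-↭ (Perm.trans p q) h with listSum-↭ p h
  ... | h₁ , e₁ , s₁ with listSum-↭ q h₁
  ... | h₂ , e₂ , s₂ = h₂ , (λ f → trans (e₁ f) (e₂ f)) , ∼-trans s₁ s₂

  -- Consumes the labels of a tree in the order of `labels` and hands the tree with the rest of the
  -- list to k. It translates between functions of a labelled tree and functions of a list; 0# is
  -- the default for a list that is too short.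
  parse : Shape → (Tree A → List A → Carrier) → List A → Carrier
  parse (leaf _) k [] = 0#
  parse (leaf _) k (x ∷ l) = k (leaf x) l
  parse (graft a b) k = parse a (λ r → parse b (λ s → k (graft r s)))

  parse-labels : ∀ {I : Set} (f : I → A) q k l → parse (shape q) k (map f (labels q) ++ l) ≡ k (mapTree f q) l
  parse-labels f (leaf x) k l = refl
  parse-labels f (graft a b) k l = trans
    (cong (parse (shape a) _) (trans (cong (_++ l) (ListP.map-++ f (labels a) (labels b))) (ListP.++-assoc (map f (labels a)) _ l)))
    (trans (parse-labels f a _ (map f (labels b) ++ l)) (parse-labels f b (λ s → k (graft (mapTree f a) s)) l))

  listSum-parse : ∀ {I : Set} (q : Tree I) k m →
    listSum (List.length (labels q) ℕ.+ m) (parse (shape q) k) ∼ fill (shape q) (λ r → listSum m (k r))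
  listSum-parse (leaf x) k m = ∼-refl
  listSum-parse (graft a b) k m = begin
    listSum (List.length (labels a ++ labels b) ℕ.+ m) (parse (shape (graft a b)) k)
      ≡⟨ cong (λ n → listSum n (parse (shape (graft a b)) k))
           (trans (cong (ℕ._+ m) (ListP.length-++ (labels a))) (ℕP.+-assoc (List.length (labels a)) _ m)) ⟩
    listSum (List.length (labels a) ℕ.+ (List.length (labels b) ℕ.+ m)) (parse (shape (graft a b)) k)
      ≈⟨ listSum-parse a (λ r → parse (shape b) (λ s → k (graft r s))) (List.length (labels b) ℕ.+ m) ⟩
    fill (shape a) (λ r → listSum (List.length (labels b) ℕ.+ m) (parse (shape b) (λ s → k (graft r s))))
      ≈⟨ fill-cong (shape a) (λ r → listSum-parse b (λ s → k (graft r s)) m) ⟩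
    fill (shape (graft a b)) (λ r → listSum m (k r)) ∎

  -- Every element of Fin n labels exactly one vertex of q, so relabelling by all functions yields
  -- every labelling of the shape once. The vertices of q come in another order than in `allFin`,
  -- which `listSum-↭` repairs.
  ∑-relabel : ∀ {n} (q : Tree (Fin n)) → labels q ↭ allFin n → ∀ g →
              ∑ (allFuns n xs) (λ f → g (mapTree f q)) ∼ fill (shape q) g
  ∑-relabel {n} q perm g with listSum-↭ perm (parse (shape q) (λ r _ → g r))
  ... | h , same , sums = begin
    ∑ (allFuns n xs) (λ f → g (mapTree f q))
      ≈⟨ ∑-cong (allFuns n xs) (λ f → reflexive (trans (sym (parse-labels f q (λ r _ → g r) []))
           (trans (cong (parse (shape q) (λ r _ → g r)) (ListP.++-identityʳ (map f (labels q)))) (same f)))) ⟩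
    ∑ (allFuns n xs) (λ f → h (map f (allFin n)))
      ≈⟨ ∑-allFuns n h ⟩
    listSum n h
      ≡⟨ cong (λ m → listSum m h) (ListP.length-tabulate {n = n} id) ⟨
    listSum (List.length (allFin n)) h
      ≈⟨ sums ⟨
    listSum (List.length (labels q)) (parse (shape q) (λ r _ → g r))
      ≡⟨ cong (λ m → listSum m (parse (shape q) (λ r _ → g r))) (ℕP.+-identityʳ (List.length (labels q))) ⟨
    listSum (List.length (labels q) ℕ.+ 0) (parse (shape q) (λ r _ → g r))
      ≈⟨ listSum-parse q (λ r _ → g r) 0 ⟩
    fill (shape q) g ∎

module _ {A B : Set} (f : A → B) where
  ∈-map : ∀ {q : Tree A} {x} → x ∈ q → f x ∈ mapTree f q
  ∈-map (leaf refl) = leaf refl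
  ∈-map (left i) = left (∈-map i)
  ∈-map (right i) = right (∈-map i)

  ∈-map⁻ : ∀ (q : Tree A) {y} → y ∈ mapTree f q → ∃ λ x → y ≡ f x × x ∈ q
  ∈-map⁻ (leaf x) (leaf e) = x , e , leaf refl
  ∈-map⁻ (graft a b) (left i) with ∈-map⁻ a i
  ... | x , e , j = x , e , left j
  ∈-map⁻ (graft a b) (right i) with ∈-map⁻ b i
  ... | x , e , j = x , e , right j

  edge-map : ∀ {q : Tree A} {x y} → Edge q x y → Edge (mapTree f q) (f x) (f y)
  edge-map {graft a b} (new refl refl) = new (sym (root-mapTree f a)) (sym (root-mapTree f b))
  edge-map (left e) = left (edge-map e)
  edge-map (right e) = right (edge-map e)

  edge-map⁻ : ∀ (q : Tree A) {x y} → Edge (mapTree f q) x y → ∃ λ u → ∃ λ v → x ≡ f u × y ≡ f v × Edge q u v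
  edge-map⁻ (graft a b) (new p r) =
    root a , root b , trans p (root-mapTree f a) , trans r (root-mapTree f b) , new refl refl
  edge-map⁻ (graft a b) (left e) with edge-map⁻ a e
  ... | u , v , p , r , e' = u , v , p , r , left e'
  edge-map⁻ (graft a b) (right e) with edge-map⁻ b e
  ... | u , v , p , r , e' = u , v , p , r , right e'

  adj-map : ∀ {q : Tree A} {x y} → Adj q x y → Adj (mapTree f q) (f x) (f y)
  adj-map (inj₁ e) = inj₁ (edge-map e)
  adj-map (inj₂ e) = inj₂ (edge-map e)

  adj-map⁻ : ∀ (q : Tree A) {x y} → Adj (mapTree f q) x y → ∃ λ u → ∃ λ v → x ≡ f u × y ≡ f v × Adj q u v
  adj-map⁻ q (inj₁ e) with edge-map⁻ q e
  ... | u , v , p , r , e' = u , v , p , r , inj₁ e'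
  adj-map⁻ q (inj₂ e) with edge-map⁻ q e
  ... | u , v , p , r , e' = v , u , r , p , inj₂ e'

  distinct-map : (∀ {x y} → f x ≡ f y → x ≡ y) → ∀ {q} → Distinct q → Distinct (mapTree f q)
  distinct-map inj leaf = leaf
  distinct-map inj {graft a b} (graft da db dis) = graft (distinct-map inj da) (distinct-map inj db) disjoint
    where
    disjoint : ∀ {x} → x ∈ mapTree f a → x ∈ mapTree f b → ⊥
    disjoint i j with ∈-map⁻ a i | ∈-map⁻ b j
    ... | u , refl , i' | v , e , j' = dis i' (subst (_∈ b) (inj (sym e)) j')

  distinct-map⁻ : ∀ {q} → Distinct (mapTree f q) → ∀ {x y} → x ∈ q → y ∈ q → f x ≡ f y → x ≡ y
  distinct-map⁻ _ (leaf refl) (leaf refl) _ = refl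
  distinct-map⁻ (graft da _ _) (left i) (left j) e = distinct-map⁻ da i j e
  distinct-map⁻ {graft a b} (graft _ _ dis) (left i) (right j) e = ⊥-elim (dis (∈-map i) (subst (_∈ mapTree f b) (sym e) (∈-map j)))
  distinct-map⁻ {graft a b} (graft _ _ dis) (right i) (left j) e = ⊥-elim (dis (∈-map j) (subst (_∈ mapTree f b) e (∈-map i)))
  distinct-map⁻ (graft _ db _) (right i) (right j) e = distinct-map⁻ db i j e

∈⇒labels : ∀ {A : Set} {q : Tree A} {x} → x ∈ q → x ListMem.∈ labels q
∈⇒labels (leaf e) = here e
∈⇒labels (left i) = ListMemP.∈-++⁺ˡ (∈⇒labels i)
∈⇒labels {q = graft a b} (right i) = ListMemP.∈-++⁺ʳ (labels a) (∈⇒labels i)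

labels⇒∈ : ∀ {A : Set} (q : Tree A) {x} → x ListMem.∈ labels q → x ∈ q
labels⇒∈ (leaf y) (here e) = leaf e
labels⇒∈ (graft a b) i with ListMemP.∈-++⁻ (labels a) i
... | inj₁ j = left (labels⇒∈ a j)
... | inj₂ j = right (labels⇒∈ b j)

unique-labels : ∀ {A : Set} {q : Tree A} → Distinct q → Unique (labels q)
unique-labels leaf = [] ∷ []
unique-labels {q = graft a b} (graft da db dis) =
  UniqueP.++⁺ (unique-labels da) (unique-labels db) (λ (i , j) → dis (labels⇒∈ a i) (labels⇒∈ b j))

labels↭allFin : ∀ {n} {q : Tree (Fin n)} → Distinct q → (∀ x → x ∈ q) → labels q ↭ allFin n
labels↭allFin {n} d t = ∼bag⇒↭ (unique∧set⇒bag (unique-labels d) (UniqueP.allFin⁺ n)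
  (λ {x} → mk⇔ (λ _ → ListMemP.∈-allFin x) (λ _ → ∈⇒labels (t x))))

≡ᵇ-true : ∀ m n → (m ℕ.≡ᵇ n) ≡ true → m ≡ n
≡ᵇ-true m n e = ℕP.≡ᵇ⇒≡ m n (subst Data.Bool.T (sym e) tt)

≡ᵇ-refl : ∀ n → (n ℕ.≡ᵇ n) ≡ true
≡ᵇ-refl zero = refl
≡ᵇ-refl (suc n) = ≡ᵇ-refl n

-- Representing recursive trees

-- Only undirected adjacency is recorded, as in `_≅_` and `blackNbrs`; together with the root it
-- determines the orientation.
record Represents {n} (T : RTree n) (q : Tree (Fin (suc n))) : Set where
  field
    root≡0   : root q ≡ Fin.zero
    distinct : Distinct q
    total    : ∀ x → x ∈ q
    adj⇒     : ∀ {u v} → adj T u v ≡ true → Adj q u v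
    adj⇐     : ∀ {u v} → Adj q u v → adj T u v ≡ true

module _ {n} {T : RTree n} {q : Tree (Fin (suc n))}
         (edge⇒ : ∀ {u v} → Edge q u v → isParent T v u ≡ true)
         (edge⇐ : ∀ {u v} → isParent T v u ≡ true → Edge q u v) where
  directed-adj⇒ : ∀ {u v} → adj T u v ≡ true → Adj q u v
  directed-adj⇒ {u} {v} e with isParent T u v in p
  ... | true = inj₂ (edge⇐ p)
  ... | false = inj₁ (edge⇐ e)

  directed-adj⇐ : ∀ {u v} → Adj q u v → adj T u v ≡ true
  directed-adj⇐ {u} {v} (inj₁ e) = trans (cong (isParent T u v ∨_) (edge⇒ e)) (BoolP.∨-zeroʳ _)
  directed-adj⇐ {u} {v} (inj₂ e) = cong (_∨ isParent T v u) (edge⇒ e)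

module _ {A : Set} (_≟_ : DecidableEquality A) (p x : A) where
  -- The root of a grafted tree is its last leaf, so the subtree hanging at p ends in the leaf p.
  -- Grafting x onto that leaf makes x a child of p and keeps all other edges.
  addChild : Tree A → Tree A
  addChild (leaf y) with y ≟ p
  ... | yes _ = graft (leaf x) (leaf y)
  ... | no _ = leaf y
  addChild (graft a b) = graft (addChild a) (addChild b)

  root-addChild : ∀ q → root (addChild q) ≡ root q
  root-addChild (leaf y) with y ≟ p
  ... | yes _ = refl
  ... | no _ = refl
  root-addChild (graft a b) = root-addChild b

  ∈-addChild⁻ : ∀ q {z} → z ∈ addChild q → z ∈ q ⊎ (z ≡ x × p ∈ q)
  ∈-addChild⁻ (leaf y) i with y ≟ p
  ∈-addChild⁻ (leaf y) (left (leaf e)) | yes y≡p = inj₂ (e , leaf (sym y≡p))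
  ∈-addChild⁻ (leaf y) (right i) | yes _ = inj₁ i
  ∈-addChild⁻ (leaf y) i | no _ = inj₁ i
  ∈-addChild⁻ (graft a b) (left i) with ∈-addChild⁻ a i
  ... | inj₁ j = inj₁ (left j)
  ... | inj₂ (e , j) = inj₂ (e , left j)
  ∈-addChild⁻ (graft a b) (right i) with ∈-addChild⁻ b i
  ... | inj₁ j = inj₁ (right j)
  ... | inj₂ (e , j) = inj₂ (e , right j)

  ∈-addChild⁺ : ∀ {q z} → z ∈ q → z ∈ addChild q
  ∈-addChild⁺ {leaf y} i with y ≟ p
  ... | yes _ = right i
  ... | no _ = i
  ∈-addChild⁺ (left i) = left (∈-addChild⁺ i)
  ∈-addChild⁺ (right i) = right (∈-addChild⁺ i)

  edge-addChild⁺ : ∀ {q u v} → Edge q u v → Edge (addChild q) u v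
  edge-addChild⁺ {graft a b} (new e f) = new (trans e (sym (root-addChild a))) (trans f (sym (root-addChild b)))
  edge-addChild⁺ (left e) = left (edge-addChild⁺ e)
  edge-addChild⁺ (right e) = right (edge-addChild⁺ e)

  edge-addChild-new : ∀ {q} → p ∈ q → Edge (addChild q) x p
  edge-addChild-new {leaf y} (leaf p≡y) with y ≟ p
  ... | yes _ = new refl p≡y
  ... | no ne = ⊥-elim (ne (sym p≡y))
  edge-addChild-new (left i) = left (edge-addChild-new i)
  edge-addChild-new (right i) = right (edge-addChild-new i)

  edge-addChild⁻ : ∀ q {u v} → Edge (addChild q) u v → Edge q u v ⊎ (u ≡ x × v ≡ p)
  edge-addChild⁻ (leaf y) e with y ≟ p
  edge-addChild⁻ (leaf y) (new e f) | yes y≡p = inj₂ (e , trans f y≡p)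
  edge-addChild⁻ (graft a b) (new e f) = inj₁ (new (trans e (root-addChild a)) (trans f (root-addChild b)))
  edge-addChild⁻ (graft a b) (left e) with edge-addChild⁻ a e
  ... | inj₁ e' = inj₁ (left e')
  ... | inj₂ e' = inj₂ e'
  edge-addChild⁻ (graft a b) (right e) with edge-addChild⁻ b e
  ... | inj₁ e' = inj₁ (right e')
  ... | inj₂ e' = inj₂ e'

  distinct-addChild : ∀ {q} → Distinct q → ¬ (x ∈ q) → Distinct (addChild q)
  distinct-addChild {leaf y} d x∉ with y ≟ p
  ... | yes _ = graft leaf leaf (λ { (leaf refl) i → x∉ i })
  ... | no _ = leaf
  distinct-addChild {graft a b} (graft da db dis) x∉ =
    graft (distinct-addChild da (x∉ ∘ left)) (distinct-addChild db (x∉ ∘ right)) disjoint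
    where
    disjoint : ∀ {z} → z ∈ addChild a → z ∈ addChild b → ⊥
    disjoint i j with ∈-addChild⁻ a i | ∈-addChild⁻ b j
    ... | inj₁ i' | inj₁ j' = dis i' j'
    ... | inj₁ i' | inj₂ (refl , _) = x∉ (left i')
    ... | inj₂ (refl , _) | inj₁ j' = x∉ (right j')
    ... | inj₂ (_ , i') | inj₂ (_ , j') = dis i' j'

module _ {n} (T : RTree n) where
  private
    parent : Fin n → Fin (suc n)
    parent i = Fin.inject≤ (T i) (s≤s (ℕP.<⇒≤ (FinP.toℕ<n i)))

    toℕ-parent : ∀ i → toℕ (parent i) ≡ toℕ (T i)
    toℕ-parent i = FinP.toℕ-inject≤ (T i) _

    parent-≤ : ∀ i → toℕ (parent i) ≤ toℕ i
    parent-≤ i = subst (_≤ toℕ i) (sym (toℕ-parent i)) (FinP.toℕ≤pred[n] (T i))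

    isParent-parent : ∀ i → isParent T (parent i) (Fin.suc i) ≡ true
    isParent-parent i = trans (cong (toℕ (T i) ℕ.≡ᵇ_) (toℕ-parent i)) (≡ᵇ-refl (toℕ (T i)))

    isParent⇒ : ∀ {i v} → isParent T v (Fin.suc i) ≡ true → v ≡ parent i
    isParent⇒ {i} {v} e = FinP.toℕ-injective (trans (sym (≡ᵇ-true (toℕ (T i)) (toℕ v) e)) (sym (toℕ-parent i)))

    record Initial (k : ℕ) (q : Tree (Fin (suc n))) : Set where
      field
        root≡0   : root q ≡ Fin.zero
        distinct : Distinct q
        ∈⇒       : ∀ {x} → x ∈ q → toℕ x ≤ k
        ∈⇐       : ∀ {x} → toℕ x ≤ k → x ∈ q
        edge⇒    : ∀ {u v} → Edge q u v → isParent T v u ≡ true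
        edge⇐    : ∀ {u v} → toℕ u ≤ k → isParent T v u ≡ true → Edge q u v

    -- Vertices are added in the order of their numbers; the parent of `suc i` has number at most i
    -- and is therefore already present.
    initial : ∀ k → k ≤ n → ∃ (Initial k)
    initial zero _ = leaf Fin.zero , record
      { root≡0 = refl ; distinct = leaf ; ∈⇒ = λ { (leaf refl) → z≤n } ; ∈⇐ = λ { {Fin.zero} _ → leaf refl }
      ; edge⇒ = λ () ; edge⇐ = λ { {Fin.zero} _ () } }
    initial (suc k) k<n with initial k (ℕP.<⇒≤ k<n)
    ... | q , I = addChild Fin._≟_ p x q , record
      { root≡0 = trans (root-addChild Fin._≟_ p x q) (Initial.root≡0 I)
      ; distinct = distinct-addChild Fin._≟_ p x (Initial.distinct I)
          (λ x∈ → ℕP.<-irrefl refl (subst (_≤ k) toℕx (Initial.∈⇒ I x∈)))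
      ; ∈⇒ = ∈⇒ ; ∈⇐ = ∈⇐ ; edge⇒ = edge⇒ ; edge⇐ = edge⇐ }
      where
      i = Fin.fromℕ< k<n
      x = Fin.suc i
      p = parent i
      toℕx : toℕ x ≡ suc k
      toℕx = cong suc (FinP.toℕ-fromℕ< k<n)
      p∈q : p ∈ q
      p∈q = Initial.∈⇐ I (subst (toℕ p ≤_) (FinP.toℕ-fromℕ< k<n) (parent-≤ i))
      old-or-x : ∀ {z} → toℕ z ≤ suc k → toℕ z ≤ k ⊎ z ≡ x
      old-or-x l with ℕP.m≤n⇒m<n∨m≡n l
      ... | inj₁ (s≤s l') = inj₁ l'
      ... | inj₂ e = inj₂ (FinP.toℕ-injective (trans e (sym toℕx)))
      ∈⇒ : ∀ {z} → z ∈ addChild Fin._≟_ p x q → toℕ z ≤ suc k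
      ∈⇒ z∈ with ∈-addChild⁻ Fin._≟_ p x q z∈
      ... | inj₁ j = ℕP.m≤n⇒m≤1+n (Initial.∈⇒ I j)
      ... | inj₂ (refl , _) = ℕP.≤-reflexive toℕx
      ∈⇐ : ∀ {z} → toℕ z ≤ suc k → z ∈ addChild Fin._≟_ p x q
      ∈⇐ l with old-or-x l
      ... | inj₁ l' = ∈-addChild⁺ Fin._≟_ p x (Initial.∈⇐ I l')
      ... | inj₂ refl = edge-∈ˡ (edge-addChild-new Fin._≟_ p x p∈q)
      edge⇒ : ∀ {u v} → Edge (addChild Fin._≟_ p x q) u v → isParent T v u ≡ true
      edge⇒ e with edge-addChild⁻ Fin._≟_ p x q e
      ... | inj₁ e' = Initial.edge⇒ I e'
      ... | inj₂ (refl , refl) = isParent-parent i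
      edge⇐ : ∀ {u v} → toℕ u ≤ suc k → isParent T v u ≡ true → Edge (addChild Fin._≟_ p x q) u v
      edge⇐ l e with old-or-x l
      ... | inj₁ l' = edge-addChild⁺ Fin._≟_ p x (Initial.edge⇐ I l' e)
      ... | inj₂ refl with isParent⇒ e
      ... | refl = edge-addChild-new Fin._≟_ p x p∈q

  representation : ∃ (Represents T)
  representation with initial n ℕP.≤-refl
  ... | q , I = q , record
    { root≡0 = Initial.root≡0 I ; distinct = Initial.distinct I
    ; total = λ x → Initial.∈⇐ I (FinP.toℕ≤pred[n] x)
    ; adj⇒ = directed-adj⇒ {T = T} (Initial.edge⇒ I) (λ {u} → Initial.edge⇐ I (FinP.toℕ≤pred[n] u))
    ; adj⇐ = directed-adj⇐ {T = T} (Initial.edge⇒ I) (λ {u} → Initial.edge⇐ I (FinP.toℕ≤pred[n] u)) }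

root-or-child : ∀ {A : Set} {q : Tree A} {x} → x ∈ q → x ≡ root q ⊎ ∃ (Edge q x)
root-or-child (leaf e) = inj₁ e
root-or-child (left i) with root-or-child i
... | inj₁ e = inj₂ (_ , new e refl)
... | inj₂ (y , e) = inj₂ (y , left e)
root-or-child (right i) with root-or-child i
... | inj₁ e = inj₁ e
... | inj₂ (y , e) = inj₂ (y , right e)

parent-unique : ∀ {A : Set} {q : Tree A} {x y z} → Distinct q → Edge q x y → Edge q x z → y ≡ z
parent-unique _ (new _ refl) (new _ refl) = refl
parent-unique (graft da _ _) (new p _) (left e) = ⊥-elim (child≢root da e p)
parent-unique {q = graft a b} (graft _ _ dis) (new refl _) (right e) = ⊥-elim (dis (root∈ a) (edge-∈ˡ e))
parent-unique (graft da _ _) (left e) (new p _) = ⊥-elim (child≢root da e p)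
parent-unique (graft da _ _) (left e) (left f) = parent-unique da e f
parent-unique (graft _ _ dis) (left e) (right f) = ⊥-elim (dis (edge-∈ˡ e) (edge-∈ˡ f))
parent-unique {q = graft a b} (graft _ _ dis) (right e) (new refl _) = ⊥-elim (dis (root∈ a) (edge-∈ˡ e))
parent-unique (graft _ _ dis) (right e) (left f) = ⊥-elim (dis (edge-∈ˡ f) (edge-∈ˡ e))
parent-unique (graft _ db _) (right e) (right f) = parent-unique db e f

-- b is numbered before a, so that labels increase away from the root.
numbering : (p : Shape) → Tree (Fin (suc (edges p)))
numbering (leaf _) = leaf Fin.zero
numbering (graft a b) =
  graft (mapTree (suc (edges b) Fin.↑ʳ_) (numbering a)) (mapTree (Fin._↑ˡ suc (edges a)) (numbering b))

shape-numbering : ∀ p → shape (numbering p) ≡ p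
shape-numbering (leaf tt) = refl
shape-numbering (graft a b) = cong₂ graft (trans (mapTree-∘ _ _ (numbering a)) (shape-numbering a))
                                          (trans (mapTree-∘ _ _ (numbering b)) (shape-numbering b))

root-numbering : ∀ p → root (numbering p) ≡ Fin.zero
root-numbering (leaf _) = refl
root-numbering (graft a b) = trans (root-mapTree _ (numbering b)) (cong (Fin._↑ˡ suc (edges a)) (root-numbering b))

distinct-numbering : ∀ p → Distinct (numbering p)
distinct-numbering (leaf _) = leaf
distinct-numbering (graft a b) = graft
  (distinct-map _ (FinP.↑ʳ-injective (suc (edges b)) _ _) (distinct-numbering a))
  (distinct-map _ (FinP.↑ˡ-injective (suc (edges a)) _ _) (distinct-numbering b))
  disjoint
  where
  disjoint : ∀ {x} → x ∈ mapTree (suc (edges b) Fin.↑ʳ_) (numbering a) → x ∈ mapTree (Fin._↑ˡ suc (edges a)) (numbering b) → ⊥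
  disjoint i j with ∈-map⁻ _ (numbering a) i | ∈-map⁻ _ (numbering b) j
  ... | u , refl , _ | v , e , _ = ℕP.<⇒≢ below (sym (trans (cong toℕ e) (FinP.toℕ-↑ˡ v (suc (edges a)))))
    where
    below : toℕ v ℕ.< toℕ (suc (edges b) Fin.↑ʳ u)
    below = subst (toℕ v ℕ.<_) (sym (FinP.toℕ-↑ʳ (suc (edges b)) u)) (ℕP.<-≤-trans (FinP.toℕ<n v) (ℕP.m≤m+n _ (toℕ u)))

total-numbering : ∀ p x → x ∈ numbering p
total-numbering (leaf _) Fin.zero = leaf refl
total-numbering (graft a b) x with Fin.splitAt (suc (edges b)) {suc (edges a)} x in e
... | inj₁ u = right (subst (_∈ mapTree (Fin._↑ˡ suc (edges a)) (numbering b)) (FinP.splitAt⁻¹-↑ˡ e) (∈-map _ (total-numbering b u)))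
... | inj₂ v = left (subst (_∈ mapTree (suc (edges b) Fin.↑ʳ_) (numbering a)) (FinP.splitAt⁻¹-↑ʳ e) (∈-map _ (total-numbering a v)))

increasing-numbering : ∀ p {u v} → Edge (numbering p) u v → toℕ v ℕ.< toℕ u
increasing-numbering (graft a b) {u} {v} (new p refl) = subst (ℕ._< toℕ u) (sym v≡0) (subst (λ w → 0 ℕ.< toℕ w) (sym p') positive)
  where
  v≡0 : toℕ (root (mapTree (Fin._↑ˡ suc (edges a)) (numbering b))) ≡ 0
  v≡0 = cong toℕ (trans (root-mapTree _ (numbering b)) (cong (Fin._↑ˡ suc (edges a)) (root-numbering b)))
  p' = trans p (root-mapTree _ (numbering a))
  positive : 0 ℕ.< toℕ (suc (edges b) Fin.↑ʳ root (numbering a))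
  positive = s≤s z≤n
increasing-numbering (graft a b) (left e) with edge-map⁻ _ (numbering a) e
... | u , v , refl , refl , e' = ℕP.≤-trans (s≤s (ℕP.≤-reflexive (FinP.toℕ-↑ʳ (suc (edges b)) v)))
  (ℕP.≤-trans (ℕP.+-monoʳ-< (suc (edges b)) (increasing-numbering a e')) (ℕP.≤-reflexive (sym (FinP.toℕ-↑ʳ (suc (edges b)) u))))
increasing-numbering (graft a b) (right e) with edge-map⁻ _ (numbering b) e
... | u , v , refl , refl , e' = subst (λ m → m ℕ.< _) (sym (FinP.toℕ-↑ˡ v _))
  (subst (λ m → toℕ v ℕ.< m) (sym (FinP.toℕ-↑ˡ u _)) (increasing-numbering b e'))

module _ (p : Shape) where
  private
    parentOf : ∀ i → ∃ (Edge (numbering p) (Fin.suc i))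
    parentOf i with root-or-child (total-numbering p (Fin.suc i))
    ... | inj₂ e = e
    ... | inj₁ e with trans e (root-numbering p)
    ... | ()

  -- The numbering increases away from the root, which is exactly the bound that `RTree` puts on
  -- parents. Each shape thus has an `RTree` of its own, to which the covering property of a
  -- transversal can be applied.
  realization : RTree (edges p)
  realization i = Fin.fromℕ< (increasing-numbering p (proj₂ (parentOf i)))

  private
    toℕ-realization : ∀ i → toℕ (realization i) ≡ toℕ (proj₁ (parentOf i))
    toℕ-realization i = FinP.toℕ-fromℕ< _

    edge⇐ : ∀ {u v} → isParent realization v u ≡ true → Edge (numbering p) u v
    edge⇐ {Fin.suc i} {v} e = subst (Edge (numbering p) (Fin.suc i))
      (FinP.toℕ-injective (trans (sym (toℕ-realization i)) (≡ᵇ-true _ (toℕ v) e))) (proj₂ (parentOf i))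

    edge⇒ : ∀ {u v} → Edge (numbering p) u v → isParent realization v u ≡ true
    edge⇒ {Fin.zero} e = ⊥-elim (child≢root (distinct-numbering p) e (sym (root-numbering p)))
    edge⇒ {Fin.suc i} {v} e = trans (cong (ℕ._≡ᵇ toℕ v)
      (trans (toℕ-realization i) (cong toℕ (parent-unique (distinct-numbering p) (proj₂ (parentOf i)) e)))) (≡ᵇ-refl (toℕ v))

  represents-numbering : Represents realization (numbering p)
  represents-numbering = record
    { root≡0 = root-numbering p ; distinct = distinct-numbering p ; total = total-numbering p
    ; adj⇒ = directed-adj⇒ {T = realization} edge⇒ edge⇐ ; adj⇐ = directed-adj⇐ {T = realization} edge⇒ edge⇐ }

-- Automorphisms

allB-allFin⇒ : ∀ {n} {p : Fin n → Bool} → allB p (allFin n) ≡ true → ∀ x → p x ≡ true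
allB-allFin⇒ {n} {p} e x = go (allFin n) e (ListMemP.∈-allFin x)
  where
  go : ∀ xs → allB p xs ≡ true → x ListMem.∈ xs → p x ≡ true
  go (y ∷ ys) e i with p y in py
  go (y ∷ ys) e (here refl) | true = py
  go (y ∷ ys) e (there i) | true = go ys e i

allB-allFin⇐ : ∀ {n} {p : Fin n → Bool} → (∀ x → p x ≡ true) → allB p (allFin n) ≡ true
allB-allFin⇐ {n} {p} e = go (allFin n)
  where
  go : ∀ xs → allB p xs ≡ true
  go [] = refl
  go (x ∷ xs) = cong₂ _∧_ (e x) (go xs)

∧-true : ∀ a {b} → a ∧ b ≡ true → a ≡ true × b ≡ true
∧-true true e = refl , e

eqB-true : ∀ a b → eqB a b ≡ true → a ≡ b
eqB-true true true _ = refl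
eqB-true false false _ = refl

eqB-refl : ∀ a → eqB a a ≡ true
eqB-refl true = refl
eqB-refl false = refl

bool-ext : ∀ {a b : Bool} → (a ≡ true → b ≡ true) → (b ≡ true → a ≡ true) → a ≡ b
bool-ext {true} f g = sym (f refl)
bool-ext {false} {true} f g = g refl
bool-ext {false} {false} f g = refl

module _ {n} (T : RTree n) where
  record Automorphism (f : Fin (suc n) → Fin (suc n)) : Set where
    field
      fixes-root : f Fin.zero ≡ Fin.zero
      injective  : ∀ {u v} → f u ≡ f v → u ≡ v
      preserves  : ∀ u v → adj T u v ≡ adj T (f u) (f v)

  isAut⇒ : ∀ {f} → isAut T f ≡ true → Automorphism f
  isAut⇒ {f} e with ∧-true (eqFin (f Fin.zero) Fin.zero) e
  ... | r , s = record
    { fixes-root = FinP.toℕ-injective (≡ᵇ-true (toℕ (f Fin.zero)) 0 r)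
    ; injective = λ {u} {v} → inj u v
    ; preserves = λ u v → eqB-true _ _ (proj₂ (both u v)) }
    where
    both : ∀ u v → (eqFin u v ∨ not (eqFin (f u) (f v))) ≡ true × eqB (adj T u v) (adj T (f u) (f v)) ≡ true
    both u v = ∧-true _ (allB-allFin⇒ (allB-allFin⇒ s u) v)
    inj : ∀ u v → f u ≡ f v → u ≡ v
    inj u v fu≡fv with eqFin u v in uv | proj₁ (both u v)
    ... | true | _ = FinP.toℕ-injective (≡ᵇ-true (toℕ u) (toℕ v) uv)
    ... | false | q with trans (sym q) (cong not (trans (cong (λ w → eqFin (f u) w) (sym fu≡fv)) (≡ᵇ-refl (toℕ (f u)))))
    ... | ()

  isAut⇐ : ∀ {f} → Automorphism f → isAut T f ≡ true
  isAut⇐ {f} α = cong₂ _∧_ (trans (cong (λ w → eqFin w Fin.zero) fixes-root) refl)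
    (allB-allFin⇐ (λ u → allB-allFin⇐ (λ v → cong₂ _∧_ (inj u v)
      (trans (cong (eqB (adj T u v)) (sym (preserves u v))) (eqB-refl (adj T u v))))))
    where
    open Automorphism α
    inj : ∀ u v → (eqFin u v ∨ not (eqFin (f u) (f v))) ≡ true
    inj u v with eqFin (f u) (f v) in e
    ... | false = BoolP.∨-zeroʳ _
    ... | true with injective (FinP.toℕ-injective (≡ᵇ-true (toℕ (f u)) (toℕ (f v)) e))
    ... | refl = cong (_∨ false) (≡ᵇ-refl (toℕ u))

-- If y were missed, punching it out would embed `suc n` elements into n.
injective⇒surjective : ∀ {n} (f : Fin n → Fin n) → (∀ {x y} → f x ≡ f y → x ≡ y) → ∀ y → ∃ λ x → y ≡ f x
injective⇒surjective {suc n} f inj y with FinP.any? (λ x → y Fin.≟ f x)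
... | yes p = p
... | no ¬p = ⊥-elim (ℕP.<-irrefl refl (FinP.injective⇒≤ {f = λ x → Fin.punchOut (missed x)}
        (λ {u} {v} e → inj (FinP.punchOut-injective (missed u) (missed v) e))))
  where
  missed : ∀ x → ¬ (y ≡ f x)
  missed x e = ¬p (x , e)

module _ {n} {T : RTree n} {q q' : Tree (Fin (suc n))} (ρ : Represents T q) (ρ' : Represents T q') where
  open Represents

  automorphism⇒sameGraph : ∀ {f} → Automorphism T f → Distinct (mapTree f q) × SameGraph (mapTree f q) q'
  automorphism⇒sameGraph {f} α = distinct-map f injective (distinct ρ) , record
    { root≡ = trans (root-mapTree f q) (trans (cong f (root≡0 ρ)) (trans fixes-root (sym (root≡0 ρ'))))
    ; ∈⇒ = λ _ → total ρ' _
    ; ∈⇐ = λ {y} _ → let (x , e) = injective⇒surjective f injective y in subst (_∈ mapTree f q) (sym e) (∈-map f (total ρ x))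
    ; adj⇒ = to ; adj⇐ = from }
    where
    open Automorphism α
    to : ∀ {x y} → Adj (mapTree f q) x y → Adj q' x y
    to a with adj-map⁻ f q a
    ... | u , v , refl , refl , b = adj⇒ ρ' (trans (sym (preserves u v)) (adj⇐ ρ b))
    from : ∀ {x y} → Adj q' x y → Adj (mapTree f q) x y
    from {x} {y} a with injective⇒surjective f injective x | injective⇒surjective f injective y
    ... | u , refl | v , refl = adj-map f (adj⇒ ρ (trans (preserves u v) (adj⇐ ρ' a)))

module _ {n} {T T' : RTree n} {q q' : Tree (Fin (suc n))} (ρ : Represents T q) (ρ' : Represents T' q')
         {f : Fin (suc n) → Fin (suc n)} (c : Congruent (mapTree f q) q') where
  open Represents

  congruent-root : f Fin.zero ≡ Fin.zero
  congruent-root = trans (cong f (sym (root≡0 ρ))) (trans (sym (root-mapTree f q)) (trans (Congruent.root≡ c) (root≡0 ρ')))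

  -- A collision of f would repeat a label in `mapTree f q`, which inherits distinctness from q'.
  congruent-injective : ∀ {u v} → f u ≡ f v → u ≡ v
  congruent-injective {u} {v} = distinct-map⁻ f (Congruent.distinct c (distinct ρ')) (total ρ u) (total ρ v)

  congruent-adj : ∀ u v → adj T u v ≡ adj T' (f u) (f v)
  congruent-adj u v = bool-ext (λ e → adj⇐ ρ' (to (adj-map f (adj⇒ ρ e)))) (λ e → from (adj-map⁻ f q (from' (adj⇒ ρ' e))))
    where
    to : ∀ {x y} → Adj (mapTree f q) x y → Adj q' x y
    to (inj₁ e) = inj₁ (Congruent.edge⇒ c e)
    to (inj₂ e) = inj₂ (Congruent.edge⇒ c e)
    from' : ∀ {x y} → Adj q' x y → Adj (mapTree f q) x y
    from' (inj₁ e) = inj₁ (Congruent.edge⇐ c e)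
    from' (inj₂ e) = inj₂ (Congruent.edge⇐ c e)
    from : (∃ λ u' → ∃ λ v' → f u ≡ f u' × f v ≡ f v' × Adj q u' v') → adj T u v ≡ true
    from (u' , v' , e , e' , a) with congruent-injective e | congruent-injective e'
    ... | refl | refl = adj⇐ ρ a

  congruent⇒≅ : T ≅ T'
  congruent⇒≅ = mk↔ₛ′ f (λ y → proj₁ (surj y)) (λ y → sym (proj₂ (surj y)))
    (λ x → congruent-injective (sym (proj₂ (surj (f x))))) , congruent-root , congruent-adj
    where surj = injective⇒surjective f congruent-injective

≅⇒represents : ∀ {n} {T T' : RTree n} {q} (i : T ≅ T') → Represents T q → Represents T' (mapTree (Inverse.to (proj₁ i)) q)
≅⇒represents {n} {T} {T'} {q} (σ , fix , pres) ρ = record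
  { root≡0 = trans (root-mapTree f q) (trans (cong f (root≡0 ρ)) fix)
  ; distinct = distinct-map f (λ {x} {y} e → trans (sym (Inverse.strictlyInverseʳ σ x)) (trans (cong (Inverse.from σ) e) (Inverse.strictlyInverseʳ σ y))) (distinct ρ)
  ; total = λ y → subst (_∈ mapTree f q) (Inverse.strictlyInverseˡ σ y) (∈-map f (total ρ (Inverse.from σ y)))
  ; adj⇒ = to ; adj⇐ = from }
  where
  open Represents
  f = Inverse.to σ
  to : ∀ {x y} → adj T' x y ≡ true → Adj (mapTree f q) x y
  to {x} {y} e = ≡.subst₂ (Adj (mapTree f q)) (Inverse.strictlyInverseˡ σ x) (Inverse.strictlyInverseˡ σ y)
    (adj-map f (adj⇒ ρ (trans (pres _ _) (trans (cong₂ (adj T') (Inverse.strictlyInverseˡ σ x) (Inverse.strictlyInverseˡ σ y)) e))))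
  from : ∀ {x y} → Adj (mapTree f q) x y → adj T' x y ≡ true
  from a with adj-map⁻ f q a
  ... | u , v , refl , refl , b = trans (sym (pres u v)) (adj⇐ ρ b)

countB-∑ : ∀ {A : Set} (p : A → Bool) xs → countB p xs ≡ ℕΣ.∑ xs (λ x → if p x then 1 else 0)
countB-∑ p [] = refl
countB-∑ p (x ∷ xs) with p x
... | true = cong suc (countB-∑ p xs)
... | false = countB-∑ p xs

allFin-complete : ∀ {n} (y : Fin n) → ℕΣ.∑ (allFin n) (λ x → indicator (x Fin.≟ y)) ≡ 1
allFin-complete {n} y = ℕΣ.∑-select (All.universal (λ _ → tt) (allFin n)) (Any.map sym (ListMemP.∈-allFin y))
  (AllPairs.map (λ ne e → ne (trans (proj₁ e) (sym (proj₂ e)))) (UniqueP.allFin⁺ n)) (λ { x _ refl → on x }) off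
  where
  on : ∀ x → indicator (x Fin.≟ x) ≡ 1
  on x with x Fin.≟ x
  ... | yes _ = refl
  ... | no ne = ⊥-elim (ne refl)
  off : ∀ x → ¬ (x ≡ y) → indicator (x Fin.≟ y) ≡ 0
  off x ne with x Fin.≟ y
  ... | yes e = ⊥-elim (ne e)
  ... | no _ = refl

∑-isos : ∀ {n} {T T' : RTree n} {q q'} → Represents T q → Represents T' q' →
         ℕΣ.∑ (allFuns (suc n) (allFin (suc n))) (λ f → isos Fin._≟_ (mapTree f q) q') ≡ shapeIsos (shape q) (shape q')
∑-isos {n} {q = q} {q'} ρ ρ' = trans
  (Relabel.∑-relabel ℕP.+-*-commutativeSemiring (allFin (suc n)) q (labels↭allFin (Represents.distinct ρ) (Represents.total ρ)) (λ r → isos Fin._≟_ r q'))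
  (fill-isos Fin._≟_ (allFin (suc n)) allFin-complete (shape q) q')

autCount-shapeIsos : ∀ {n} {T : RTree n} {q q'} → Represents T q → Represents T q' →
                     autCount T ≡ shapeIsos (shape q) (shape q')
autCount-shapeIsos {n} {T} {q} {q'} ρ ρ' =
  trans (countB-∑ (isAut T) (allFuns (suc n) (allFin (suc n))))
  (trans (ℕΣ.∑-cong (allFuns (suc n) (allFin (suc n))) pointwise) (∑-isos ρ ρ'))
  where
  pointwise : ∀ f → (if isAut T f then 1 else 0) ≡ isos Fin._≟_ (mapTree f q) q'
  pointwise f with isAut T f in e
  ... | true with automorphism⇒sameGraph ρ ρ' (isAut⇒ T e)
  ... | d , s = sym (sameGraph⇒isos Fin._≟_ (mapTree f q) q' d (Represents.distinct ρ') s)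
  pointwise f | false with isos Fin._≟_ (mapTree f q) q' ℕ.≟ 0
  ... | yes z = sym z
  ... | no nz with trans (sym e) (isAut⇐ T (record
          { fixes-root = congruent-root ρ ρ' c ; injective = congruent-injective ρ ρ' c ; preserves = congruent-adj ρ ρ' c }))
    where c = isos⇒congruent Fin._≟_ (mapTree f q) q' nz
  ... | ()

-- The count is a sum over all vertex maps, so a nonzero count yields an actual map.
shapeIsos⇒≅ : ∀ {n} {T T' : RTree n} {q q'} → Represents T q → Represents T' q' →
              ¬ (shapeIsos (shape q) (shape q') ≡ 0) → T ≅ T'
shapeIsos⇒≅ {n} {q = q} {q'} ρ ρ' nz with Any.satisfied (∑≢0 (allFuns (suc n) (allFin (suc n)))
                   (λ f → isos Fin._≟_ (mapTree f q) q') (λ z → nz (trans (sym (∑-isos ρ ρ')) z)))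
... | f , ne = congruent⇒≅ ρ ρ' (isos⇒congruent Fin._≟_ (mapTree f q) q' ne)

-- Colorings

bit : Bool → ℕ
bit b = if b then 1 else 0

blackChildren : Tree Bool → ℕ
blackChildren (leaf _) = 0
blackChildren (graft a b) = bit (root a) ℕ.+ blackChildren b

-- The root is not counted, since its state changes when the tree is grafted.
evenWhites : Tree Bool → ℕ
evenWhites (leaf _) = 0
evenWhites (graft a b) =
  evenWhites a ℕ.+ evenWhites b ℕ.+ bit (not (root a) ∧ isEven (blackChildren a ℕ.+ bit (root b)))

indicator-yes : ∀ {P : Set} (d : Dec P) → P → indicator d ≡ 1
indicator-yes (yes _) p = refl
indicator-yes (no n) p = ⊥-elim (n p)

indicator-no : ∀ {P : Set} (d : Dec P) → ¬ P → indicator d ≡ 0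
indicator-no (yes p) n = ⊥-elim (n p)
indicator-no (no _) n = refl

module _ {n : ℕ} where
  private
    V = Fin n
    _≡?_ : V → V → ℕ
    x ≡? y = indicator (x Fin.≟ y)

  -- A count that is additive under grafting, so that the number of black neighbours, defined as a
  -- sum over all vertices, can be computed by recursion on the tree.
  adjacency : Tree V → V → V → ℕ
  adjacency (leaf _) v u = 0
  adjacency (graft a b) v u = (adjacency a v u ℕ.+ adjacency b v u) ℕ.+
    ((v ≡? root a) ℕ.* (u ≡? root b) ℕ.+ (v ≡? root b) ℕ.* (u ≡? root a))

  adjacency-0 : ∀ q {v u} → ¬ Adj q v u → adjacency q v u ≡ 0
  adjacency-0 (leaf _) _ = refl
  adjacency-0 (graft a b) {v} {u} na = cong₂ ℕ._+_
    (cong₂ ℕ._+_ (adjacency-0 a (na ∘ graft-adjˡ)) (adjacency-0 b (na ∘ graft-adjʳ)))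
    (cong₂ ℕ._+_ (product-0 (λ p r → na (inj₁ (new p r)))) (product-0 (λ p r → na (inj₂ (new r p)))))
    where
    product-0 : ∀ {x y} → (v ≡ x → u ≡ y → ⊥) → (v ≡? x) ℕ.* (u ≡? y) ≡ 0
    product-0 {x} {y} ne with v Fin.≟ x | u Fin.≟ y
    ... | yes p | yes r = ⊥-elim (ne p r)
    ... | yes _ | no _ = refl
    ... | no _ | _ = refl

  adjacency-1 : ∀ {q v u} → Distinct q → Adj q v u → adjacency q v u ≡ 1
  adjacency-1 {leaf _} leaf (inj₁ ())
  adjacency-1 {leaf _} leaf (inj₂ ())
  adjacency-1 {graft a b} {v} {u} (graft da db dis) e = case e
    where
    sum₄ : ∀ {w x y z w' x' y' z'} → w ≡ w' → x ≡ x' → y ≡ y' → z ≡ z' → (w ℕ.+ x) ℕ.+ (y ℕ.+ z) ≡ (w' ℕ.+ x') ℕ.+ (y' ℕ.+ z')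
    sum₄ refl refl refl refl = refl
    both : ∀ {x y} → v ≡ x → u ≡ y → (v ≡? x) ℕ.* (u ≡? y) ≡ 1
    both p r = cong₂ ℕ._*_ (indicator-yes (_ Fin.≟ _) p) (indicator-yes (_ Fin.≟ _) r)
    no₁ : ∀ {x y} → ¬ (v ≡ x) → (v ≡? x) ℕ.* (u ≡? y) ≡ 0
    no₁ {x} {y} n = cong (ℕ._* (u ≡? y)) (indicator-no (v Fin.≟ x) n)
    no₂ : ∀ {x y} → ¬ (u ≡ y) → (v ≡? x) ℕ.* (u ≡? y) ≡ 0
    no₂ {x} {y} n = trans (cong ((v ≡? x) ℕ.*_) (indicator-no (u Fin.≟ y) n)) (ℕP.*-zeroʳ (v ≡? x))
    ra≢rb : ¬ (root a ≡ root b)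
    ra≢rb p = dis (root∈ a) (subst (_∈ b) (sym p) (root∈ b))
    ∈a⇒≢rb : ∀ {x} → x ∈ a → ¬ (x ≡ root b)
    ∈a⇒≢rb i refl = dis i (root∈ b)
    ∈b⇒≢ra : ∀ {x} → x ∈ b → ¬ (x ≡ root a)
    ∈b⇒≢ra i refl = dis (root∈ a) i
    inside-a : Adj a v u → adjacency (graft a b) v u ≡ 1
    inside-a e = sum₄ (adjacency-1 da e) (adjacency-0 b (λ e' → dis (adj-∈ˡ e) (adj-∈ˡ e')))
      (no₂ (∈a⇒≢rb (adj-∈ʳ e))) (no₁ (∈a⇒≢rb (adj-∈ˡ e)))
    inside-b : Adj b v u → adjacency (graft a b) v u ≡ 1
    inside-b e = sum₄ (adjacency-0 a (λ e' → dis (adj-∈ˡ e') (adj-∈ˡ e))) (adjacency-1 db e)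
      (no₁ (∈b⇒≢ra (adj-∈ˡ e))) (no₂ (∈b⇒≢ra (adj-∈ʳ e)))
    case : Adj (graft a b) v u → adjacency (graft a b) v u ≡ 1
    case (inj₁ (left e)) = inside-a (inj₁ e)
    case (inj₂ (left e)) = inside-a (inj₂ e)
    case (inj₁ (right e)) = inside-b (inj₁ e)
    case (inj₂ (right e)) = inside-b (inj₂ e)
    case (inj₁ (new p r)) = sum₄
      (adjacency-0 a (λ e' → dis (adj-∈ʳ e') (subst (_∈ b) (sym r) (root∈ b))))
      (adjacency-0 b (λ e' → dis (subst (_∈ a) (sym p) (root∈ a)) (adj-∈ˡ e')))
      (both p r) (no₁ (λ p' → ra≢rb (trans (sym p) p')))
    case (inj₂ (new p r)) = sum₄
      (adjacency-0 a (λ e' → dis (adj-∈ˡ e') (subst (_∈ b) (sym r) (root∈ b))))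
      (adjacency-0 b (λ e' → dis (subst (_∈ a) (sym p) (root∈ a)) (adj-∈ʳ e')))
      (no₁ (λ r' → ra≢rb (trans (sym r') r))) (both r p)

  module _ (c : V → Bool) where
    blacks : Tree V → V → ℕ
    blacks (leaf _) v = 0
    blacks (graft a b) v = (blacks a v ℕ.+ blacks b v) ℕ.+
      ((v ≡? root a) ℕ.* bit (c (root b)) ℕ.+ (v ≡? root b) ℕ.* bit (c (root a)))

    ∑-at : ∀ x → ℕΣ.∑ (allFin n) (λ u → (u ≡? x) ℕ.* bit (c u)) ≡ bit (c x)
    ∑-at x = ℕΣ.∑-select (All.universal (λ _ → tt) (allFin n)) (Any.map sym (ListMemP.∈-allFin x))
      (AllPairs.map (λ ne e → ne (trans (proj₁ e) (sym (proj₂ e)))) (UniqueP.allFin⁺ n))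
      (λ { u _ refl → trans (cong (ℕ._* bit (c u)) (indicator-yes (u Fin.≟ u) refl)) (ℕP.*-identityˡ _) })
      (λ u ne → cong (ℕ._* bit (c u)) (indicator-no (u Fin.≟ x) ne))

    ∑-adjacency : ∀ q v → ℕΣ.∑ (allFin n) (λ u → adjacency q v u ℕ.* bit (c u)) ≡ blacks q v
    ∑-adjacency (leaf _) v = ℕΣ.∑-zero (allFin n) (λ _ → refl)
    ∑-adjacency (graft a b) v = begin
      ∑ᵤ (λ u → adjacency (graft a b) v u ℕ.* bit (c u))
        ≡⟨ ℕΣ.∑-cong (allFin n) (λ u → expand (adjacency a v u) (adjacency b v u) (v ≡? root a) (u ≡? root b) (v ≡? root b) (u ≡? root a) (bit (c u))) ⟩
      ∑ᵤ (λ u → (A₁ u ℕ.+ A₂ u) ℕ.+ (B₁ u ℕ.+ B₂ u))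
        ≡⟨ trans (ℕΣ.∑-+ (allFin n) (λ u → A₁ u ℕ.+ A₂ u) (λ u → B₁ u ℕ.+ B₂ u)) (cong₂ ℕ._+_ (ℕΣ.∑-+ (allFin n) A₁ A₂) (ℕΣ.∑-+ (allFin n) B₁ B₂)) ⟩
      (∑ᵤ A₁ ℕ.+ ∑ᵤ A₂) ℕ.+ (∑ᵤ B₁ ℕ.+ ∑ᵤ B₂)
        ≡⟨ cong₂ ℕ._+_ (cong₂ ℕ._+_ (∑-adjacency a v) (∑-adjacency b v)) (cong₂ ℕ._+_ (pull (root a) (root b)) (pull (root b) (root a))) ⟩
      blacks (graft a b) v ∎
      where
      open ≡.≡-Reasoning
      ∑ᵤ = ℕΣ.∑ (allFin n)
      A₁ A₂ B₁ B₂ : V → ℕ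
      A₁ u = adjacency a v u ℕ.* bit (c u)
      A₂ u = adjacency b v u ℕ.* bit (c u)
      B₁ u = (v ≡? root a) ℕ.* ((u ≡? root b) ℕ.* bit (c u))
      B₂ u = (v ≡? root b) ℕ.* ((u ≡? root a) ℕ.* bit (c u))
      open NatSolver ℕP.+-*-commutativeSemiring using (solve; _:=_; _:+_; _:*_)
      expand : ∀ k l p r p' r' m → ((k ℕ.+ l) ℕ.+ (p ℕ.* r ℕ.+ p' ℕ.* r')) ℕ.* m ≡
               (k ℕ.* m ℕ.+ l ℕ.* m) ℕ.+ (p ℕ.* (r ℕ.* m) ℕ.+ p' ℕ.* (r' ℕ.* m))
      expand = solve 7 (λ k l p r p' r' m → ((k :+ l) :+ (p :* r :+ p' :* r')) :* m :=
               (k :* m :+ l :* m) :+ (p :* (r :* m) :+ p' :* (r' :* m))) refl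
      pull : ∀ x y → ∑ᵤ (λ u → (v ≡? x) ℕ.* ((u ≡? y) ℕ.* bit (c u))) ≡ (v ≡? x) ℕ.* bit (c y)
      pull x y = trans (ℕΣ.∑-*ˡ (allFin n) (v ≡? x) _) (cong ((v ≡? x) ℕ.*_) (∑-at y))

    blacks-∉ : ∀ q {v} → ¬ (v ∈ q) → blacks q v ≡ 0
    blacks-∉ (leaf _) _ = refl
    blacks-∉ (graft a b) {v} v∉ = cong₂ ℕ._+_
      (cong₂ ℕ._+_ (blacks-∉ a (v∉ ∘ left)) (blacks-∉ b (v∉ ∘ right)))
      (cong₂ ℕ._+_ (cong (ℕ._* bit (c (root b))) (indicator-no (v Fin.≟ root a) (λ { refl → v∉ (left (root∈ a)) })))
                   (cong (ℕ._* bit (c (root a))) (indicator-no (v Fin.≟ root b) (λ { refl → v∉ (right (root∈ b)) }))))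

    blacks-left : ∀ {a b v} → Distinct (graft a b) → v ∈ a →
                  blacks (graft a b) v ≡ blacks a v ℕ.+ (v ≡? root a) ℕ.* bit (c (root b))
    blacks-left {a} {b} {v} (graft _ _ dis) i = cong₂ ℕ._+_
      (trans (cong (blacks a v ℕ.+_) (blacks-∉ b (dis i))) (ℕP.+-identityʳ _))
      (trans (cong ((v ≡? root a) ℕ.* bit (c (root b)) ℕ.+_)
        (cong (ℕ._* bit (c (root a))) (indicator-no (v Fin.≟ root b) (λ { refl → dis i (root∈ b) })))) (ℕP.+-identityʳ _))

    blacks-right : ∀ {a b v} → Distinct (graft a b) → v ∈ b →
                   blacks (graft a b) v ≡ blacks b v ℕ.+ (v ≡? root b) ℕ.* bit (c (root a))
    blacks-right {a} {b} {v} (graft _ _ dis) i = cong₂ ℕ._+_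
      (cong (ℕ._+ blacks b v) (blacks-∉ a (λ j → dis j i)))
      (cong (ℕ._+ (v ≡? root b) ℕ.* bit (c (root a)))
        (cong (ℕ._* bit (c (root b))) (indicator-no (v Fin.≟ root a) (λ { refl → dis (root∈ a) i }))))

    blacks-root : ∀ {q} → Distinct q → blacks q (root q) ≡ blackChildren (mapTree c q)
    blacks-root leaf = refl
    blacks-root {graft a b} d@(graft _ db _) = trans (blacks-right d (root∈ b))
      (trans (cong₂ ℕ._+_ (blacks-root db)
                (trans (cong (ℕ._* bit (c (root a))) (indicator-yes (root b Fin.≟ root b) refl)) (ℕP.*-identityˡ _)))
      (trans (ℕP.+-comm (blackChildren (mapTree c b)) _)
             (cong (λ w → bit w ℕ.+ blackChildren (mapTree c b)) (sym (root-mapTree c a)))))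

    -- e counts further black neighbours of the root, outside the tree
    ∑-evenWhite : ∀ {q} → Distinct q → ∀ e →
      ℕΣ.∑ (labels q) (λ v → bit (not (c v) ∧ isEven (blacks q v ℕ.+ (v ≡? root q) ℕ.* e))) ≡
      evenWhites (mapTree c q) ℕ.+ bit (not (c (root q)) ∧ isEven (blackChildren (mapTree c q) ℕ.+ e))
    ∑-evenWhite {leaf x} leaf e = trans (ℕP.+-identityʳ _)
      (cong (λ w → bit (not (c x) ∧ isEven w)) (trans (cong (ℕ._* e) (indicator-yes (x Fin.≟ x) refl)) (ℕP.*-identityˡ e)))
    ∑-evenWhite {graft a b} d@(graft da db dis) e = begin
      ℕΣ.∑ (labels a ++ labels b) (λ v → even v (blacks (graft a b) v ℕ.+ (v ≡? root b) ℕ.* e))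
        ≡⟨ ℕΣ.∑-++ (labels a) (labels b) _ ⟩
      ℕΣ.∑ (labels a) (λ v → even v (blacks (graft a b) v ℕ.+ (v ≡? root b) ℕ.* e)) ℕ.+
      ℕΣ.∑ (labels b) (λ v → even v (blacks (graft a b) v ℕ.+ (v ≡? root b) ℕ.* e))
        -- Seen from a, the only neighbour outside is the root of b, attached to the root of a; seen
        -- from b, the root of a adds to the e neighbours already counted.
        ≡⟨ cong₂ ℕ._+_ (ℕΣ.∑-cong-All (All.tabulate (λ i → in-a (labels⇒∈ a i)))) (ℕΣ.∑-cong-All (All.tabulate (λ i → in-b (labels⇒∈ b i)))) ⟩
      ℕΣ.∑ (labels a) (λ v → even v (blacks a v ℕ.+ (v ≡? root a) ℕ.* bit (c (root b)))) ℕ.+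
      ℕΣ.∑ (labels b) (λ v → even v (blacks b v ℕ.+ (v ≡? root b) ℕ.* (bit (c (root a)) ℕ.+ e)))
        ≡⟨ cong₂ ℕ._+_ (∑-evenWhite da (bit (c (root b)))) (∑-evenWhite db (bit (c (root a)) ℕ.+ e)) ⟩
      (evenWhites a' ℕ.+ even (root a) (blackChildren a' ℕ.+ bit (c (root b)))) ℕ.+
      (evenWhites b' ℕ.+ even (root b) (blackChildren b' ℕ.+ (bit (c (root a)) ℕ.+ e)))
        ≡⟨ shuffle (evenWhites a') _ (evenWhites b') _ ⟩
      (evenWhites a' ℕ.+ evenWhites b' ℕ.+ even (root a) (blackChildren a' ℕ.+ bit (c (root b)))) ℕ.+
      even (root b) (blackChildren b' ℕ.+ (bit (c (root a)) ℕ.+ e))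
        ≡⟨ cong₂ ℕ._+_ (cong (evenWhites a' ℕ.+ evenWhites b' ℕ.+_)
             (cong₂ (λ x y → bit (not x ∧ isEven (blackChildren a' ℕ.+ bit y))) (sym (root-mapTree c a)) (sym (root-mapTree c b))))
             (cong (even (root b)) (trans (sym (ℕP.+-assoc (blackChildren b') _ e))
               (cong (ℕ._+ e) (trans (ℕP.+-comm (blackChildren b') _) (cong (λ w → bit w ℕ.+ blackChildren b') (sym (root-mapTree c a))))))) ⟩
      evenWhites (mapTree c (graft a b)) ℕ.+ even (root b) (blackChildren (mapTree c (graft a b)) ℕ.+ e) ∎
      where
      open ≡.≡-Reasoning
      open NatSolver ℕP.+-*-commutativeSemiring using (solve; _:=_; _:+_)
      a' = mapTree c a
      b' = mapTree c b
      even : V → ℕ → ℕ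
      even v m = bit (not (c v) ∧ isEven m)
      shuffle : ∀ w x y z → (w ℕ.+ x) ℕ.+ (y ℕ.+ z) ≡ (w ℕ.+ y ℕ.+ x) ℕ.+ z
      shuffle = solve 4 (λ w x y z → (w :+ x) :+ (y :+ z) := (w :+ y :+ x) :+ z) refl
      in-a : ∀ {v} → v ∈ a → even v (blacks (graft a b) v ℕ.+ (v ≡? root b) ℕ.* e) ≡
                             even v (blacks a v ℕ.+ (v ≡? root a) ℕ.* bit (c (root b)))
      in-a {v} i = cong (even v) (trans (cong₂ ℕ._+_ (blacks-left d i)
        (cong (ℕ._* e) (indicator-no (v Fin.≟ root b) (λ { refl → dis i (root∈ b) })))) (ℕP.+-identityʳ _))
      in-b : ∀ {v} → v ∈ b → even v (blacks (graft a b) v ℕ.+ (v ≡? root b) ℕ.* e) ≡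
                             even v (blacks b v ℕ.+ (v ≡? root b) ℕ.* (bit (c (root a)) ℕ.+ e))
      in-b {v} i = cong (even v) (trans (cong (ℕ._+ (v ≡? root b) ℕ.* e) (blacks-right d i))
        (trans (ℕP.+-assoc (blacks b v) _ _) (cong (blacks b v ℕ.+_) (sym (ℕP.*-distribˡ-+ (v ≡? root b) _ e)))))

module _ {n} {T : RTree n} {q} (ρ : Represents T q) (c : Coloring n) where
  open Represents ρ

  blackNbrs-blacks : ∀ v → blackNbrs T c v ≡ blacks c q v
  blackNbrs-blacks v = trans (countB-∑ (λ u → adj T v u ∧ c u) (allFin (suc n)))
    (trans (ℕΣ.∑-cong (allFin (suc n)) pointwise) (∑-adjacency c q v))
    where
    pointwise : ∀ u → bit (adj T v u ∧ c u) ≡ adjacency q v u ℕ.* bit (c u)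
    pointwise u with adj T v u in e
    ... | true = sym (trans (cong (ℕ._* bit (c u)) (adjacency-1 distinct (adj⇒ e))) (ℕP.*-identityˡ _))
    ... | false = sym (cong (ℕ._* bit (c u)) (adjacency-0 q (λ a → absurd (trans (sym e) (adj⇐ a)))))
      where
      absurd : ¬ (false ≡ true)
      absurd ()

  blackNbrs-root : blackNbrs T c Fin.zero ≡ blackChildren (mapTree c q)
  blackNbrs-root = trans (blackNbrs-blacks Fin.zero) (trans (cong (blacks c q) (sym root≡0)) (blacks-root c distinct))

  root-colour : root (mapTree c q) ≡ c Fin.zero
  root-colour = trans (root-mapTree c q) (cong c root≡0)

  numEvenWhite-tree : numEvenWhite T c ≡
    evenWhites (mapTree c q) ℕ.+ bit (not (root (mapTree c q)) ∧ isEven (blackChildren (mapTree c q)))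
  numEvenWhite-tree = begin
    countB (evenWhite T c) (allFin (suc n))
      ≡⟨ countB-∑ (evenWhite T c) (allFin (suc n)) ⟩
    ℕΣ.∑ (allFin (suc n)) (λ v → bit (evenWhite T c v))
      ≡⟨ ℕΣ.∑-↭ (labels↭allFin distinct total) (λ v → bit (evenWhite T c v)) ⟨
    ℕΣ.∑ (labels q) (λ v → bit (evenWhite T c v))
      ≡⟨ ℕΣ.∑-cong (labels q) (λ v → cong (λ w → bit (not (c v) ∧ isEven w))
           (trans (blackNbrs-blacks v) (trans (sym (ℕP.+-identityʳ _)) (cong (blacks c q v ℕ.+_) (sym (ℕP.*-zeroʳ (indicator (v Fin.≟ root q)))))))) ⟩
    ℕΣ.∑ (labels q) (λ v → bit (not (c v) ∧ isEven (blacks c q v ℕ.+ indicator (v Fin.≟ root q) ℕ.* 0)))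
      ≡⟨ ∑-evenWhite c distinct 0 ⟩
    evenWhites (mapTree c q) ℕ.+ bit (not (c (root q)) ∧ isEven (blackChildren (mapTree c q) ℕ.+ 0))
      ≡⟨ cong₂ (λ x y → evenWhites (mapTree c q) ℕ.+ bit (not x ∧ isEven y)) (sym (root-mapTree c q)) (ℕP.+-identityʳ (blackChildren (mapTree c q))) ⟩
    evenWhites (mapTree c q) ℕ.+ bit (not (root (mapTree c q)) ∧ isEven (blackChildren (mapTree c q))) ∎
    where open ≡.≡-Reasoning

isEven-suc : ∀ n → isEven (suc n) ≡ not (isEven n)
isEven-suc zero = refl
isEven-suc (suc n) = trans (sym (BoolP.not-involutive (isEven n))) (cong not (sym (isEven-suc n)))

isEven-+bit : ∀ n c → isEven (n ℕ.+ bit c) ≡ (if c then not (isEven n) else isEven n)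
isEven-+bit n true = trans (cong isEven (ℕP.+-comm n 1)) (isEven-suc n)
isEven-+bit n false = cong isEven (ℕP.+-identityʳ n)

isEven-bit+ : ∀ c n → isEven (bit c ℕ.+ n) ≡ (if c then not (isEven n) else isEven n)
isEven-bit+ c n = trans (cong isEven (ℕP.+-comm (bit c) n)) (isEven-+bit n c)

-- Colouring weights under grafting

module Weights (K : CommutativeSemiring 0ℓ 0ℓ) (t : CommutativeSemiring.Carrier K) where
  open CommutativeSemiring K renaming (_≈_ to _∼_; refl to ∼-refl; sym to ∼-sym; trans to ∼-trans)
  open SetoidReasoning setoid
  open NatSolver K using (solve; _:=_; _:+_; _:*_; con)
  open Sums K

  t^ : ℕ → Carrier
  t^ zero = 1#
  t^ (suc n) = t * t^ n

  t^-+ : ∀ m n → t^ (m ℕ.+ n) ∼ t^ m * t^ n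
  t^-+ zero n = ∼-sym (*-identityˡ _)
  t^-+ (suc m) n = ∼-trans (*-congˡ (t^-+ m n)) (∼-sym (*-assoc _ _ _))

  when : Bool → Carrier → Carrier
  when b x = if b then x else 0#

  -- As evenWhites leaves out the root, grafting below a black vertex needs no division by t.
  evenWeight oddWeight blackWeight : Tree Bool → Carrier
  evenWeight r = when (not (root r) ∧ isEven (blackChildren r)) (t^ (evenWhites r))
  oddWeight r = when (not (root r) ∧ not (isEven (blackChildren r))) (t^ (evenWhites r))
  blackWeight r = when (root r) (t^ (evenWhites r))

  private
    total₀ : ∀ m n → t^ (m ℕ.+ n ℕ.+ 0) ∼ t^ m * t^ n
    total₀ m n = ∼-trans (reflexive (cong t^ (ℕP.+-identityʳ (m ℕ.+ n)))) (t^-+ m n)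

    total₁ : ∀ m n → t^ (m ℕ.+ n ℕ.+ 1) ∼ t * (t^ m * t^ n)
    total₁ m n = ∼-trans (reflexive (cong t^ (ℕP.+-comm (m ℕ.+ n) 1))) (*-congˡ (t^-+ m n))

    -- Joining a root of colour ra (with black children of parity pa) below a root of colour rb.
    join-white : ∀ ra pa rb pb m n →
      when (not rb ∧ (if ra then not pb else pb)) (t^ (m ℕ.+ n ℕ.+ bit (not ra ∧ (if rb then not pa else pa)))) ∼
      (t * when (not ra ∧ pa) (t^ m) + when (not ra ∧ not pa) (t^ m)) * when (not rb ∧ pb) (t^ n) +
      when ra (t^ m) * when (not rb ∧ not pb) (t^ n)
    join-white ra pa true pb m n = solve 2 (λ p z → con 0 := p :* con 0 :+ z :* con 0) ∼-refl _ _
    join-white false true false true m n = ∼-trans (total₁ m n)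
      (solve 3 (λ t x y → t :* (x :* y) := (t :* x :+ con 0) :* y :+ con 0 :* con 0) ∼-refl t (t^ m) (t^ n))
    join-white false true false false m n =
      solve 3 (λ t x y → con 0 := (t :* x :+ con 0) :* con 0 :+ con 0 :* y) ∼-refl t (t^ m) (t^ n)
    join-white false false false true m n = ∼-trans (total₀ m n)
      (solve 3 (λ t x y → x :* y := (t :* con 0 :+ x) :* y :+ con 0 :* con 0) ∼-refl t (t^ m) (t^ n))
    join-white false false false false m n =
      solve 3 (λ t x y → con 0 := (t :* con 0 :+ x) :* con 0 :+ con 0 :* y) ∼-refl t (t^ m) (t^ n)
    join-white true pa false true m n =
      solve 3 (λ t x y → con 0 := (t :* con 0 :+ con 0) :* y :+ x :* con 0) ∼-refl t (t^ m) (t^ n)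
    join-white true pa false false m n = ∼-trans (total₀ m n)
      (solve 3 (λ t x y → x :* y := (t :* con 0 :+ con 0) :* con 0 :+ x :* y) ∼-refl t (t^ m) (t^ n))

    -- A black parent flips the parity of a white root, so here the factor t goes to the odd part
    -- and the even part receives none. This is the origin of the exponent a/t + tb + c, in which a
    -- already carries the t of its root.
    join-black : ∀ ra pa rb m n →
      when rb (t^ (m ℕ.+ n ℕ.+ bit (not ra ∧ (if rb then not pa else pa)))) ∼
      (when (not ra ∧ pa) (t^ m) + t * when (not ra ∧ not pa) (t^ m) + when ra (t^ m)) * when rb (t^ n)
    join-black ra pa false m n = ∼-sym (zeroʳ _)
    join-black false true true m n = ∼-trans (total₀ m n)
      (solve 3 (λ t x y → x :* y := (x :+ t :* con 0 :+ con 0) :* y) ∼-refl t (t^ m) (t^ n))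
    join-black false false true m n = ∼-trans (total₁ m n)
      (solve 3 (λ t x y → t :* (x :* y) := (con 0 :+ t :* x :+ con 0) :* y) ∼-refl t (t^ m) (t^ n))
    join-black true pa true m n = ∼-trans (total₀ m n)
      (solve 3 (λ t x y → x :* y := (con 0 :+ t :* con 0 :+ x) :* y) ∼-refl t (t^ m) (t^ n))

    push-not : ∀ c p → not (if c then not p else p) ≡ (if c then not (not p) else not p)
    push-not true p = refl
    push-not false p = refl

  evenWeight-graft : ∀ a b → evenWeight (graft a b) ∼
    (t * evenWeight a + oddWeight a) * evenWeight b + blackWeight a * oddWeight b
  evenWeight-graft a b rewrite isEven-bit+ (root a) (blackChildren b) | isEven-+bit (blackChildren a) (root b) =
    join-white (root a) _ (root b) _ (evenWhites a) (evenWhites b)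

  oddWeight-graft : ∀ a b → oddWeight (graft a b) ∼
    (t * evenWeight a + oddWeight a) * oddWeight b + blackWeight a * evenWeight b
  oddWeight-graft a b rewrite isEven-bit+ (root a) (blackChildren b) | isEven-+bit (blackChildren a) (root b)
    | push-not (root a) (isEven (blackChildren b)) =
    -- Negating the parity of b exchanges its even and odd weights, so the even case of the join
    -- applies.
    ∼-trans (join-white (root a) _ (root b) (not (isEven (blackChildren b))) (evenWhites a) (evenWhites b))
      (+-congˡ (*-congˡ (reflexive (cong (λ p → when (not (root b) ∧ p) (t^ (evenWhites b))) (BoolP.not-involutive (isEven (blackChildren b)))))))

  blackWeight-graft : ∀ a b → blackWeight (graft a b) ∼
    (evenWeight a + t * oddWeight a + blackWeight a) * blackWeight b
  blackWeight-graft a b rewrite isEven-+bit (blackChildren a) (root b) =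
    join-black (root a) _ (root b) (evenWhites a) (evenWhites b)

  open Fill K (false ∷ true ∷ [])

  evenSum oddSum blackSum : Shape → Carrier
  evenSum p = fill p evenWeight
  oddSum p = fill p oddWeight
  blackSum p = fill p blackWeight

  -- Stated for f, g, h so that one argument serves roots of both parities.
  whiteSum-graft : ∀ a b {f g h : Tree Bool → Carrier} →
    (∀ r s → f (graft r s) ∼ (t * evenWeight r + oddWeight r) * g s + blackWeight r * h s) →
    fill (graft a b) f ∼ (t * evenSum a + oddSum a) * fill b g + blackSum a * fill b h
  whiteSum-graft a b {f} {g} {h} e = begin
    fill a (λ r → fill b (λ s → f (graft r s)))
      ≈⟨ fill-cong a (λ r → ∼-trans (fill-cong b (e r)) (fill-+ b _ _)) ⟩
    fill a (λ r → fill b (λ s → (t * evenWeight r + oddWeight r) * g s) + fill b (λ s → blackWeight r * h s))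
      ≈⟨ fill-+ a _ _ ⟩
    fill a (λ r → fill b (λ s → (t * evenWeight r + oddWeight r) * g s)) + fill a (λ r → fill b (λ s → blackWeight r * h s))
      ≈⟨ +-cong (fill-product a b (λ r → t * evenWeight r + oddWeight r) g) (fill-product a b blackWeight h) ⟩
    fill a (λ r → t * evenWeight r + oddWeight r) * fill b g + blackSum a * fill b h
      ≈⟨ +-congʳ (*-congʳ (∼-trans (fill-+ a (λ r → t * evenWeight r) oddWeight) (+-congʳ (fill-*ˡ a t evenWeight)))) ⟩
    (t * evenSum a + oddSum a) * fill b g + blackSum a * fill b h ∎

  blackSum-graft : ∀ a b → blackSum (graft a b) ∼ (evenSum a + t * oddSum a + blackSum a) * blackSum b
  blackSum-graft a b = begin
    fill a (λ r → fill b (λ s → blackWeight (graft r s)))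
      ≈⟨ fill-cong a (λ r → fill-cong b (blackWeight-graft r)) ⟩
    fill a (λ r → fill b (λ s → (evenWeight r + t * oddWeight r + blackWeight r) * blackWeight s))
      ≈⟨ fill-product a b (λ r → evenWeight r + t * oddWeight r + blackWeight r) blackWeight ⟩
    fill a (λ r → evenWeight r + t * oddWeight r + blackWeight r) * blackSum b
      ≈⟨ *-congʳ (∼-trans (fill-+ a (λ r → evenWeight r + t * oddWeight r) blackWeight)
           (+-congʳ (∼-trans (fill-+ a evenWeight (λ r → t * oddWeight r)) (+-congˡ (fill-*ˡ a t oddWeight))))) ⟩
    (evenSum a + t * oddSum a + blackSum a) * blackSum b ∎

-- The recurrences and the uniqueness of their solution

module Recurrence (K : CommutativeSemiring 0ℓ 0ℓ) (D : Sums.Inverses K) (t : CommutativeSemiring.Carrier K) where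
  open CommutativeSemiring K renaming (_≈_ to _∼_; refl to ∼-refl; sym to ∼-sym; trans to ∼-trans)
  open SetoidReasoning setoid
  open Sums K
  open Inverses D
  open Mass K D
  open Weights K t

  -- The recurrences satisfied by exp(a+b)cosh(c), exp(a+b)sinh(c) and exp(a/t+tb+c),
  -- for a = txU, b = xV, c = xC.
  record Solves (U V C : ℕ → Carrier) : Set where
    field
      U₀ : U 0 ∼ 1#
      V₀ : V 0 ∼ 0#
      C₀ : C 0 ∼ 1#
      U₊ : ∀ n → nat (suc n) * U (suc n) ∼ diag n (λ i j → nat (suc i) * ((t * U i + V i) * U j + C i * V j))
      V₊ : ∀ n → nat (suc n) * V (suc n) ∼ diag n (λ i j → nat (suc i) * ((t * U i + V i) * V j + C i * U j))
      C₊ : ∀ n → nat (suc n) * C (suc n) ∼ diag n (λ i j → nat (suc i) * ((U i + t * V i + C i) * C j))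

  divide : ∀ n {x y} → nat (suc n) * x ∼ y → inv (suc n) * y ∼ x
  divide n {x} {y} e = begin
    inv (suc n) * y                     ≈⟨ *-congˡ e ⟨
    inv (suc n) * (nat (suc n) * x)     ≈⟨ *-assoc _ _ _ ⟨
    inv (suc n) * nat (suc n) * x       ≈⟨ *-congʳ (∼-trans (*-comm _ _) (nat-inv n)) ⟩
    1# * x                              ≈⟨ *-identityˡ x ⟩
    x ∎

  module _ {U V C : ℕ → Carrier} (S : Solves U V C) where
    open Solves S

    -- The factor i+1 by which `wsum` weighs a branch is the same as the one that x d/dx produces in
    -- the recurrences. Both sides are therefore the same expression in earlier coefficients, and
    -- division by n+1 identifies the next one.
    wsum-solves : ∀ k n → n ℕ.< k → (wsum k n evenSum ∼ U n) × (wsum k n oddSum ∼ V n) × (wsum k n blackSum ∼ C n)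
    wsum-solves (suc k) zero _ =
      -- A single vertex is white or black with weight 1 each; when white it is even, having no
      -- black children.
      ∼-trans (+-congˡ (+-identityʳ _)) (∼-trans (+-identityʳ _) (∼-sym U₀)) ,
      ∼-trans (∼-trans (+-identityˡ _) (+-identityˡ _)) (∼-sym V₀) ,
      ∼-trans (∼-trans (+-identityˡ _) (+-identityʳ _)) (∼-sym C₀)
    wsum-solves (suc k) (suc n) (s≤s n<k) =
      ∼-trans (*-congˡ (diag-cong n (λ i j p → *-congˡ (white i j p {evenSum} (λ a b → whiteSum-graft a b {evenWeight} evenWeight-graft) (evens j p) (odds j p)))))
              (divide n (U₊ n)) ,
      ∼-trans (*-congˡ (diag-cong n (λ i j p → *-congˡ (white i j p {oddSum} (λ a b → whiteSum-graft a b {oddWeight} oddWeight-graft) (odds j p) (evens j p)))))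
              (divide n (V₊ n)) ,
      ∼-trans (*-congˡ (diag-cong n (λ i j p → *-congˡ (black i j p)))) (divide n (C₊ n))
      where
      belowˡ : ∀ {i j} → i ℕ.+ j ≡ n → i ℕ.< k
      belowˡ {i} {j} p = ℕP.≤-<-trans (subst (i ≤_) p (ℕP.m≤m+n i j)) n<k
      belowʳ : ∀ {i} j → i ℕ.+ j ≡ n → j ℕ.< k
      belowʳ {i} j p = ℕP.≤-<-trans (subst (j ≤_) p (ℕP.m≤n+m j i)) n<k
      evens : ∀ {i} j → i ℕ.+ j ≡ n → wsum k j evenSum ∼ U j
      evens j p = proj₁ (wsum-solves k j (belowʳ j p))
      odds : ∀ {i} j → i ℕ.+ j ≡ n → wsum k j oddSum ∼ V j
      odds j p = proj₁ (proj₂ (wsum-solves k j (belowʳ j p)))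
      white : ∀ i j → i ℕ.+ j ≡ n → ∀ {f g h : Shape → Carrier} →
              (∀ a b → f (graft a b) ∼ (t * evenSum a + oddSum a) * g b + blackSum a * h b) →
              ∀ {G H} → wsum k j g ∼ G → wsum k j h ∼ H →
              wsum k i (λ a → wsum k j (λ b → f (graft a b))) ∼ (t * U i + V i) * G + C i * H
      white i j p {f} {g} {h} e {G} {H} eg eh = begin
        wsum k i (λ a → wsum k j (λ b → f (graft a b)))
          ≈⟨ wsum-cong k i (λ a _ → ∼-trans (wsum-cong k j (λ b _ → e a b)) (wsum-+ k j _ _)) ⟩
        wsum k i (λ a → wsum k j (λ b → (t * evenSum a + oddSum a) * g b) + wsum k j (λ b → blackSum a * h b))
          ≈⟨ wsum-+ k i _ _ ⟩
        wsum k i (λ a → wsum k j (λ b → (t * evenSum a + oddSum a) * g b)) + wsum k i (λ a → wsum k j (λ b → blackSum a * h b))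
          ≈⟨ +-cong (wsum-product k i j (λ a → t * evenSum a + oddSum a) g) (wsum-product k i j blackSum h) ⟩
        wsum k i (λ a → t * evenSum a + oddSum a) * wsum k j g + wsum k i blackSum * wsum k j h
          ≈⟨ +-cong (*-cong (∼-trans (wsum-+ k i (λ a → t * evenSum a) oddSum)
                               (+-cong (∼-trans (wsum-*ˡ k i t evenSum) (*-congˡ (proj₁ rec))) (proj₁ (proj₂ rec)))) eg)
                    (*-cong (proj₂ (proj₂ rec)) eh) ⟩
        (t * U i + V i) * G + C i * H ∎
        where rec = wsum-solves k i (belowˡ p)
      black : ∀ i j → i ℕ.+ j ≡ n → wsum k i (λ a → wsum k j (λ b → blackSum (graft a b))) ∼ (U i + t * V i + C i) * C j
      black i j p = begin
        wsum k i (λ a → wsum k j (λ b → blackSum (graft a b)))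
          ≈⟨ wsum-cong k i (λ a _ → wsum-cong k j (λ b _ → blackSum-graft a b)) ⟩
        wsum k i (λ a → wsum k j (λ b → (evenSum a + t * oddSum a + blackSum a) * blackSum b))
          ≈⟨ wsum-product k i j (λ a → evenSum a + t * oddSum a + blackSum a) blackSum ⟩
        wsum k i (λ a → evenSum a + t * oddSum a + blackSum a) * wsum k j blackSum
          ≈⟨ *-cong (∼-trans (wsum-+ k i (λ a → evenSum a + t * oddSum a) blackSum)
                       (+-cong (∼-trans (wsum-+ k i evenSum (λ a → t * oddSum a))
                                 (+-cong (proj₁ rec) (∼-trans (wsum-*ˡ k i t oddSum) (*-congˡ (proj₁ (proj₂ rec))))))
                               (proj₂ (proj₂ rec))))
                    (proj₂ (proj₂ (wsum-solves k j (belowʳ j p)))) ⟩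
        (U i + t * V i + C i) * C j ∎
        where rec = wsum-solves k i (belowˡ p)

-- Sums over a transversal of the isomorphism classes

module LPΣ = Sums LP-semiring

nat-ℚ : ∀ n → Sums.nat ℚ-semiring n ≡ ℚ.mkℚ (+ n) 0 (Coprimality.sym (Coprimality.1-coprimeTo n))
nat-ℚ zero = refl
nat-ℚ (suc n) = trans (cong (1ℚ ℚ.+_) (nat-ℚ n))
  (trans (cong (λ z → (+ 1 ℤ.+ z) ℚ./ 1) (ℤP.*-identityʳ (+ n))) (ℚP.normalize-coprime (Coprimality.sym (Coprimality.1-coprimeTo (suc n)))))

nat-invNat : ∀ n → Sums.nat ℚ-semiring (suc n) ℚ.* invNat (suc n) ≡ 1ℚ
nat-invNat n = trans (cong₂ ℚ._*_ (nat-ℚ (suc n)) (ℚP.normalize-coprime (Coprimality.1-coprimeTo (suc n))))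
  (ℚP.*-inverseʳ (ℚ.mkℚ (+ suc n) 0 (Coprimality.sym (Coprimality.1-coprimeTo (suc n)))))

nat-const : ∀ n → LPΣ.nat n ≃ lpConst (Sums.nat ℚ-semiring n)
nat-const zero = level⇒≃ 0 z≤n z≤n (λ { zero → refl ; (suc _) → refl })
nat-const (suc n) = lpAdd-cong ≃-refl (nat-const n)

LP-inverses : LPΣ.Inverses
LP-inverses = record
  { inv = λ n → lpConst (invNat n)
  ; nat-inv = λ n → ≃-trans (lpMul-cong (nat-const (suc n)) ≃-refl)
      (subst (λ x → lpConst (x ℚ.+ 0ℚ) ≃ lp1) (sym (nat-invNat n)) ≃-refl) }

shapeIsos-refl : ∀ p → ¬ (shapeIsos p p ≡ 0)
shapeIsos-refl (leaf tt) ()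
shapeIsos-refl (graft a b) e with ℕP.m*n≡0⇒m≡0∨n≡0 (shapeIsos a a) (ℕP.m+n≡0⇒m≡0 (shapeIsos a a ℕ.* shapeIsos b b) e)
... | inj₁ z = shapeIsos-refl a z
... | inj₂ z = shapeIsos-refl b z

represents-edges : ∀ {n} {T : RTree n} {q} → Represents T q → edges q ≡ n
represents-edges {n} {T} {q} ρ = ℕP.suc-injective (trans (sym (length-labels q))
  (trans (PermP.↭-length (labels↭allFin (Represents.distinct ρ) (Represents.total ρ))) (ListP.length-tabulate {n = suc n} id)))
  where
  length-labels : ∀ {A : Set} (p : Tree A) → List.length (labels p) ≡ suc (edges p)
  length-labels (leaf x) = refl
  length-labels (graft a b) = trans (ListP.length-++ (labels a))
    (trans (cong₂ ℕ._+_ (length-labels a) (length-labels b)) (ℕP.+-comm (suc (edges a)) (suc (edges b))))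

≅-euclidean : ∀ {n} {R T T' : RTree n} → R ≅ T → R ≅ T' → T ≅ T'
≅-euclidean {T' = T'} (σ , fixσ , presσ) (τ , fixτ , presτ) =
  mk↔ₛ′ (Inverse.to τ ∘ Inverse.from σ) (Inverse.to σ ∘ Inverse.from τ)
    (λ y → trans (cong (Inverse.to τ) (Inverse.strictlyInverseʳ σ _)) (Inverse.strictlyInverseˡ τ y))
    (λ x → trans (cong (Inverse.to σ) (Inverse.strictlyInverseʳ τ _)) (Inverse.strictlyInverseˡ σ x)) ,
  trans (cong (Inverse.to τ) (trans (cong (Inverse.from σ) (sym fixσ)) (Inverse.strictlyInverseʳ σ Fin.zero))) fixτ ,
  λ u v → trans (cong₂ (adj _) (sym (Inverse.strictlyInverseˡ σ u)) (sym (Inverse.strictlyInverseˡ σ v)))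
    (trans (sym (presσ _ _)) (presτ _ _))

module Transversal (K : CommutativeSemiring 0ℓ 0ℓ) (D : Sums.Inverses K) where
  open CommutativeSemiring K renaming (_≈_ to _∼_; refl to ∼-refl; sym to ∼-sym; trans to ∼-trans)
  open SetoidReasoning setoid
  open NatSolver K using (solve; _:=_; _:*_)
  open Sums K
  open Inverses D
  open Mass K D

  module _ {n} (W : RTree n → Carrier) (w : Shape → Carrier) (W∼w : ∀ T q → Represents T q → W T ∼ w (shape q)) where
    private
      canonical : RTree n → Shape
      canonical T = shape (proj₁ (representation T))

    -- The numbering of p represents exactly one of the trees in L.
    ∑-over-class : ∀ L → IsTransversal L → ∀ p → edges p ≡ n →
      ∑ L (λ T → inv (autCount T) * w (canonical T) * nat (shapeIsos p (canonical T))) ∼ w p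
    ∑-over-class L (covers , separated) p refl =
      ∑-select (All.universal (λ _ → tt) L) (covers (realization p))
        (AllPairs.map (λ ne e → ne (≅-euclidean (proj₁ e) (proj₂ e))) separated) (λ T _ → on T) off
      where
      term : RTree (edges p) → Carrier
      term T = inv (autCount T) * w (canonical T) * nat (shapeIsos p (canonical T))
      on : ∀ T → realization p ≅ T → term T ∼ w p
      on T i = begin
        inv (autCount T) * w (canonical T) * nat (shapeIsos p (canonical T))
          ≈⟨ *-cong (*-congˡ same-weight) (reflexive (cong nat isos≡aut)) ⟩
        inv (autCount T) * w p * nat (autCount T)
          ≈⟨ solve 3 (λ x y z → x :* y :* z := (z :* x) :* y) ∼-refl _ _ _ ⟩
        nat (autCount T) * inv (autCount T) * w p
          ≈⟨ *-congʳ (unit (autCount T) aut≢0) ⟩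
        1# * w p
          ≈⟨ *-identityˡ _ ⟩
        w p ∎
        where
        q = mapTree (Inverse.to (proj₁ i)) (numbering p)
        ρ : Represents T q
        ρ = ≅⇒represents i (represents-numbering p)
        ρ' = proj₂ (representation T)
        shape-q : shape q ≡ p
        shape-q = trans (mapTree-∘ _ _ (numbering p)) (shape-numbering p)
        same-weight : w (canonical T) ∼ w p
        same-weight = ∼-trans (∼-sym (W∼w T _ ρ')) (∼-trans (W∼w T q ρ) (reflexive (cong w shape-q)))
        isos≡aut : shapeIsos p (canonical T) ≡ autCount T
        isos≡aut = sym (trans (autCount-shapeIsos ρ ρ') (cong (λ s → shapeIsos s (canonical T)) shape-q))
        -- `inv` is specified at positive numbers only; the count is positive because every shape is
        -- isomorphic to itself.
        aut≢0 : ¬ (autCount T ≡ 0)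
        aut≢0 e = shapeIsos-refl (canonical T) (trans (sym (autCount-shapeIsos ρ' ρ')) e)
        unit : ∀ m → ¬ (m ≡ 0) → nat m * inv m ∼ 1#
        unit zero ne = ⊥-elim (ne refl)
        unit (suc m) _ = nat-inv m
      off : ∀ T → ¬ (realization p ≅ T) → term T ∼ 0#
      off T ne with shapeIsos p (canonical T) ℕ.≟ 0
      ... | yes e = ∼-trans (*-congˡ (reflexive (cong nat e))) (zeroʳ _)
      ... | no nz = ⊥-elim (ne (shapeIsos⇒≅ (represents-numbering p) (proj₂ (representation T))
                      (λ e → nz (trans (cong (λ s → shapeIsos s (canonical T)) (sym (shape-numbering p))) e))))

    -- Each term is multiplied by 1, written as the weighted number of isomorphisms from all shapes,
    -- and the sums are exchanged. For a fixed shape only the tree of its class remains, where the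
    -- number of isomorphisms equals `autCount` and cancels.
    ∑-transversal : ∀ L → IsTransversal L → ∑ L (λ T → inv (autCount T) * W T) ∼ wsum (suc n) n w
    ∑-transversal L trv = begin
      ∑ L (λ T → inv (autCount T) * W T)
        ≈⟨ ∑-cong L (λ T → ∼-trans (*-congˡ (W∼w T _ (proj₂ (representation T)))) (∼-sym (∼-trans (*-congˡ (unit-mass T)) (*-identityʳ _)))) ⟩
      ∑ L (λ T → inv (autCount T) * w (canonical T) * wsum (suc n) n (λ p → nat (shapeIsos p (canonical T))))
        ≈⟨ ∑-cong L (λ T → ∼-sym (wsum-*ˡ (suc n) n _ _)) ⟩
      ∑ L (λ T → wsum (suc n) n (λ p → inv (autCount T) * w (canonical T) * nat (shapeIsos p (canonical T))))
        ≈⟨ wsum-∑ (suc n) n L (λ p T → inv (autCount T) * w (canonical T) * nat (shapeIsos p (canonical T))) ⟨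
      wsum (suc n) n (λ p → ∑ L (λ T → inv (autCount T) * w (canonical T) * nat (shapeIsos p (canonical T))))
        ≈⟨ wsum-cong (suc n) n (λ p → ∑-over-class L trv p) ⟩
      wsum (suc n) n w ∎
      where
      unit-mass : ∀ T → wsum (suc n) n (λ p → nat (shapeIsos p (canonical T))) ∼ 1#
      unit-mass T = wsum-isos (suc n) n (canonical T) (ℕP.n<1+n n)
        (trans (edges-mapTree _ (proj₁ (representation T))) (represents-edges (proj₂ (representation T))))

open Weights LP-semiring tLP
open Mass LP-semiring LP-inverses

tpow-suc : ∀ k → tpow (suc k) ≃ lpMul tLP (tpow k)
tpow-suc k = level⇒≃ 0 z≤n z≤n (λ m → trans (shifted m) (sym (nth-mulL (0ℚ ∷ 1ℚ ∷ []) (cs (tpow k)) m)))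
  where
  f = nthℚ (cs (tpow k))
  unit : ∀ m → (nthℚ (1ℚ ∷ []) ℚS.⋆ f) m ≡ f m
  unit m = trans (sym (nth-mulL (1ℚ ∷ []) (cs (tpow k)) m)) (≃⇒level {lpMul lp1 (tpow k)} {tpow k} 0 z≤n z≤n (lpMul-identityˡ (tpow k)) m)
  shifted : ∀ m → nthℚ (cs (tpow (suc k))) m ≡ (nthℚ (0ℚ ∷ 1ℚ ∷ []) ℚS.⋆ f) m
  shifted zero = sym (ℚP.*-zeroˡ (f 0))
  shifted (suc m) = sym (trans (cong₂ ℚ._+_ (ℚP.*-zeroˡ (f (suc m))) (unit m)) (ℚP.+-identityˡ (f m)))

tpow-t^ : ∀ k → tpow k ≃ t^ k
tpow-t^ zero = ≃-refl
tpow-t^ (suc k) = ≃-trans (tpow-suc k) (lpMul-cong {tLP} {tLP} ≃-refl (tpow-t^ k))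

sumLP-map : ∀ {A : Set} (f : A → LP) xs → sumLP (map f xs) ≡ LPΣ.∑ xs f
sumLP-map f [] = refl
sumLP-map f (x ∷ xs) = cong (lpAdd (f x)) (sumLP-map f xs)

module _ {n} (sel : RTree n → Coloring n → Bool) (g : Tree Bool → LP) (w : Shape → LP)
         (term : ∀ T q → Represents T q → ∀ c → (if sel T c then tpow (numEvenWhite T c) else lp0) ≃ g (mapTree c q))
         (sum : ∀ p → Fill.fill LP-semiring (false ∷ true ∷ []) p g ≃ w p) where
  treeSum-wsum : ∀ L → IsTransversal L → treeSum sel L ≃ wsum (suc n) n w
  treeSum-wsum L trv = subst (_≃ _) (sym (sumLP-map (treeTerm sel) L))
    (Transversal.∑-transversal LP-semiring LP-inverses _ w weight L trv)
    where
    weight : ∀ T q → Represents T q →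
             sumLP (map (λ c → if sel T c then tpow (numEvenWhite T c) else lp0) (colorings n)) ≃ w (shape q)
    weight T q ρ = subst (_≃ _) (sym (sumLP-map (λ c → if sel T c then tpow (numEvenWhite T c) else lp0) (colorings n)))
      (≃-trans (LPΣ.∑-cong (colorings n) (term T q ρ))
      (≃-trans (Relabel.∑-relabel LP-semiring (false ∷ true ∷ []) q (labels↭allFin (Represents.distinct ρ) (Represents.total ρ)) g) (sum (shape q))))

module _ {n} {T : RTree n} {q} (ρ : Represents T q) (c : Coloring n) where
  private
    r = mapTree c q
    e = evenWhites r

    t^-total : ∀ b → tpow (e ℕ.+ bit b) ≃ (if b then lpMul tLP (t^ e) else t^ e)
    t^-total true = subst (λ m → tpow m ≃ lpMul tLP (t^ e)) (ℕP.+-comm 1 e) (tpow-t^ (suc e))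
    t^-total false = subst (λ m → tpow m ≃ t^ e) (sym (ℕP.+-identityʳ e)) (tpow-t^ e)

    t*0 : lp0 ≃ lpMul tLP lp0
    t*0 = ≃-sym (CommutativeSemiring.zeroʳ LP-semiring tLP)

    even-white : ∀ x p → (if not x ∧ p then tpow (e ℕ.+ bit (not x ∧ p)) else lp0) ≃ lpMul tLP (when (not x ∧ p) (t^ e))
    even-white true p = t*0
    even-white false true = t^-total true
    even-white false false = t*0

    odd-white : ∀ x p → (if not x ∧ not p then tpow (e ℕ.+ bit (not x ∧ p)) else lp0) ≃ when (not x ∧ not p) (t^ e)
    odd-white true p = ≃-refl
    odd-white false true = ≃-refl
    odd-white false false = t^-total false

    black : ∀ x p → (if x then tpow (e ℕ.+ bit (not x ∧ p)) else lp0) ≃ when x (t^ e)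
    black true p = t^-total false
    black false p = ≃-refl

    any : ∀ x p → tpow (e ℕ.+ bit (not x ∧ p)) ≃
          lpAdd (lpMul tLP (when (not x ∧ p) (t^ e))) (lpAdd (when (not x ∧ not p) (t^ e)) (when x (t^ e)))
    any true p = ≃-trans (t^-total false) (≃-sym (≃-trans (lpAdd-cong (≃-sym t*0) (lpAdd-identityˡ _)) (lpAdd-identityˡ _)))
    any false true = ≃-trans (t^-total true) (≃-sym (CommutativeSemiring.+-identityʳ LP-semiring _))
    any false false = ≃-trans (t^-total false) (≃-sym (≃-trans (lpAdd-cong (≃-sym t*0) (CommutativeSemiring.+-identityʳ LP-semiring _)) (lpAdd-identityˡ _)))

  -- `numEvenWhite` counts the root and `evenWeight` does not; the missing factor t appears
  -- precisely for an even-white root.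
  term-even : (if rootWhiteEven T c then tpow (numEvenWhite T c) else lp0) ≃ lpMul tLP (evenWeight r)
  term-even rewrite numEvenWhite-tree ρ c | blackNbrs-root ρ c | sym (root-colour ρ c) = even-white (root r) (isEven (blackChildren r))

  term-odd : (if rootWhiteOdd T c then tpow (numEvenWhite T c) else lp0) ≃ oddWeight r
  term-odd rewrite numEvenWhite-tree ρ c | blackNbrs-root ρ c | sym (root-colour ρ c) = odd-white (root r) (isEven (blackChildren r))

  term-black : (if rootBlack T c then tpow (numEvenWhite T c) else lp0) ≃ blackWeight r
  term-black rewrite numEvenWhite-tree ρ c | sym (root-colour ρ c) = black (root r) (isEven (blackChildren r))

  term-any : (if anyRoot T c then tpow (numEvenWhite T c) else lp0) ≃ lpAdd (lpMul tLP (evenWeight r)) (lpAdd (oddWeight r) (blackWeight r))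
  term-any rewrite numEvenWhite-tree ρ c = any (root r) (isEven (blackChildren r))

module _ {n} (L : List (RTree n)) (trv : IsTransversal L) where
  open Fill LP-semiring (false ∷ true ∷ [])

  private
    E = wsum (suc n) n evenSum
    O = wsum (suc n) n oddSum
    B' = wsum (suc n) n blackSum

  treeSum-even : treeSum rootWhiteEven L ≃ lpMul tLP E
  treeSum-even = ≃-trans (treeSum-wsum rootWhiteEven (λ r → lpMul tLP (evenWeight r)) (λ p → lpMul tLP (evenSum p))
    (λ T q → term-even) (λ p → fill-*ˡ p tLP evenWeight) L trv) (wsum-*ˡ (suc n) n tLP evenSum)

  treeSum-odd : treeSum rootWhiteOdd L ≃ O
  treeSum-odd = treeSum-wsum rootWhiteOdd oddWeight oddSum (λ T q → term-odd) (λ p → ≃-refl) L trv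

  treeSum-black : treeSum rootBlack L ≃ B'
  treeSum-black = treeSum-wsum rootBlack blackWeight blackSum (λ T q → term-black) (λ p → ≃-refl) L trv

  treeSum-any : treeSum anyRoot L ≃ lpAdd (lpMul tLP E) (lpAdd O B')
  treeSum-any = ≃-trans (treeSum-wsum anyRoot _ (λ p → lpAdd (lpMul tLP (evenSum p)) (lpAdd (oddSum p) (blackSum p)))
    (λ T q → term-any)
    (λ p → ≃-trans (fill-+ p (λ r → lpMul tLP (evenWeight r)) (λ r → lpAdd (oddWeight r) (blackWeight r)))
                   (lpAdd-cong (fill-*ˡ p tLP evenWeight) (fill-+ p oddWeight blackWeight))) L trv)
    (≃-trans (wsum-+ (suc n) n (λ p → lpMul tLP (evenSum p)) (λ p → lpAdd (oddSum p) (blackSum p)))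
             (lpAdd-cong (wsum-*ˡ (suc n) n tLP evenSum) (wsum-+ (suc n) n oddSum blackSum)))

-- The limit of the iteration

module Exponentials (K : CommutativeSemiring 0ℓ 0ℓ) (D : Sums.Inverses K) (t : CommutativeSemiring.Carrier K) where
  open CommutativeSemiring K renaming (_≈_ to _∼_; refl to ∼-refl; sym to ∼-sym; trans to ∼-trans)
  open SetoidReasoning setoid
  open NatSolver K using (solve; _:=_; _:*_)
  open Sums K
  open Inverses D
  open Series K

  factorial-suc : ∀ k → ∃ λ m → k ! ≡ suc m
  factorial-suc zero = 0 , refl
  factorial-suc (suc k) with k ! | factorial-suc k
  ... | .(suc m) | m , refl = _ , refl

  inv-* : ∀ k n → nat (suc k) * inv (suc k ℕ.* suc n) ∼ inv (suc n)
  inv-* k n = begin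
    nat (suc k) * inv kn                            ≈⟨ *-identityˡ _ ⟨
    1# * (nat (suc k) * inv kn)                     ≈⟨ *-congʳ (nat-inv n) ⟨
    nat (suc n) * inv (suc n) * (nat (suc k) * inv kn)
      ≈⟨ solve 4 (λ x y z w → x :* y :* (z :* w) := z :* x :* w :* y) ∼-refl _ _ _ _ ⟩
    nat (suc k) * nat (suc n) * inv kn * inv (suc n) ≈⟨ *-congʳ (*-congʳ (nat-* (suc k) (suc n))) ⟨
    nat kn * inv kn * inv (suc n)                   ≈⟨ *-congʳ (nat-inv (n ℕ.+ k ℕ.* suc n)) ⟩
    1# * inv (suc n)                                ≈⟨ *-identityˡ _ ⟩
    inv (suc n) ∎
    where kn = suc k ℕ.* suc n

  inv-factorial : ∀ k → nat (suc k) * inv (suc k !) ∼ inv (k !)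
  inv-factorial k with k ! | factorial-suc k
  ... | .(suc m) | m , refl = inv-* k m

  coefficients : (ℕ → Bool) → ℕ → Carrier
  coefficients sel k = if sel k then inv (k !) else 0#

  -- Differentiation shifts the selected exponents: `all` is preserved, `even` and `odd` are
  -- exchanged. This gives exp' = exp, cosh' = sinh and sinh' = cosh at once.
  coefficients-suc : ∀ {sel sel'} → (∀ k → sel (suc k) ≡ sel' k) →
                     ∀ k → nat (suc k) * coefficients sel (suc k) ∼ coefficients sel' k
  coefficients-suc {sel} {sel'} e k rewrite e k with sel' k
  ... | true = inv-factorial k
  ... | false = zeroʳ _

  all even odd : ℕ → Bool
  all _ = true
  even = isEven
  odd k = not (isEven k)

  exp cosh sinh : (ℕ → Carrier) → ℕ → Carrier
  exp = compose (coefficients all)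
  cosh = compose (coefficients even)
  sinh = compose (coefficients odd)

  θ-exp : ∀ {f} → f 0 ∼ 0# → θ (exp f) ≐ θ f ⋆ exp f
  θ-exp = θ-compose (coefficients all) (coefficients all) (coefficients-suc {all} {all} (λ _ → refl))

  θ-cosh : ∀ {f} → f 0 ∼ 0# → θ (cosh f) ≐ θ f ⋆ sinh f
  θ-cosh = θ-compose (coefficients even) (coefficients odd) (coefficients-suc {even} {odd} isEven-suc)

  θ-sinh : ∀ {f} → f 0 ∼ 0# → θ (sinh f) ≐ θ f ⋆ cosh f
  θ-sinh = θ-compose (coefficients odd) (coefficients even)
    (coefficients-suc {odd} {even} (λ k → trans (cong not (isEven-suc k)) (BoolP.not-involutive (isEven k))))

  inv-1 : inv 1 ∼ 1#
  inv-1 = ∼-trans (∼-sym (*-identityˡ _)) (∼-trans (*-congʳ (∼-sym (+-identityʳ 1#))) (nat-inv 0))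

  compose-0-one : ∀ {sel} → sel 0 ≡ true → ∀ f → compose (coefficients sel) f 0 ∼ 1#
  compose-0-one {sel} e f rewrite e = ∼-trans (+-identityʳ _) (∼-trans (*-identityʳ _) inv-1)

  compose-0-zero : ∀ {sel} → sel 0 ≡ false → ∀ f → compose (coefficients sel) f 0 ∼ 0#
  compose-0-zero {sel} e f rewrite e = ∼-trans (+-identityʳ _) (zeroˡ _)

  X⋆-zero : ∀ {f} g → f 0 ∼ 0# → (f ⋆ g) 0 ∼ 0#
  X⋆-zero g z = ∼-trans (*-congʳ z) (zeroˡ _)

  X⋆-suc : ∀ f g {x} → f 0 ∼ 0# → f 1 ∼ x → (∀ i → f (suc (suc i)) ∼ 0#) → ∀ n → (f ⋆ g) (suc n) ∼ x * g n
  X⋆-suc f g z o r n = ∼-trans (⋆-shift f g z n) (diag-select n 0 n refl (*-congʳ o) vanish)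
    where
    vanish : ∀ i j → i ℕ.+ j ≡ n → ¬ (i ≡ 0) → f (suc i) * g j ∼ 0#
    vanish zero j _ ne = ⊥-elim (ne refl)
    vanish (suc i) j _ _ = ∼-trans (*-congʳ (r i)) (zeroˡ _)

  module _ (t⁻¹ : Carrier) (t-inverse : t⁻¹ * t ∼ 1#) (a b c : ℕ → Carrier) where
    open Recurrence K D t

    whiteSeries blackSeries evenGF oddGF blackGF : ℕ → Carrier
    whiteSeries n = a n + b n
    blackSeries n = t⁻¹ * a n + (t * b n + c n)
    evenGF = exp whiteSeries ⋆ cosh c
    oddGF = exp whiteSeries ⋆ sinh c
    blackGF = exp blackSeries

    -- At a fixed point, coefficient i+1 of the white exponent is tU_i + V_i and that of the black
    -- exponent is U_i + tV_i + C_i; in the latter `t⁻¹` cancels the t contained in a.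
    fixedPoint-solves : a 0 ∼ 0# → b 0 ∼ 0# → c 0 ∼ 0# →
      (∀ n → a (suc n) ∼ t * evenGF n) → (∀ n → b (suc n) ∼ oddGF n) → (∀ n → c (suc n) ∼ blackGF n) → Solves evenGF oddGF blackGF
    fixedPoint-solves a₀ b₀ c₀ a₊ b₊ c₊ = record
      { U₀ = ∼-trans (*-cong (compose-0-one {all} refl whiteSeries) (compose-0-one {even} refl c)) (*-identityˡ 1#)
      ; V₀ = ∼-trans (*-congˡ (compose-0-zero {odd} refl c)) (zeroʳ _)
      ; C₀ = compose-0-one {all} refl blackSeries
      ; U₊ = λ n → ∼-trans (θ-recurrence₂ whiteSeries c (exp whiteSeries) (cosh c) (sinh c) (θ-exp white₀) (θ-cosh c₀) n)
               (diag-cong n (λ i j _ → *-congˡ (+-cong (*-congʳ (white₊ i)) (*-congʳ (c₊ i)))))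
      ; V₊ = λ n → ∼-trans (θ-recurrence₂ whiteSeries c (exp whiteSeries) (sinh c) (cosh c) (θ-exp white₀) (θ-sinh c₀) n)
               (diag-cong n (λ i j _ → *-congˡ (+-cong (*-congʳ (white₊ i)) (*-congʳ (c₊ i)))))
      ; C₊ = λ n → ∼-trans (θ-recurrence blackSeries blackGF (θ-exp black₀) n)
               (diag-cong n (λ i j _ → *-congˡ (*-congʳ (black₊ i))))
      }
      where
      white₀ : whiteSeries 0 ∼ 0#
      white₀ = ∼-trans (+-cong a₀ b₀) (+-identityˡ 0#)
      black₀ : blackSeries 0 ∼ 0#
      black₀ = ∼-trans (+-cong (∼-trans (*-congˡ a₀) (zeroʳ _))
                 (∼-trans (+-cong (∼-trans (*-congˡ b₀) (zeroʳ _)) c₀) (+-identityˡ 0#))) (+-identityˡ 0#)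
      white₊ : ∀ i → whiteSeries (suc i) ∼ t * evenGF i + oddGF i
      white₊ i = +-cong (a₊ i) (b₊ i)
      black₊ : ∀ i → blackSeries (suc i) ∼ evenGF i + t * oddGF i + blackGF i
      black₊ i = ∼-trans (+-cong
        (∼-trans (*-congˡ (a₊ i)) (∼-trans (∼-sym (*-assoc _ _ _)) (∼-trans (*-congʳ t-inverse) (*-identityˡ _))))
        (+-cong (*-congˡ (b₊ i)) (c₊ i))) (∼-sym (+-assoc _ _ _))

module LPK = CommutativeSemiring LP-semiring
open Series LP-semiring using (_⋆_; _≐_; _≐[_]_; pow; compose; ⋆-cong; ⋆-local; compose-local)
open Exponentials LP-semiring LP-inverses tLP

∑-applyUpTo : ∀ {A : Set} (f : ℕ → A) n g → LPΣ.∑ (applyUpTo f n) g ≡ LPΣ.sumTo n (g ∘ f)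
∑-applyUpTo f zero g = refl
∑-applyUpTo f (suc n) g = cong (lpAdd (g (f 0))) (∑-applyUpTo (f ∘ suc) n g)

sumLP-upTo : ∀ (F : ℕ → LP) n → sumLP (map F (upTo n)) ≡ LPΣ.sumTo n F
sumLP-upTo F n = trans (sumLP-map F (upTo n)) (∑-applyUpTo id n F)

psMul-⋆ : ∀ f g → psMul f g ≐ f ⋆ g
psMul-⋆ f g n = subst (_≃ (f ⋆ g) n) (sym (sumLP-upTo (λ j → lpMul (f j) (g (n ∸ j))) (suc n)))
                      (LPΣ.sumTo-antidiagonal n (λ i j → lpMul (f i) (g j)))

psPow-pow : ∀ f k → psPow f k ≐ pow f k
psPow-pow f zero zero = ≃-refl
psPow-pow f zero (suc n) = ≃-refl
psPow-pow f (suc k) n = ≃-trans (psMul-⋆ f (psPow f k) n) (⋆-cong {f} (λ _ → ≃-refl) (psPow-pow f k) n)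

expLike-compose : ∀ sel f → expLike sel f ≐ compose (coefficients sel) f
expLike-compose sel f n = subst (_≃ compose (coefficients sel) f n) (sym (sumLP-upTo _ (suc n)))
  (LPΣ.sumTo-cong (suc n) term)
  where
  term : ∀ k → (if sel k then lpMul (lpConst (invNat (k !))) (psPow f k n) else lp0) ≃ lpMul (coefficients sel k) (pow f k n)
  term k with sel k
  ... | true = lpMul-cong {lpConst (invNat (k !))} ≃-refl (psPow-pow f k n)
  ... | false = ≃-sym (lpMul-zeroˡ (pow f k n))

t⁻¹*t : lpMul tinvLP tLP ≃ lp1
t⁻¹*t = level⇒≃ 1 (s≤s z≤n) z≤n (λ { zero → refl ; (suc zero) → refl ; (suc (suc _)) → refl })

module Step (S : Triple) where
  private
    a b c : PS
    a = A S
    b = B S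
    c = C S

  U' V' C' : PS
  U' = evenGF tinvLP t⁻¹*t a b c
  V' = oddGF tinvLP t⁻¹*t a b c
  C' = blackGF tinvLP t⁻¹*t a b c

  private
    T : Triple
    T = stepT S

    exp⋆ : ∀ sel → psMul (expS (psAdd a b)) (expLike sel c) ≐
           compose (coefficients all) (λ n → lpAdd (a n) (b n)) ⋆ compose (coefficients sel) c
    exp⋆ sel n = ≃-trans (psMul-⋆ (expS (psAdd a b)) (expLike sel c) n)
      (⋆-cong (expLike-compose all (psAdd a b)) (expLike-compose sel c) n)

    even-factor odd-factor black-factor : PS
    even-factor = psMul (expS (psAdd a b)) (coshS c)
    odd-factor = psMul (expS (psAdd a b)) (sinhS c)
    black-factor = expS (psAdd (psScale tinvLP a) (psAdd (psScale tLP b) c))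

    tX₀ : psScale tLP X 0 ≃ lp0
    tX₀ = LPK.zeroʳ tLP

  A₀ : A T 0 ≃ lp0
  A₀ = ≃-trans (psMul-⋆ (psScale tLP X) even-factor 0) (X⋆-zero {psScale tLP X} even-factor tX₀)

  B₀ : B T 0 ≃ lp0
  B₀ = ≃-trans (psMul-⋆ (X) odd-factor 0) (X⋆-zero {X} odd-factor ≃-refl)

  C₀ : C T 0 ≃ lp0
  C₀ = ≃-trans (psMul-⋆ (X) black-factor 0) (X⋆-zero {X} black-factor ≃-refl)

  A₊ : ∀ n → A T (suc n) ≃ lpMul tLP (U' n)
  A₊ n = ≃-trans (psMul-⋆ (psScale tLP X) even-factor (suc n)) (≃-trans
    (X⋆-suc (psScale tLP X) even-factor tX₀ (LPK.*-identityʳ tLP) (λ _ → LPK.zeroʳ tLP) n) (lpMul-cong {tLP} {tLP} ≃-refl (exp⋆ isEven n)))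

  B₊ : ∀ n → B T (suc n) ≃ V' n
  B₊ n = ≃-trans (psMul-⋆ (X) odd-factor (suc n)) (≃-trans
    (X⋆-suc X odd-factor ≃-refl ≃-refl (λ _ → ≃-refl) n) (≃-trans (lpMul-identityˡ (odd-factor n)) (exp⋆ odd n)))

  C₊ : ∀ n → C T (suc n) ≃ C' n
  C₊ n = ≃-trans (psMul-⋆ (X) black-factor (suc n)) (≃-trans
    (X⋆-suc X black-factor ≃-refl ≃-refl (λ _ → ≃-refl) n) (≃-trans (lpMul-identityˡ (black-factor n)) (expLike-compose all (psAdd (psScale tinvLP a) (psAdd (psScale tLP b) c)) n)))

record Agree (n : ℕ) (S T : Triple) : Set where
  constructor agree
  field
    onA : A S ≐[ n ] A T
    onB : B S ≐[ n ] B T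
    onC : C S ≐[ n ] C T
open Agree

agree-sym : ∀ {n} S T → Agree n S T → Agree n T S
agree-sym _ _ (agree p q r) = agree (λ i l → ≃-sym (p i l)) (λ i l → ≃-sym (q i l)) (λ i l → ≃-sym (r i l))

agree-trans : ∀ {n} R S T → Agree n R S → Agree n S T → Agree n R T
agree-trans _ _ _ (agree p q r) (agree p' q' r') =
  agree (λ i l → ≃-trans (p i l) (p' i l)) (λ i l → ≃-trans (q i l) (q' i l)) (λ i l → ≃-trans (r i l) (r' i l))

-- Every component of a step carries a factor x, so its coefficient i+1 depends only on the
-- coefficients of the argument up to i. The constant terms vanish on both sides.
agree-step : ∀ {n} S T → Agree n S T → Agree (suc n) (stepT S) (stepT T)
agree-step {n} S T (agree p q r) = agree onA' onB' onC'
  where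
  module S = Step S
  module T = Step T
  white : (λ m → lpAdd (A S m) (B S m)) ≐[ n ] (λ m → lpAdd (A T m) (B T m))
  white i l = lpAdd-cong (p i l) (q i l)
  black : (λ m → lpAdd (lpMul tinvLP (A S m)) (lpAdd (lpMul tLP (B S m)) (C S m))) ≐[ n ]
          (λ m → lpAdd (lpMul tinvLP (A T m)) (lpAdd (lpMul tLP (B T m)) (C T m)))
  black i l = lpAdd-cong (lpMul-cong {tinvLP} ≃-refl (p i l)) (lpAdd-cong (lpMul-cong {tLP} ≃-refl (q i l)) (r i l))
  onA' : A (stepT S) ≐[ suc n ] A (stepT T)
  onA' zero _ = ≃-trans S.A₀ (≃-sym T.A₀)
  onA' (suc i) (s≤s l) = ≃-trans (S.A₊ i) (≃-trans
    (lpMul-cong {tLP} ≃-refl (⋆-local (compose-local (coefficients all) white) (compose-local (coefficients even) r) i l)) (≃-sym (T.A₊ i)))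
  onB' : B (stepT S) ≐[ suc n ] B (stepT T)
  onB' zero _ = ≃-trans S.B₀ (≃-sym T.B₀)
  onB' (suc i) (s≤s l) = ≃-trans (S.B₊ i) (≃-trans
    (⋆-local (compose-local (coefficients all) white) (compose-local (coefficients odd) r) i l) (≃-sym (T.B₊ i)))
  onC' : C (stepT S) ≐[ suc n ] C (stepT T)
  onC' zero _ = ≃-trans S.C₀ (≃-sym T.C₀)
  onC' (suc i) (s≤s l) = ≃-trans (S.C₊ i) (≃-trans (compose-local (coefficients all) black i l) (≃-sym (T.C₊ i)))

record Vanishes (T : Triple) : Set where
  field
    A₀ : A T 0 ≃ lp0
    B₀ : B T 0 ≃ lp0
    C₀ : C T 0 ≃ lp0

vanishes : ∀ i → Vanishes (iterT i)
vanishes zero = record { A₀ = LPK.zeroʳ tLP ; B₀ = ≃-trans (psMul-⋆ X X 0) (LPK.zeroʳ lp0) ; C₀ = ≃-refl }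
vanishes (suc i) = record { Step (iterT i) }

-- The induction starts because all iterates have constant term 0, and each step gains one
-- coefficient.
iterates-agree : ∀ n {i j} → n ≤ i → n ≤ j → Agree n (iterT i) (iterT j)
iterates-agree zero {i} {j} _ _ = agree
  (λ { _ z≤n → ≃-trans (Vanishes.A₀ (vanishes i)) (≃-sym (Vanishes.A₀ (vanishes j))) })
  (λ { _ z≤n → ≃-trans (Vanishes.B₀ (vanishes i)) (≃-sym (Vanishes.B₀ (vanishes j))) })
  (λ { _ z≤n → ≃-trans (Vanishes.C₀ (vanishes i)) (≃-sym (Vanishes.C₀ (vanishes j))) })
iterates-agree (suc n) {suc i} {suc j} (s≤s p) (s≤s q) = agree-step (iterT i) (iterT j) (iterates-agree n p q)

-- Coefficient n no longer changes from the n-th iterate on, so the diagonal is the coefficientwise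
-- limit.
limit : Triple
limit = ⟨ (λ n → A (iterT n) n) , (λ n → B (iterT n) n) , (λ n → C (iterT n) n) ⟩

iterates-limit : ∀ {n i} → n ≤ i → Agree n (iterT i) limit
iterates-limit n≤i = agree
  (λ m l → onA (iterates-agree m (ℕP.≤-trans l n≤i) ℕP.≤-refl) m ℕP.≤-refl)
  (λ m l → onB (iterates-agree m (ℕP.≤-trans l n≤i) ℕP.≤-refl) m ℕP.≤-refl)
  (λ m l → onC (iterates-agree m (ℕP.≤-trans l n≤i) ℕP.≤-refl) m ℕP.≤-refl)

-- Both triples agree with `iterT (suc n)` up to this degree; `agree-step` plays the part of
-- continuity.
limit-fixed : ∀ n → Agree (suc n) limit (stepT limit)
limit-fixed n = agree-trans limit (iterT (suc n)) (stepT limit)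
  (agree-sym (iterT (suc n)) limit (iterates-limit {suc n} {suc n} ℕP.≤-refl))
  (agree-step (iterT n) limit (iterates-limit {n} {n} ℕP.≤-refl))

a∞ b∞ c∞ : PS
a∞ = A limit
b∞ = B limit
c∞ = C limit

module Limit = Step limit

a∞₊ : ∀ n → A limit (suc n) ≃ lpMul tLP (Limit.U' n)
a∞₊ n = ≃-trans (onA (limit-fixed n) (suc n) ℕP.≤-refl) (Limit.A₊ n)

b∞₊ : ∀ n → B limit (suc n) ≃ Limit.V' n
b∞₊ n = ≃-trans (onB (limit-fixed n) (suc n) ℕP.≤-refl) (Limit.B₊ n)

c∞₊ : ∀ n → C limit (suc n) ≃ Limit.C' n
c∞₊ n = ≃-trans (onC (limit-fixed n) (suc n) ℕP.≤-refl) (Limit.C₊ n)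

open Recurrence LP-semiring LP-inverses tLP using (wsum-solves; Solves)

limit-solves : Solves Limit.U' Limit.V' Limit.C'
limit-solves = fixedPoint-solves tinvLP t⁻¹*t (A limit) (B limit) (C limit)
  -- By definition the constant terms of `limit` are those of `iterT 0`.
  (Vanishes.A₀ (vanishes 0)) (Vanishes.B₀ (vanishes 0)) (Vanishes.C₀ (vanishes 0)) a∞₊ b∞₊ c∞₊

a∞-wsum : ∀ n → lpMul tLP (wsum (suc n) n evenSum) ≃ a∞ (suc n)
a∞-wsum n = ≃-trans (lpMul-cong {tLP} ≃-refl (proj₁ (wsum-solves limit-solves (suc n) n (ℕP.n<1+n n)))) (≃-sym (a∞₊ n))

b∞-wsum : ∀ n → wsum (suc n) n oddSum ≃ b∞ (suc n)
b∞-wsum n = ≃-trans (proj₁ (proj₂ (wsum-solves limit-solves (suc n) n (ℕP.n<1+n n)))) (≃-sym (b∞₊ n))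

c∞-wsum : ∀ n → wsum (suc n) n blackSum ≃ c∞ (suc n)
c∞-wsum n = ≃-trans (proj₂ (proj₂ (wsum-solves limit-solves (suc n) n (ℕP.n<1+n n)))) (≃-sym (c∞₊ n))

-- Absence of negative powers of t

low-diag : ∀ n {F} → (∀ i j → low (F i j) ≡ 0) → low (LPΣ.diag n F) ≡ 0
low-diag zero e = e 0 0
low-diag (suc n) e = cong₂ ℕ._⊔_ (e 0 (suc n)) (low-diag n (λ i → e (suc i)))

low-nat : ∀ n → low (LPΣ.nat n) ≡ 0
low-nat zero = refl
low-nat (suc n) = low-nat n

-- `low` is the stored shift: sums take the maximum, products add, and the constants involved have
-- shift 0. Hence 0 propagates through the structure and no coefficient has to be computed.
low-wsum : ∀ k n {g} → (∀ p → low (g p) ≡ 0) → low (wsum k n g) ≡ 0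
low-wsum zero n e = refl
low-wsum (suc k) zero e = e (leaf tt)
low-wsum (suc k) (suc n) e = low-diag n (λ i j → cong₂ ℕ._+_ (low-nat (suc i)) (low-wsum k i (λ a → low-wsum k j (λ b → e (graft a b)))))

low-fill : ∀ p {g} → (∀ r → low (g r) ≡ 0) → low (Fill.fill LP-semiring (false ∷ true ∷ []) p g) ≡ 0
low-fill (leaf _) e = cong₂ ℕ._⊔_ (e (leaf false)) (cong (ℕ._⊔ 0) (e (leaf true)))
low-fill (graft a b) e = low-fill a (λ r → low-fill b (λ s → e (graft r s)))

low-when : ∀ b n → low (when b (t^ n)) ≡ 0
low-when false n = refl
low-when true zero = refl
low-when true (suc n) = low-when true n

-- The stored shift depends on the presentation of a Laurent polynomial, its coefficients do not.
-- One presentation without a shift therefore suffices.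
polynomial : ∀ {p q} → low p ≡ 0 → p ≃ q → ∀ k → k < 0ℤ → coeff q k ≡ 0ℚ
polynomial {p} l e (+ _) (ℤ.+<+ ())
polynomial {p} l e -[1+ k ] _ = trans (sym (at e -[1+ k ]))
  (trans (coeff-nthℤ p -[1+ k ]) (cong (λ m → nthℤ (cs p) (-[1+ k ] ℤ.+ + m)) l))

theorem4p7 : Σ PS λ a∞ → Σ PS λ b∞ → Σ PS λ c∞ →
    -- coefficientwise convergence of (a_i, b_i, c_i)
    (∀ (n : ℕ) → Σ ℕ λ N → ∀ (i : ℕ) → N ≤ i →
        (A (iterT i) n ≈ a∞ n) × (B (iterT i) n ≈ b∞ n) × (C (iterT i) n ≈ c∞ n))
    -- the limits have coefficients in ℚ[t]
    × (∀ (n : ℕ) (k : ℤ) → k < 0ℤ →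
        (coeff (a∞ n) k ≡ 0ℚ) × (coeff (b∞ n) k ≡ 0ℚ) × (coeff (c∞ n) k ≡ 0ℚ))
    -- coefficient of x^0 (there are no trees with 0 vertices)
    × ((a∞ zero ≈ lp0) × (b∞ zero ≈ lp0) × (c∞ zero ≈ lp0))
    -- coefficient of x^(n+1): T_w^+ = a∞, T_w^- = b∞, T_b = c∞, T = a∞ + b∞ + c∞
    × (∀ (n : ℕ) (L : List (RTree n)) → IsTransversal L →
        (treeSum rootWhiteEven L ≈ a∞ (suc n))
        × (treeSum rootWhiteOdd L ≈ b∞ (suc n))
        × (treeSum rootBlack L ≈ c∞ (suc n))
        × (treeSum anyRoot L ≈ lpAdd (a∞ (suc n)) (lpAdd (b∞ (suc n)) (c∞ (suc n)))))
theorem4p7 = a∞ , b∞ , c∞ , converges , polynomials , (at A₀ , at B₀ , at C₀) , counts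
  where
  open Vanishes (vanishes 0)

  converges : ∀ n → Σ ℕ λ N → ∀ i → N ≤ i → (A (iterT i) n ≈ a∞ n) × (B (iterT i) n ≈ b∞ n) × (C (iterT i) n ≈ c∞ n)
  converges n = n , λ i n≤i → let c = iterates-limit n≤i in
    at (onA c n ℕP.≤-refl) , at (onB c n ℕP.≤-refl) , at (onC c n ℕP.≤-refl)

  polynomials : ∀ n k → k < 0ℤ → (coeff (a∞ n) k ≡ 0ℚ) × (coeff (b∞ n) k ≡ 0ℚ) × (coeff (c∞ n) k ≡ 0ℚ)
  polynomials zero k k<0 =
    polynomial {lp0} refl (≃-sym A₀) k k<0 , polynomial {lp0} refl (≃-sym B₀) k k<0 , polynomial {lp0} refl (≃-sym C₀) k k<0
  polynomials (suc n) k k<0 =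
    -- The tree sums are built without t⁻¹, unlike the iterates from which the limit is defined.
    polynomial (low-wsum (suc n) n (λ p → low-fill p (λ r → low-when (not (root r) ∧ isEven (blackChildren r)) (evenWhites r)))) (a∞-wsum n) k k<0 ,
    polynomial (low-wsum (suc n) n (λ p → low-fill p (λ r → low-when (not (root r) ∧ not (isEven (blackChildren r))) (evenWhites r)))) (b∞-wsum n) k k<0 ,
    polynomial (low-wsum (suc n) n (λ p → low-fill p (λ r → low-when (root r) (evenWhites r)))) (c∞-wsum n) k k<0

  counts : ∀ n (L : List (RTree n)) → IsTransversal L →
    (treeSum rootWhiteEven L ≈ a∞ (suc n)) × (treeSum rootWhiteOdd L ≈ b∞ (suc n)) × (treeSum rootBlack L ≈ c∞ (suc n)) ×
    (treeSum anyRoot L ≈ lpAdd (a∞ (suc n)) (lpAdd (b∞ (suc n)) (c∞ (suc n))))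
  counts n L trv =
    at (≃-trans (treeSum-even L trv) (a∞-wsum n)) ,
    at (≃-trans (treeSum-odd L trv) (b∞-wsum n)) ,
    at (≃-trans (treeSum-black L trv) (c∞-wsum n)) ,
    at (≃-trans (treeSum-any L trv) (lpAdd-cong (a∞-wsum n) (lpAdd-cong (b∞-wsum n) (c∞-wsum n))))
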